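{- Let $k$ and $n$ be positive integers. Let $\mathcal{H}=(V,E)$ be a hypergraph whose edges are colored with $k$ colors (a $k$-edge-coloring $E\to[k]$, $[k]=\{1,\dots,k\}$), and let $\alpha\in V$ be such that $$\mathrm{mult}_{\mathcal H}(\alpha^t,Y)=0\quad\text{for each } t>n \text{ and each } Y\subseteq V.$$ Then there exists an $(\alpha,n)$-detachment $\mathcal F$ of $\mathcal H$, with $\alpha$ split into $\alpha_1,\dots,\alpha_n$, such that $\mathcal F$ is $\alpha$-simple and the following conditions hold: (F1) for each $i\in[n]$, $\deg_{\mathcal F}(\alpha_i)\approx \deg_{\mathcal H}(\alpha)/n$; (F2) for each $i\in[n]$ and each $j\in[k]$, $\deg_{\mathcal F(j)}(\alpha_i)\approx \deg_{\mathcal H(j)}(\alpha)/n$; (F3) for each $U\subseteq\{\alpha_1,\dots,\alpha_n\}$ and each $X\subseteq V\setminus\{\alpha\}$, $$\mathrm{mult}_{\mathcal F}(U,X)\approx \frac{\mathrm{mult}_{\mathcal H}(\alpha^{|U|},X)}{\binom{n}{|U|}};$$ (F4) for each $U\subseteq\{\alpha_1,\dots,\alpha_n\}$, each $X\subseteq V\setminus\{\alpha\}$ and each $j\in[k]$, $$\mathrm{mult}_{\mathcal F(j)}(U,X)\approx \frac{\mathrm{mult}_{\mathcal H(j)}(\alpha^{|U|},X)}{\binom{n}{|U|}};$$ (C1) for each $j\in[k]$, $c(\mathcal F(j))=c(\mathcal H(j))$ if and only if $\deg_{\mathcal H(j)}(\alpha)-\omega_\alpha(\mathcal H(j))\geq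 n-1$.
   Context: A hypergraph $\mathcal G$ consists of a finite vertex set $V(\mathcal G)$ and a finite multiset $E(\mathcal G)$ of edges, each edge a nonempty finite multiset of vertices (edges may be repeated and a vertex may occur several times in an edge). $\deg_{\mathcal G}(v)$ is the total number of occurrences of $v$ in all edges (counted with all multiplicities). An edge is incident with $v$ if $v$ occurs in it. $\mathcal G$ is non-trivial if it has at least one edge. Sub-hypergraphs, unions and intersections are taken on vertex sets and edge multisets. $c(\mathcal G)$ is the number of connected components (an isolated vertex is a component). For multisets $U_1,\dots,U_s$ of vertices, $\mathrm{mult}_{\mathcal G}(U_1,\dots,U_s)$ is the number of edges (with repetition) equal to the multiset union $U_1\cup\dots\cup U_s$; $\{\alpha^t\}$ (written $\alpha^t$) is the multiset containing $\alpha$ exactly $t$ times. For a $k$-edge-coloring, the color class $\mathcal G(j)$ is the spanning sub-hypergraph (vertex set $V(\mathcal G)$) whose edges are those of color $j$. For reals, $x\approx y$ means $\lfloor y\rfloor\le x\le\lceil y\rceil$. $(\alpha,n)$-detachment: $\mathcal F$ is obtained from $\mathcal H$ by replacing $\alpha$ by $n$ new vertices $\alpha_1,\dots,\alpha_n$, replacing each edge $\{\alpha^p\}\cup U$ ($p\ge1$, $U$ a multiset not containing $\alpha$) by an edge $\{\alpha_1^{p_1},\dots,\alpha_n^{p_n}\}\cup U$ with $p_1+\dots+p_n=p$, and keeping all other vertices and edges; each edge keeps its color. $\mathcal F$ is $\alpha$-simple if no edge of $\mathcal F$ contains any $\alpha_i$ more than once. Wings: a vertex $\alpha$ of a connected hypergraph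 $\mathcal G$ is a cut vertex if there are non-trivial sub-hypergraphs $I,J$ with $I\cup J=\mathcal G$, $V(I\cap J)=\{\alpha\}$ and $E(I\cap J)=\varnothing$. A sub-hypergraph $W$ of $\mathcal G$ with $\alpha\in V(W)$ is an $\alpha$-wing of $\mathcal G$ if $W$ is non-trivial and connected, $\alpha$ is not a cut vertex of $W$, and no edge of $E(\mathcal G)\setminus E(W)$ is incident with a vertex of $V(W)\setminus\{\alpha\}$. $\omega_\alpha(\mathcal G)$ is the number of $\alpha$-wings of $\mathcal G$.
   Formalization: In the hypothesis mult(α^t,Y)=0, Y ranges over all multisets of vertices, not only subsets of V: with sets the claim fails (n=1, one edge {α²,u²}), as no α-simple detachment exists if an edge contains α more than n times; X in (F3), (F4) is likewise any multiset over V∖{α}. -}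

module Defs where

open import Data.Nat using (ℕ; zero; suc; _+_; _*_; _∸_; _≤_; _<_)
open import Data.Nat.DivMod using (_/_)
open import Data.Bool using (Bool; true; false)
open import Data.Fin as Fin using (Fin; _↑ˡ_; _↑ʳ_)
open import Data.Fin.Subset as Sub using (Subset; _∪_; _∩_; ⁅_⁆)
open import Data.Vec as Vec using (Vec; lookup; insertAt; take; drop; updateAt)
open import Data.Vec.Properties using (≡-dec)
open import Data.List as List using (List; map; filter; length)
open import Data.Nat.ListAction using () renaming (sum to listSum)
open import Data.List.Relation.Unary.All using (All)
open import Data.List.Relation.Binary.Pointwise using (Pointwise)
open import Data.List.Relation.Unary.Unique.Propositional using (Unique)
import Data.List.Membership.Propositional as LMem
open import Data.Product using (Σ; ∃; _×_; _,_; proj₁; proj₂)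
open import Relation.Nullary using (¬_)
open import Relation.Binary.PropositionalEquality using (_≡_; _≢_)
open import Relation.Binary.Construct.Closure.ReflexiveTransitive using (Star)
open import Function.Bundles using (_⇔_)

-- Hypergraphs.
-- The vertex set of a hypergraph on m vertices is Fin m.
-- An edge is a finite multiset of vertices, represented by its
-- multiplicity vector (entry v = number of occurrences of v).

Edge : ℕ → Set
Edge m = Vec ℕ m

MSet : ℕ → Set
MSet m = Vec ℕ m

-- A (raw) hypergraph on vertex set Fin m: its multiset of edges,
-- given as a list (repeated edges allowed; list positions label the
-- parallel edges as distinct elements of the edge multiset).
Hyp : ℕ → Set
Hyp m = List (Edge m)

record CHyp (m k : ℕ) : Set where
  field
    edges    : List (Edge m × Fin k)
    nonempty : All (λ ec → 0 < Vec.sum (proj₁ ec)) edges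
open CHyp public

underlying : ∀ {m k} → CHyp m k → Hyp m
underlying H = map proj₁ (edges H)

colourClass : ∀ {m k} → CHyp m k → Fin k → Hyp m
colourClass H j = map proj₁ (filter (λ ec → proj₂ ec Fin.≟ j) (edges H))

deg : ∀ {m} → Hyp m → Fin m → ℕ
deg G v = listSum (map (λ e → lookup e v) G)

mult : ∀ {m} → Hyp m → MSet m → ℕ
mult G U = length (filter (λ e → ≡-dec Data.Nat._≟_ e U) G)

setMS : ∀ {m} → Subset m → MSet m
setMS = Vec.map (λ { true → 1 ; false → 0 })

addCopies : ∀ {m} → Fin m → ℕ → MSet m → MSet m
addCopies α t Y = updateAt Y α (t +_)

-- Approximation  x ≈ y / d  :  ⌊ y/d ⌋ ≤ x ≤ ⌈ y/d ⌉   (only used with d ≥ 1)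

⌊_/_⌋ : ℕ → ℕ → ℕ
⌊ y / zero  ⌋ = 0
⌊ y / suc d ⌋ = y / suc d

⌈_/_⌉ : ℕ → ℕ → ℕ
⌈ y / zero  ⌉ = 0
⌈ y / suc d ⌉ = (y + d) / suc d

_≈_/_ : ℕ → ℕ → ℕ → Set
x ≈ y / d = ⌊ y / d ⌋ ≤ x × x ≤ ⌈ y / d ⌉

-- (α,n)-detachments.
-- If H has vertex set Fin (suc m) and α : Fin (suc m), the detachment F
-- has vertex set Fin (n + m): vertex  i ↑ˡ m  is α_(i+1) (i : Fin n) and
-- vertex  n ↑ʳ u  is the old vertex  Fin.punchIn α u  of H (the vertices
-- of V ∖ {α}, in order).  An edge eF of F is obtained from the edge eH
-- of H iff eH is eF with α_1,…,α_n merged back into α, i.e. the part of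
-- eF outside the α_i agrees with eH off α and p₁+⋯+pₙ = p.

DetachedEdge : ∀ {m} (α : Fin (suc m)) (n : ℕ) → Edge (n + m) → Edge (suc m) → Set
DetachedEdge {m} α n eF eH = eH ≡ insertAt (drop n eF) α (Vec.sum (take n eF))

IsDetachment : ∀ {m k} (α : Fin (suc m)) (n : ℕ) → CHyp (n + m) k → CHyp (suc m) k → Set
IsDetachment α n F H =
  Pointwise (λ f h → DetachedEdge α n (proj₁ f) (proj₁ h) × proj₂ f ≡ proj₂ h)
            (edges F) (edges H)

αᵢ : ∀ {n} (m : ℕ) → Fin n → Fin (n + m)
αᵢ m i = i ↑ˡ m

detMS : ∀ {n m} → Subset n → MSet m → MSet (n + m)
detMS U X = setMS U Vec.++ X

origMS : ∀ {m} → Fin (suc m) → ℕ → MSet m → MSet (suc m)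
origMS α t X = insertAt X α t

αSimple : ∀ {m k} (n : ℕ) → CHyp (n + m) k → Set
αSimple {m} n F = All (λ ec → ∀ (i : Fin n) → lookup (proj₁ ec) (αᵢ m i) ≤ 1) (edges F)

Adjacent : ∀ {m} → Hyp m → Fin m → Fin m → Set
Adjacent G u v = ∃ λ e → e LMem.∈ G × 0 < lookup e u × 0 < lookup e v

Connected : ∀ {m} → Hyp m → Fin m → Fin m → Set
Connected G = Star (Adjacent G)

HasComponents : ∀ {m} → Hyp m → ℕ → Set
HasComponents {m} G c =
  Σ (Fin m → Fin c) λ comp →
    (∀ (a : Fin c) → ∃ λ v → comp v ≡ a) ×
    (∀ u v → (comp u ≡ comp v) ⇔ Connected G u v)

-- Sub-hypergraphs and wings.
-- Sub-hypergraphs of G are pairs (S , T): a vertex subset S and a subset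
-- T of the (labelled) edges of G, every edge of T having all its
-- vertices in S.

module _ {m : ℕ} (G : Hyp m) where

  private
    e = length G
    E : Fin e → Edge m
    E = List.lookup G

  Incident : Fin e → Fin m → Set
  Incident i v = 0 < lookup (E i) v

  SubHyp : Subset m → Subset e → Set
  SubHyp S T = ∀ i → i Sub.∈ T → ∀ v → Incident i v → v Sub.∈ S

  NonTrivial : Subset e → Set
  NonTrivial T = ∃ λ i → i Sub.∈ T

  AdjacentIn : Subset e → Fin m → Fin m → Set
  AdjacentIn T u v = ∃ λ i → i Sub.∈ T × Incident i u × Incident i v

  ConnectedSub : Subset m → Subset e → Set
  ConnectedSub S T = ∀ u v → u Sub.∈ S → v Sub.∈ S → Star (AdjacentIn T) u v

  CutVertex : Fin m → Subset m → Subset e → Set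
  CutVertex α S T =
    ∃ λ S₁ → ∃ λ T₁ → ∃ λ S₂ → ∃ λ T₂ →
      SubHyp S₁ T₁ × SubHyp S₂ T₂ × NonTrivial T₁ × NonTrivial T₂ ×
      (S₁ ∪ S₂ ≡ S) × (T₁ ∪ T₂ ≡ T) ×
      (S₁ ∩ S₂ ≡ ⁅ α ⁆) × (T₁ ∩ T₂ ≡ Sub.⊥)

  IsWing : Fin m → Subset m × Subset e → Set
  IsWing α (S , T) =
    α Sub.∈ S × SubHyp S T × NonTrivial T × ConnectedSub S T ×
    ¬ CutVertex α S T ×
    (∀ i → i Sub.∉ T → ∀ v → v Sub.∈ S → v ≢ α → ¬ Incident i v)

  WingCount : Fin m → ℕ → Set
  WingCount α w =
    ∃ λ (L : List (Subset m × Subset e)) →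
      Unique L × (∀ W → (W LMem.∈ L) ⇔ IsWing α W) × length L ≡ w

-- The new vertices are split off one at a time.  While ν of them remain, every edge distributes its
-- copies of α over ν slots so that all slots get equally many copies, up to one, from every member of two
-- laminar families: all edges ⊃ a colour ⊃ its wings of degree at least 2 ⊃ a wing, and a type ⊃ a
-- coloured type.  Two slots can always be balanced against each other, because pairing up edges along each
-- family gives two matchings, whose union is bipartite; balancing an unbalanced pair decreases the sum of
-- the squared loads, so the process ends.  One slot becomes the new vertex, and the roundings compose.
--
-- If the wings of a colour have degrees d_W, then deg α − ω_α = Σ (d_W − 1), called the excess.  When it is
-- at least ν − 1, the wings of degree at least 2 together have at least ν copies of α, so the new vertex
-- shares a wing with what remains of α; joining the wings it meets lowers the excess by at most 1, and the
-- recursion connects all parts.  Conversely, connecting n parts needs an excess of at least n − 1.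

module Submission where

open import Defs
open import Data.Bool as Bool using (Bool; true; false; not; if_then_else_)
open import Data.Bool.Properties using (not-involutive)
open import Data.Empty using (⊥; ⊥-elim)
open import Data.Fin as Fin using (Fin; zero; suc; _↑ˡ_; _↑ʳ_; splitAt; punchIn; punchOut)
open import Data.Fin.Properties
  using (all?; any?; ¬∀⟶∃¬; suc-injective; injective⇒≤; punchOut-injective; punchIn-injective; punchIn-punchOut;
         punchOut-punchIn; punchOut-cong′; punchInᵢ≢i; splitAt-↑ˡ; splitAt-↑ʳ; splitAt⁻¹-↑ˡ; splitAt⁻¹-↑ʳ; ↑ˡ-injective)
open import Data.Fin.Subset as Sub using (Subset; ∣_∣; _∪_; _∩_; ⁅_⁆)
import Data.Fin.Subset.Properties as Sub
open import Data.List as List using (List; []; _∷_; map; filter; length; allFin; _++_; concatMap; cartesianProduct)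
import Data.List.Properties as List
open import Data.List.Membership.Propositional using (_∈_; _∉_; find; lose)
open import Data.List.Membership.Propositional.Properties
  using (∈-map⁺; ∈-map⁻; ∈-++⁺ˡ; ∈-filter⁺; ∈-filter⁻; ∈-lookup; ∈-allFin; ∈-concatMap⁺; ∈-cartesianProduct⁺)
open import Data.List.Membership.Propositional.Properties.WithK using (unique∧set⇒bag)
open import Data.List.Relation.Binary.BagAndSetEquality using (∼bag⇒↭)
open import Data.List.Relation.Binary.Permutation.Propositional
  using (_↭_; ↭-refl; ↭-sym; ↭-trans; prep; swap; ↭⇒↭ₛ; module PermutationReasoning)
open import Data.List.Relation.Binary.Permutation.Propositional.Properties as Perm
  using (++-assoc; ++-comm; ++⁺ˡ; ++⁺ʳ; shift; ∈-resp-↭; ↭-length)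
import Data.List.Relation.Binary.Permutation.Setoid.Properties as PermS
open import Data.List.Relation.Binary.Pointwise using (Pointwise; []; _∷_)
open import Data.List.Relation.Unary.All as All using (All; []; _∷_)
open import Data.List.Relation.Unary.All.Properties using (¬All⇒Any¬)
  renaming (++⁺ to All-++⁺; ++⁻ʳ to All-++⁻ʳ; ++⁻ˡ to All-++⁻ˡ; map⁺ to All-map⁺; map⁻ to All-map⁻)
open import Data.List.Relation.Unary.AllPairs using (AllPairs; []; _∷_)
open import Data.List.Relation.Unary.Any as Any using (Any; here; there)
open import Data.List.Relation.Unary.Any.Properties using (lookup-index)
open import Data.List.Relation.Unary.Unique.Propositional using (Unique)
import Data.List.Relation.Unary.Unique.Propositional.Properties as Unique
open import Data.Maybe using (Maybe; just; nothing)
open import Data.Nat hiding (_≟_; _/_)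
open import Data.Nat.Combinatorics using (_C_; nCk+nC[k+1]≡[n+1]C[k+1]; k>n⇒nCk≡0; nC1≡n)
open import Data.Nat.DivMod using (/-monoˡ-≤; m*n/n≡m; m<n*o⇒m/o<n)
open import Data.Nat.Induction using (<-wellFounded)
open import Data.Nat.ListAction using (sum)
open import Data.Nat.ListAction.Properties using (sum-++; sum-↭)
open import Data.Nat.Properties as ℕ hiding (_≟_; suc-injective)
open import Data.Nat.Tactic.RingSolver using (solve-∀)
open import Data.Product using (Σ; ∃; _×_; _,_; proj₁; proj₂)
open import Data.Sum using (_⊎_; inj₁; inj₂; [_,_]′)
open import Data.Sum.Properties using (≡-dec; inj₁-injective; inj₂-injective)
open import Data.Unit using (tt)
import Data.Unit.Properties as Unit
open import Data.Vec as Vec using (Vec; lookup; insertAt; removeAt; updateAt; take; drop; []; _∷_)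
import Data.Vec.Properties as Vec
open import Function using (_∘_; id)
open import Function.Bundles using (_⇔_; mk⇔; Equivalence)
open import Induction.WellFounded using (Acc; acc)
open import Relation.Binary.Construct.Closure.ReflexiveTransitive using (Star; ε; _◅_; _◅◅_)
open import Relation.Binary.Definitions using (DecidableEquality)
open import Relation.Binary.PropositionalEquality
open import Relation.Nullary using (Dec; yes; no; does; ¬_; ¬?)
open import Relation.Nullary.Decidable using (_×-dec_; _⊎-dec_; map′)

-- Two chains are the limit of the method: the union of two matchings has only even cycles and can
-- be coloured alternately, while three matchings may close an odd cycle. All requirements must
-- therefore fit into two laminar families; degrees and connectivity share one chain, multiplicities
-- take the other. The level of wings of degree at least 2 serves connectivity alone. A wing with a
-- single copy of α links no parts, and balance over single wings and whole colours would still
-- allow the new vertex to take all its copies from such wings; it would then be cut off from the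
-- other parts in that colour. The excess can in fact drop by more than one, but only if some wing
-- gives the new vertex at least two copies. Balance over that wing then leaves at least ν - 1
-- copies in it, which alone suffices for the remaining ν - 1 parts.

private
  variable
    A B : Set
    m n k N M ν : ℕ

-- Sums and indicators

b2n : Bool → ℕ
b2n false = 0
b2n true  = 1

𝟙 : {P : Set} → Dec P → ℕ
𝟙 d = b2n (does d)

∑ : {A : Set} → List A → (A → ℕ) → ℕ
∑ xs f = sum (map f xs)

𝟙-yes : {P : Set} (d : Dec P) → P → 𝟙 d ≡ 1
𝟙-yes (yes _) _ = refl
𝟙-yes (no ¬p) p = ⊥-elim (¬p p)

𝟙-no : {P : Set} (d : Dec P) → ¬ P → 𝟙 d ≡ 0
𝟙-no (yes p) ¬p = ⊥-elim (¬p p)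
𝟙-no (no _) _ = refl

𝟙-cong : {P Q : Set} (d : Dec P) (d′ : Dec Q) → (P → Q) → (Q → P) → 𝟙 d ≡ 𝟙 d′
𝟙-cong (yes p) d′ f g = sym (𝟙-yes d′ (f p))
𝟙-cong (no ¬p) d′ f g = sym (𝟙-no d′ (¬p ∘ g))

b2n≤1 : ∀ b → b2n b ≤ 1
b2n≤1 false = z≤n
b2n≤1 true  = ≤-refl

∑-cong : {f g : A → ℕ} → (∀ x → f x ≡ g x) → ∀ xs → ∑ xs f ≡ ∑ xs g
∑-cong eq xs = cong sum (List.map-cong eq xs)

∑-mono : {f g : A → ℕ} → (∀ x → f x ≤ g x) → ∀ xs → ∑ xs f ≤ ∑ xs g
∑-mono le [] = z≤n
∑-mono le (x ∷ xs) = +-mono-≤ (le x) (∑-mono le xs)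

∑-mono-< : {f g : A → ℕ} → (∀ x → f x ≤ g x) → ∀ {x xs} → x ∈ xs → f x < g x → ∑ xs f < ∑ xs g
∑-mono-< le {xs = _ ∷ xs} (here refl) lt = +-mono-<-≤ lt (∑-mono le xs)
∑-mono-< le (there x∈) lt = +-mono-≤-< (le _) (∑-mono-< le x∈ lt)

∑-+ : ∀ xs (f g : A → ℕ) → ∑ xs (λ x → f x + g x) ≡ ∑ xs f + ∑ xs g
∑-+ [] f g = refl
∑-+ (x ∷ xs) f g = begin
  f x + g x + ∑ xs (λ x → f x + g x)  ≡⟨ cong (f x + g x +_) (∑-+ xs f g) ⟩
  f x + g x + (∑ xs f + ∑ xs g)       ≡⟨ interchange (f x) (g x) _ _ ⟩
  f x + ∑ xs f + (g x + ∑ xs g)       ∎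
  where
  open ≡-Reasoning
  interchange : ∀ a b c d → a + b + (c + d) ≡ a + c + (b + d)
  interchange = solve-∀

∑-*ˡ : ∀ c xs (f : A → ℕ) → ∑ xs (λ x → c * f x) ≡ c * ∑ xs f
∑-*ˡ c [] f = sym (*-zeroʳ c)
∑-*ˡ c (x ∷ xs) f = trans (cong (c * f x +_) (∑-*ˡ c xs f)) (sym (*-distribˡ-+ c (f x) _))

∑-zero : ∀ (xs : List A) → ∑ xs (λ _ → 0) ≡ 0
∑-zero [] = refl
∑-zero (x ∷ xs) = ∑-zero xs

∑-const : ∀ c (xs : List A) → ∑ xs (λ _ → c) ≡ length xs * c
∑-const c [] = refl
∑-const c (x ∷ xs) = cong (c +_) (∑-const c xs)

∑-swap : ∀ (xs : List A) (ys : List B) (f : A → B → ℕ) →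
         ∑ xs (λ x → ∑ ys (f x)) ≡ ∑ ys (λ y → ∑ xs (λ x → f x y))
∑-swap [] ys f = sym (∑-zero ys)
∑-swap (x ∷ xs) ys f = trans (cong (∑ ys (f x) +_) (∑-swap xs ys f)) (sym (∑-+ ys (f x) _))

∑-++ : ∀ xs ys (f : A → ℕ) → ∑ (xs ++ ys) f ≡ ∑ xs f + ∑ ys f
∑-++ xs ys f = trans (cong sum (List.map-++ f xs ys)) (sum-++ (map f xs) _)

∑-↭ : ∀ {xs ys} (f : A → ℕ) → xs ↭ ys → ∑ xs f ≡ ∑ ys f
∑-↭ f p = sum-↭ (Perm.map⁺ f p)

∑-map : ∀ (g : A → B) xs (f : B → ℕ) → ∑ (map g xs) f ≡ ∑ xs (f ∘ g)
∑-map g xs f = cong sum (sym (List.map-∘ xs))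

∑-filter : {P : A → Set} (P? : ∀ x → Dec (P x)) → ∀ xs (f : A → ℕ) →
           ∑ (filter P? xs) f ≡ ∑ xs (λ x → 𝟙 (P? x) * f x)
∑-filter P? [] f = refl
∑-filter P? (x ∷ xs) f with P? x
... | yes _ = cong₂ _+_ (sym (+-identityʳ (f x))) (∑-filter P? xs f)
... | no _  = ∑-filter P? xs f

length-filter-∑ : {P : A → Set} (P? : ∀ x → Dec (P x)) → ∀ xs → length (filter P? xs) ≡ ∑ xs (λ x → 𝟙 (P? x))
length-filter-∑ P? [] = refl
length-filter-∑ P? (x ∷ xs) with P? x
... | yes _ = cong suc (length-filter-∑ P? xs)
... | no _  = length-filter-∑ P? xs

∈⇒≤∑ : ∀ (f : A → ℕ) {x xs} → x ∈ xs → f x ≤ ∑ xs f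
∈⇒≤∑ f (here refl) = m≤m+n _ _
∈⇒≤∑ f (there x∈) = ≤-trans (∈⇒≤∑ f x∈) (m≤n+m _ _)

0<∑⇒∃ : ∀ (f : A → ℕ) xs → 0 < ∑ xs f → ∃ λ x → x ∈ xs × 0 < f x
0<∑⇒∃ f (x ∷ xs) lt with f x in eq
... | suc _ = x , here refl , subst (0 <_) (sym eq) z<s
... | zero with 0<∑⇒∃ f xs lt
... | y , y∈ , p = y , there y∈ , p

∑-δ : ∀ (a : Fin n) (f : Fin n → ℕ) → ∑ (allFin n) (λ x → 𝟙 (a Fin.≟ x) * f x) ≡ f a
∑-δ {n} a f = go (Unique.allFin⁺ n) (∈-allFin a)
  where
  none : ∀ {xs} → All (a ≢_) xs → ∑ xs (λ x → 𝟙 (a Fin.≟ x) * f x) ≡ 0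
  none [] = refl
  none {x ∷ _} (a≢ ∷ as) = cong₂ _+_ (cong (_* f x) (𝟙-no (a Fin.≟ x) a≢)) (none as)
  go : ∀ {xs} → Unique xs → a ∈ xs → ∑ xs (λ x → 𝟙 (a Fin.≟ x) * f x) ≡ f a
  go (p ∷ u) (here refl) = trans (cong₂ _+_ (cong (_* f a) (𝟙-yes (a Fin.≟ a) refl)) (none p))
                             (trans (+-identityʳ _) (+-identityʳ _))
  go {x ∷ _} (p ∷ u) (there a∈) = cong₂ _+_ (cong (_* f x) (𝟙-no (a Fin.≟ x) (λ a≡x → All.lookup p a∈ (sym a≡x)))) (go u a∈)

-- The equations relating f and g are arranged so that no subtraction occurs.
∑-point : ∀ (a : Fin n) (f g : Fin n → ℕ) → (∀ x → x ≢ a → f x ≡ g x) →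
          ∑ (allFin n) f + g a ≡ ∑ (allFin n) g + f a
∑-point {n} a f g eq = begin
  ∑ (allFin n) f + g a
    ≡⟨ cong (∑ (allFin n) f +_) (∑-δ a (λ _ → g a)) ⟨
  ∑ (allFin n) f + ∑ (allFin n) (λ x → 𝟙 (a Fin.≟ x) * g a)
    ≡⟨ ∑-+ (allFin n) f _ ⟨
  ∑ (allFin n) (λ x → f x + 𝟙 (a Fin.≟ x) * g a)
    ≡⟨ ∑-cong pointwise (allFin n) ⟩
  ∑ (allFin n) (λ x → g x + 𝟙 (a Fin.≟ x) * f a)
    ≡⟨ ∑-+ (allFin n) g _ ⟩
  ∑ (allFin n) g + ∑ (allFin n) (λ x → 𝟙 (a Fin.≟ x) * f a)
    ≡⟨ cong (∑ (allFin n) g +_) (∑-δ a (λ _ → f a)) ⟩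
  ∑ (allFin n) g + f a ∎
  where
  open ≡-Reasoning
  pointwise : ∀ x → f x + 𝟙 (a Fin.≟ x) * g a ≡ g x + 𝟙 (a Fin.≟ x) * f a
  pointwise x with a Fin.≟ x
  ... | yes refl = comm (f a) (g a)
    where comm : ∀ a b → a + (b + 0) ≡ b + (a + 0)
          comm = solve-∀
  ... | no a≢x = cong (_+ 0) (eq x (a≢x ∘ sym))

∑-point₂ : ∀ (a b : Fin n) → a ≢ b → (f g : Fin n → ℕ) → (∀ x → x ≢ a → x ≢ b → f x ≡ g x) →
           ∑ (allFin n) f + (g a + g b) ≡ ∑ (allFin n) g + (f a + f b)
∑-point₂ {n} a b a≢b f g eq = begin
  ∑ (allFin n) f + (g a + g b)   ≡⟨ +-assoc (∑ (allFin n) f) _ _ ⟨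
  ∑ (allFin n) f + g a + g b     ≡⟨ cong (λ z → ∑ (allFin n) f + z + g b) (sym ha) ⟩
  ∑ (allFin n) f + h a + g b     ≡⟨ cong (_+ g b) (∑-point a f h off-a) ⟩
  ∑ (allFin n) h + f a + g b     ≡⟨ shuffle (∑ (allFin n) h) _ _ ⟩
  ∑ (allFin n) h + g b + f a     ≡⟨ cong (_+ f a) (∑-point b h g off-b) ⟩
  ∑ (allFin n) g + h b + f a     ≡⟨ cong (λ z → ∑ (allFin n) g + z + f a) hb ⟩
  ∑ (allFin n) g + f b + f a     ≡⟨ shuffle′ (∑ (allFin n) g) _ _ ⟩
  ∑ (allFin n) g + (f a + f b)   ∎
  where
  open ≡-Reasoning
  shuffle : ∀ a b c → a + b + c ≡ a + c + b
  shuffle = solve-∀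
  shuffle′ : ∀ a b c → a + b + c ≡ a + (c + b)
  shuffle′ = solve-∀
  -- `h` is `f` with its value at `a` replaced by that of `g`; it differs from `f` only at `a` and
  -- from `g` only at `b`, so the one-point lemma applies twice.
  h : Fin _ → ℕ
  h x = if does (x Fin.≟ a) then g a else f x
  ha : h a ≡ g a
  ha with a Fin.≟ a
  ... | yes _ = refl
  ... | no ≢ = ⊥-elim (≢ refl)
  hb : h b ≡ f b
  hb with b Fin.≟ a
  ... | yes b≡a = ⊥-elim (a≢b (sym b≡a))
  ... | no _ = refl
  off-a : ∀ x → x ≢ a → f x ≡ h x
  off-a x x≢a with x Fin.≟ a
  ... | yes p = ⊥-elim (x≢a p)
  ... | no _ = refl
  off-b : ∀ x → x ≢ b → h x ≡ g x
  off-b x x≢b with x Fin.≟ a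
  ... | yes refl = refl
  ... | no x≢a = eq x x≢a x≢b

-- Alternating colourings of two matchings

flat : List (A × A) → List A
flat [] = []
flat ((x , y) ∷ ps) = x ∷ y ∷ flat ps

flat-++ : ∀ (ps qs : List (A × A)) → flat (ps ++ qs) ≡ flat ps ++ flat qs
flat-++ [] qs = refl
flat-++ ((x , y) ∷ ps) qs = cong (λ l → x ∷ y ∷ l) (flat-++ ps qs)

Alternates : (A → Bool) → List (A × A) → Set
Alternates c = All (λ p → c (proj₂ p) ≡ not (c (proj₁ p)))

Unique-↭ : {xs ys : List A} → xs ↭ ys → Unique xs → Unique ys
Unique-↭ p = PermS.Unique-resp-↭ (setoid _) (↭⇒↭ₛ p)

module _ {A : Set} (_≟_ : DecidableEquality A) where

  infixl 8 _[_≔_]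
  _[_≔_] : (A → Bool) → A → Bool → A → Bool
  (c [ x ≔ b ]) z = if does (z ≟ x) then b else c z

  update-same : ∀ c x b → (c [ x ≔ b ]) x ≡ b
  update-same c x b with x ≟ x
  ... | yes _ = refl
  ... | no ≢ = ⊥-elim (≢ refl)

  update-other : ∀ c {x z} b → z ≢ x → (c [ x ≔ b ]) z ≡ c z
  update-other c {x} {z} b z≢x with z ≟ x
  ... | yes z≡x = ⊥-elim (z≢x z≡x)
  ... | no _ = refl

  alternates-cong : ∀ {c c′} (ps : List (A × A)) → (∀ z → z ∈ flat ps → c′ z ≡ c z) → Alternates c ps → Alternates c′ ps
  alternates-cong [] eq [] = []
  alternates-cong ((x , y) ∷ ps) eq (p ∷ alt) =
    trans (eq y (there (here refl))) (trans p (cong not (sym (eq x (here refl))))) ∷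
    alternates-cong ps (λ z z∈ → eq z (there (there z∈))) alt

  alternates-update : ∀ {c x b} (ps : List (A × A)) → x ∉ flat ps → Alternates c ps → Alternates (c [ x ≔ b ]) ps
  alternates-update {c} {x} {b} ps x∉ =
    alternates-cong ps (λ z z∈ → update-other c b (λ { refl → x∉ z∈ }))

  -- Pairs carry no direction, so `x` may be found in either position. The last component puts the
  -- removed pair back once the rest has been coloured.
  partner : ∀ {x : A} (ps : List (A × A)) → x ∈ flat ps → ∃ λ y → ∃ λ qs → flat ps ↭ x ∷ y ∷ flat qs ×
            (∀ (c : A → Bool) → c y ≡ not (c x) → Alternates c qs → Alternates c ps)
  partner ((x , y) ∷ ps) (here refl) = y , ps , ↭-refl , λ c p alt → p ∷ alt
  partner ((y , x) ∷ ps) (there (here refl)) =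
    y , ps , swap y x ↭-refl , λ c p alt → trans (sym (not-involutive (c x))) (cong not (sym p)) ∷ alt
  partner {x} ((u , v) ∷ ps) (there (there x∈)) with partner ps x∈
  ... | y , qs , perm , f =
    y , (u , v) ∷ qs ,
    ↭-trans (prep u (prep v perm)) (move u v x y (flat qs)) ,
    λ { c p (q ∷ alt) → q ∷ f c p alt }
    where
    move : ∀ u v x y (l : List A) → u ∷ v ∷ x ∷ y ∷ l ↭ x ∷ y ∷ u ∷ v ∷ l
    move u v x y l = ++-comm-head (u ∷ v ∷ []) (x ∷ y ∷ []) l
      where
      ++-comm-head : ∀ (k m l : List A) → k ++ m ++ l ↭ m ++ k ++ l
      ++-comm-head k m l = ↭-trans (↭-sym (++-assoc k m l)) (↭-trans (++⁺ʳ l (++-comm k m)) (++-assoc m k l))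

  ∉-head : ∀ {x : A} {xs} → Unique (x ∷ xs) → x ∉ xs
  ∉-head (p ∷ _) x∈ = All.lookup p x∈ refl

  alternating₁ : ∀ (qs : List (A × A)) → Unique (flat qs) → ∃ λ (c : A → Bool) → Alternates c qs
  alternating₁ [] u = (λ _ → true) , []
  alternating₁ ((x , y) ∷ qs) u@(_ ∷ u′@(_ ∷ u″)) with alternating₁ qs u″
  ... | c , alt = c [ x ≔ true ] [ y ≔ false ] ,
      trans (update-same (c [ x ≔ true ]) y false)
            (cong not (sym (trans (update-other (c [ x ≔ true ]) false (λ { refl → ∉-head u (here refl) })) (update-same c x true)))) ∷
      alternates-update qs (∉-head u′) (alternates-update qs (∉-head u ∘ there) alt)

  -- Two matchings have a common alternating colouring: contract a pair (x , y) of the first one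
  -- by joining the partners of x and y in the second one.
  alternating₂ : ∀ (ps qs : List (A × A)) → Unique (flat ps) → Unique (flat qs) → (∀ {z} → z ∈ flat ps → z ∈ flat qs) →
                 ∃ λ (c : A → Bool) → Alternates c ps × Alternates c qs
  alternating₂ [] qs _ uq _ with alternating₁ qs uq
  ... | c , alt = c , [] , alt
  alternating₂ ((x , y) ∷ ps) qs up@(_ ∷ up′@(_ ∷ up″)) uq ⊆ with partner qs (⊆ (here refl))
  ... | x′ , qs₁ , perm₁ , extend₁ with Unique-↭ perm₁ uq | y ≟ x′
  -- Here `x` and `y` are paired in both matchings and form a component of their own, so they can be
  -- coloured independently of the rest.
  ... | u₁@(_ ∷ u₁′@(_ ∷ u₁″)) | yes refl with
          alternating₂ ps qs₁ up″ u₁″ rest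
    where
    rest : ∀ {z} → z ∈ flat ps → z ∈ flat qs₁
    rest z∈ with ∈-resp-↭ perm₁ (⊆ (there (there z∈)))
    ... | here refl = ⊥-elim (∉-head up (there z∈))
    ... | there (here refl) = ⊥-elim (∉-head up′ z∈)
    ... | there (there z∈′) = z∈′
  ... | c , altp , altq =
    c′ , xy ∷ keep ps (∉-head up ∘ there) (∉-head up′) altp ,
    extend₁ c′ xy (keep qs₁ (∉-head u₁ ∘ there) (∉-head u₁′) altq)
    where
    c′ = c [ x ≔ true ] [ y ≔ false ]
    xy : c′ y ≡ not (c′ x)
    xy = trans (update-same (c [ x ≔ true ]) y false)
           (cong not (sym (trans (update-other (c [ x ≔ true ]) false (λ { refl → ∉-head up (here refl) })) (update-same c x true))))
    keep : ∀ rs → x ∉ flat rs → y ∉ flat rs → Alternates c rs → Alternates c′ rs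
    keep rs x∉ y∉ alt = alternates-update rs y∉ (alternates-update rs x∉ alt)
  alternating₂ ((x , y) ∷ ps) qs up@(_ ∷ up′@(_ ∷ up″)) uq ⊆ | x′ , qs₁ , perm₁ , extend₁ | u₁@(_ ∷ u₁′) | no y≢x′ with
          partner qs₁ y∈
    where
    -- `y` has a partner because the second matching covers the first; `rest` below preserves this
    -- covering after the contraction.
    y∈ : y ∈ flat qs₁
    y∈ with ∈-resp-↭ perm₁ (⊆ (there (here refl)))
    ... | here refl = ⊥-elim (∉-head up (here refl))
    ... | there (here y≡x′) = ⊥-elim (y≢x′ y≡x′)
    ... | there (there y∈′) = y∈′
  ... | y′ , qs₂ , perm₂ , extend₂ with Unique-↭ (prep x (prep x′ perm₂)) u₁
  ... | v₁@(_ ∷ v₂@(v₂≢ ∷ v₃@(_ ∷ v₄))) with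
          alternating₂ ps ((x′ , y′) ∷ qs₂) up″ (All.tail v₂≢ ∷ v₄) rest
    where
    rest : ∀ {z} → z ∈ flat ps → z ∈ x′ ∷ y′ ∷ flat qs₂
    rest z∈ with ∈-resp-↭ (↭-trans perm₁ (prep x (prep x′ perm₂))) (⊆ (there (there z∈)))
    ... | here refl = ⊥-elim (∉-head up (there z∈))
    ... | there (here refl) = here refl
    ... | there (there (here refl)) = ⊥-elim (∉-head up′ z∈)
    ... | there (there (there z∈′)) = there z∈′
  ... | c , altp , (x′y′ ∷ altq) =
    c′ , xy ∷ keep ps (∉-head up ∘ there) (∉-head up′) altp ,
    extend₁ c′ xx′ (extend₂ c′ yy′ (keep qs₂ (∉-head v₁ ∘ there ∘ there ∘ there) (∉-head v₃ ∘ there) altq))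
    where
    -- The joined pair `(x′ , y′)` has opposite colours, so giving `x` and `y` the opposites of
    -- their partners' colours makes them differ as well.
    c′ = c [ x ≔ not (c x′) ] [ y ≔ not (c y′) ]
    x≢y : x ≢ y
    x≢y refl = ∉-head up (here refl)
    c′x : c′ x ≡ not (c x′)
    c′x = trans (update-other (c [ x ≔ not (c x′) ]) _ x≢y) (update-same c x _)
    c′y : c′ y ≡ not (c y′)
    c′y = update-same (c [ x ≔ not (c x′) ]) y _
    c′-other : ∀ {z} → z ≢ x → z ≢ y → c′ z ≡ c z
    c′-other z≢x z≢y = trans (update-other (c [ x ≔ not (c x′) ]) _ z≢y) (update-other c _ z≢x)
    xy : c′ y ≡ not (c′ x)
    xy = trans c′y (cong not (trans x′y′ (sym c′x)))
    flip-not : ∀ {b b′ d d′} → d ≡ not b → b′ ≡ b → d′ ≡ d → b′ ≡ not d′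
    flip-not {b} refl refl refl = sym (not-involutive b)
    xx′ : c′ x′ ≡ not (c′ x)
    xx′ = flip-not c′x (c′-other (λ { refl → ∉-head v₁ (here refl) }) (λ p → y≢x′ (sym p))) refl
    yy′ : c′ y′ ≡ not (c′ y)
    yy′ = flip-not c′y (c′-other (λ { refl → ∉-head v₁ (there (there (here refl))) })
                                 (λ { refl → ∉-head v₃ (here refl) })) refl
    keep : ∀ rs → x ∉ flat rs → y ∉ flat rs → Alternates c rs → Alternates c′ rs
    keep rs x∉ y∉ alt = alternates-update rs y∉ (alternates-update rs x∉ alt)

-- Halving the classes of two chains of partitions

-- A partition of `A` into the fibres of `key`. Its classes are 0/1 weights, so that loads, degrees
-- and multiplicities all become weighted sums over the edges.
record Key (A : Set) : Set₁ where
  field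
    {K} : Set
    _≟_ : DecidableEquality K
    key : A → K

  class : K → A → ℕ
  class v x = 𝟙 (key x ≟ v)

open Key using (key; class)

Refines : Key A → Key A → Set
Refines κ κ′ = ∀ x y → key κ x ≡ key κ y → key κ′ x ≡ key κ′ y

Coloured : List A → (A → ℕ) → (A → Bool) → ℕ
Coloured xs χ c = ∑ xs (λ x → χ x * b2n (c x))

-- One-sided on purpose: the other inequality is the same statement for `not ∘ c`.
Halved : List A → (A → Bool) → (A → ℕ) → Set
Halved xs c χ = Coloured xs χ c ≤ suc (Coloured xs χ (not ∘ c))

-- Greedy: an element is paired with an unpaired one of its class whenever there is one, hence no
-- class keeps two unpaired elements.
pairUp : ∀ (κ : Key A) xs → ∃ λ ps → ∃ λ rs → xs ↭ flat ps ++ rs ×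
         All (λ p → key κ (proj₁ p) ≡ key κ (proj₂ p)) ps × AllPairs (λ x y → key κ x ≢ key κ y) rs
pairUp κ [] = [] , [] , ↭-refl , [] , []
pairUp κ (x ∷ xs) with pairUp κ xs
... | ps , rs , perm , same , distinct with Any.any? (λ y → Key._≟_ κ (key κ x) (key κ y)) rs
... | no none = ps , x ∷ rs , ↭-trans (prep x perm) (↭-sym (shift x (flat ps) rs)) , same ,
                All.tabulate (λ y∈ eq → none (Any.map (λ { refl → eq }) y∈)) ∷ distinct
... | yes some with pick some distinct
  where
  pick : ∀ {rs} → Any (λ y → key κ x ≡ key κ y) rs → AllPairs (λ x y → key κ x ≢ key κ y) rs →
         ∃ λ y → ∃ λ rs′ → rs ↭ y ∷ rs′ × key κ x ≡ key κ y × AllPairs (λ x y → key κ x ≢ key κ y) rs′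
  pick {y ∷ rs} (here eq) (_ ∷ d) = y , rs , ↭-refl , eq , d
  pick {z ∷ rs} (there any) (p ∷ d) with pick any d
  ... | y , rs′ , perm′ , eq , d′ =
    y , z ∷ rs′ , ↭-trans (prep z perm′) (swap z y ↭-refl) , eq , All.tail (Perm.All-resp-↭ perm′ p) ∷ d′
... | y , rs′ , perm′ , eq , d =
  (x , y) ∷ ps , rs′ ,
  prep x (↭-trans perm (↭-trans (++⁺ˡ (flat ps) perm′) (shift y (flat ps) rs′))) ,
  eq ∷ same , d

coloured-swap : ∀ {ps} {χ : A → ℕ} {c} → All (λ p → χ (proj₁ p) ≡ χ (proj₂ p)) ps → Alternates c ps →
                Coloured (flat ps) χ c ≡ Coloured (flat ps) χ (not ∘ c)
coloured-swap [] [] = refl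
coloured-swap {ps = (x , y) ∷ ps} {χ} {c} (s ∷ same) (p ∷ alt)
  rewrite p | sym s | not-involutive (c x) | coloured-swap same alt = exch (χ x * b2n (c x)) (χ x * b2n (not (c x))) _
  where
  exch : ∀ a b c → a + (b + c) ≡ b + (a + c)
  exch = solve-∀

class-distinct : ∀ (κ : Key A) v {rs} → AllPairs (λ x y → key κ x ≢ key κ y) rs → ∑ rs (class κ v) ≤ 1
class-distinct κ v [] = z≤n
class-distinct κ v {x ∷ rs} (p ∷ d) with Key._≟_ κ (key κ x) v
... | no _ = class-distinct κ v d
... | yes refl = s≤s (≤-reflexive (none p))
  where
  none : ∀ {rs} → All (λ y → key κ x ≢ key κ y) rs → ∑ rs (class κ (key κ x)) ≡ 0
  none [] = refl
  none {y ∷ _} (x≢y ∷ ps) = cong₂ _+_ (𝟙-no (Key._≟_ κ (key κ y) (key κ x)) (x≢y ∘ sym)) (none ps)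

-- A pair has the same weight at both ends and one end of each colour, so only the unpaired elements
-- `rs` can cause an imbalance.
halved-++ : ∀ {xs} ps rs {χ : A → ℕ} {c} → xs ↭ flat ps ++ rs →
            All (λ p → χ (proj₁ p) ≡ χ (proj₂ p)) ps → Alternates c ps → Halved rs c χ → Halved xs c χ
halved-++ {xs = xs} ps rs {χ} {c} perm same alt le = begin
  Coloured xs χ c                               ≡⟨ split c ⟩
  Coloured (flat ps) χ c + Coloured rs χ c      ≤⟨ +-mono-≤ (≤-reflexive (coloured-swap same alt)) le ⟩
  Coloured (flat ps) χ c̄ + suc (Coloured rs χ c̄) ≡⟨ +-suc _ _ ⟩
  suc (Coloured (flat ps) χ c̄ + Coloured rs χ c̄) ≡⟨ cong suc (split c̄) ⟨
  suc (Coloured xs χ c̄)                         ∎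
  where
  open ≤-Reasoning
  c̄ = not ∘ c
  split : ∀ d → Coloured xs χ d ≡ Coloured (flat ps) χ d + Coloured rs χ d
  split d = trans (∑-↭ _ perm) (∑-++ (flat ps) rs _)

class-cong : ∀ (κ : Key A) v {x y} → key κ x ≡ key κ y → class κ v x ≡ class κ v y
class-cong κ v eq = 𝟙-cong (Key._≟_ κ _ v) (Key._≟_ κ _ v) (trans (sym eq)) (trans eq)

-- Elements left unpaired at one level are paired at the next coarser one. Pairs from finer levels
-- lie inside the coarser classes and cancel there, and each class has at most one unpaired element
-- once its own level is done, so a single matching serves all levels.
chainMatching : ∀ (ks : List (Key A)) → AllPairs Refines ks → ∀ xs → ∃ λ ps → ∃ λ rs → xs ↭ flat ps ++ rs ×
                (∀ c → Alternates c ps → All (λ κ → ∀ v → Halved xs c (class κ v)) ks)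
chainMatching [] _ xs = [] , xs , ↭-refl , λ _ _ → []
chainMatching (κ ∷ ks) (finer ∷ chain) xs with pairUp κ xs
... | ps₁ , rs₁ , perm₁ , same , distinct with chainMatching ks chain rs₁
... | ps₂ , rs₂ , perm₂ , halved =
  ps₁ ++ ps₂ , rs₂ ,
  ↭-trans perm₁ (↭-trans (++⁺ˡ (flat ps₁) perm₂)
    (subst (flat ps₁ ++ flat ps₂ ++ rs₂ ↭_) (cong (_++ rs₂) (sym (flat-++ ps₁ ps₂)))
           (↭-sym (++-assoc (flat ps₁) (flat ps₂) rs₂)))) ,
  λ c alt →
    (λ v → halved-++ ps₁ rs₁ perm₁ (All.map (class-cong κ v) same) (All-++⁻ˡ ps₁ alt)
             (≤-trans (∑-mono (λ x → subst (class κ v x * b2n (c x) ≤_) (*-identityʳ _)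
                                       (*-monoʳ-≤ (class κ v x) (b2n≤1 (c x)))) rs₁)
                      (≤-trans (class-distinct κ v distinct) (s≤s z≤n)))) ∷
    All.zipWith (λ {κ′} (fine , h) v →
                   halved-++ ps₁ rs₁ perm₁ (All.map (class-cong κ′ v ∘ fine _ _) same) (All-++⁻ˡ ps₁ alt) (h v))
                (finer , halved c (All-++⁻ʳ ps₁ alt))

Unique-++ˡ : ∀ (xs : List A) {ys} → Unique (xs ++ ys) → Unique xs
Unique-++ˡ [] _ = []
Unique-++ˡ (x ∷ xs) (p ∷ u) = All-++⁻ˡ xs p ∷ Unique-++ˡ xs u

Unique-++ʳ : ∀ (xs : List A) {ys} → Unique (xs ++ ys) → Unique ys
Unique-++ʳ [] u = u
Unique-++ʳ (x ∷ xs) (_ ∷ u) = Unique-++ʳ xs u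

dummies : List A → List ((A ⊎ A) × (A ⊎ A))
dummies = map (λ x → inj₁ x , inj₂ x)

dummies-↭ : ∀ (xs : List A) → flat (dummies xs) ↭ map inj₁ xs ++ map inj₂ xs
dummies-↭ [] = ↭-refl
dummies-↭ (x ∷ xs) =
  prep (inj₁ x) (↭-trans (prep (inj₂ x) (dummies-↭ xs)) (↭-sym (shift (inj₂ x) (map inj₁ xs) (map inj₂ xs))))

lift₁ : List (A × A) → List ((A ⊎ A) × (A ⊎ A))
lift₁ = map (λ p → inj₁ (proj₁ p) , inj₁ (proj₂ p))

flat-lift₁ : ∀ (ps : List (A × A)) → flat (lift₁ ps) ≡ map inj₁ (flat ps)
flat-lift₁ [] = refl
flat-lift₁ ((x , y) ∷ ps) = cong (λ l → inj₁ x ∷ inj₁ y ∷ l) (flat-lift₁ ps)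

alternates-lift₁ : ∀ {c : A ⊎ A → Bool} (ps : List (A × A)) → Alternates c (lift₁ ps) → Alternates (c ∘ inj₁) ps
alternates-lift₁ [] [] = []
alternates-lift₁ (_ ∷ ps) (p ∷ alt) = p ∷ alternates-lift₁ ps alt

alternates-not : ∀ {c : A → Bool} ps → Alternates c ps → Alternates (not ∘ c) ps
alternates-not _ = All.map (cong not)

-- The unmatched elements of the second matching are matched with dummies inj₂ x.
commonHalving : DecidableEquality A → ∀ (ks₁ ks₂ : List (Key A)) → AllPairs Refines ks₁ → AllPairs Refines ks₂ →
                ∀ xs → Unique xs →
                ∃ λ c → All (λ κ → ∀ v → Halved xs c (class κ v) × Halved xs (not ∘ c) (class κ v)) (ks₁ ++ ks₂)
commonHalving {A = A} _≟_ ks₁ ks₂ chain₁ chain₂ xs u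
  with chainMatching ks₁ chain₁ xs | chainMatching ks₂ chain₂ xs
... | ps , rs , perm , halved | qs , ts , perm′ , halved′
  with alternating₂ (≡-dec _≟_ _≟_) (lift₁ ps) (lift₁ qs ++ dummies ts) uniq₁ uniq₂ sub
  where
  perm₂ : flat (lift₁ qs ++ dummies ts) ↭ map inj₁ xs ++ map inj₂ ts
  perm₂ = begin
    flat (lift₁ qs ++ dummies ts)                     ≡⟨ flat-++ (lift₁ qs) (dummies ts) ⟩
    flat (lift₁ qs) ++ flat (dummies ts)              ≡⟨ cong (_++ flat (dummies ts)) (flat-lift₁ qs) ⟩
    map inj₁ (flat qs) ++ flat (dummies ts)           ↭⟨ ++⁺ˡ (map inj₁ (flat qs)) (dummies-↭ ts) ⟩
    map inj₁ (flat qs) ++ map inj₁ ts ++ map inj₂ ts  ↭⟨ ++-assoc (map inj₁ (flat qs)) (map inj₁ ts) (map inj₂ ts) ⟨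
    (map inj₁ (flat qs) ++ map inj₁ ts) ++ map inj₂ ts ≡⟨ cong (_++ map inj₂ ts) (List.map-++ inj₁ (flat qs) ts) ⟨
    map inj₁ (flat qs ++ ts) ++ map inj₂ ts           ↭⟨ ++⁺ʳ (map inj₂ ts) (Perm.map⁺ inj₁ perm′) ⟨
    map inj₁ xs ++ map inj₂ ts                        ∎
    where open PermutationReasoning
  uniq₁ : Unique (flat (lift₁ ps))
  uniq₁ = subst Unique (sym (flat-lift₁ ps)) (Unique.map⁺ inj₁-injective (Unique-++ˡ (flat ps) (Unique-↭ perm u)))
  uniq₂ : Unique (flat (lift₁ qs ++ dummies ts))
  uniq₂ = Unique-↭ (↭-sym perm₂)
    (Unique.++⁺ (Unique.map⁺ inj₁-injective u) (Unique.map⁺ inj₂-injective (Unique-++ʳ (flat qs) (Unique-↭ perm′ u)))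
                (λ { (p , q) → disj (∈-map⁻ inj₁ p) (∈-map⁻ inj₂ q) }))
    where
    disj : ∀ {z : A ⊎ A} → (∃ λ x → x ∈ xs × z ≡ inj₁ x) → (∃ λ y → y ∈ ts × z ≡ inj₂ y) → ⊥
    disj (_ , _ , refl) (_ , _ , ())
  sub : ∀ {z} → z ∈ flat (lift₁ ps) → z ∈ flat (lift₁ qs ++ dummies ts)
  sub z∈ with ∈-map⁻ inj₁ (subst (_ ∈_) (flat-lift₁ ps) z∈)
  ... | x , x∈ , refl = ∈-resp-↭ (↭-sym perm₂) (∈-++⁺ˡ (∈-map⁺ inj₁ (∈-resp-↭ (↭-sym perm) (∈-++⁺ˡ x∈))))
... | c , alt₁ , alt₂ =
  c ∘ inj₁ ,
  All-++⁺ (both ps (alternates-lift₁ ps alt₁) halved)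
          (both qs (alternates-lift₁ qs (All-++⁻ˡ (lift₁ qs) alt₂)) halved′)
  where
  both : ∀ {ks : List (Key A)} {c} ps → Alternates c ps →
         (∀ c → Alternates c ps → All (λ κ → ∀ v → Halved xs c (class κ v)) ks) →
         All (λ κ → ∀ v → Halved xs c (class κ v) × Halved xs (not ∘ c) (class κ v)) ks
  both {c = c} ps alt halved =
    -- The complementary colouring alternates too and supplies the reverse inequality.
    All.zipWith (λ (h , h′) v → h v , h′ v) (halved c alt , halved (not ∘ c) (alternates-not {c = c} ps alt))

-- Equitable distribution over ν parts

∑-suc : ∀ (f : Fin (suc n) → ℕ) → ∑ (allFin (suc n)) f ≡ f zero + ∑ (allFin n) (f ∘ suc)
∑-suc f = cong (f zero +_) (trans (cong (λ l → ∑ l f) (sym (List.map-tabulate id suc))) (∑-map suc (allFin _) f))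

-- Starting point of the search for an equitable distribution: an edge with `p` copies puts them
-- into the first `p` parts.
∑-threshold : ∀ ν p → p ≤ ν → ∑ (allFin ν) (λ x → 𝟙 (Fin.toℕ x <? p)) ≡ p
∑-threshold ν zero _ = ∑-zero (allFin ν)
∑-threshold (suc ν) (suc p) (s≤s p≤ν) = trans (∑-suc {ν} (λ x → 𝟙 (Fin.toℕ x <? suc p)))
  (cong suc (trans (∑-cong (λ x → 𝟙-cong (suc (Fin.toℕ x) <? suc p) (Fin.toℕ x <? p) s≤s⁻¹ s≤s) (allFin ν)) (∑-threshold ν p p≤ν)))

-- For a fixed sum, the sum of squares grows with the difference. With `x = y + k`, `x′ = y + j` and
-- `y′ = x′ + i`, the equal sums give `k = i + 2j`, and the sums of squares differ by exactly
-- `2j(j + i)`. Since `i ≤ 1`, a gap `k` of at least 2 forces `j` to be positive.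
squares-sorted : ∀ x y x′ y′ → y ≤ x → x′ ≤ y′ → y′ ≤ suc x′ → x + y ≡ x′ + y′ →
                 x′ * x′ + y′ * y′ ≤ x * x + y * y × (suc y < x → x′ * x′ + y′ * y′ < x * x + y * y)
squares-sorted x y x′ y′ y≤x x′≤y′ y′≤ eq with m≤n⇒∃[o]m+o≡n y≤x | m≤n⇒∃[o]m+o≡n x′≤y′ | m≤n⇒∃[o]m+o≡n y≤x′
  where
  -- If `x′ < y`, then also `y′ ≤ y`, and the new sum would be below `y + y ≤ x + y`.
  y≤x′ : y ≤ x′
  y≤x′ with y ≤? x′
  ... | yes p = p
  ... | no y≰ = ⊥-elim (<-irrefl (sym eq) (begin-strict
    x′ + y′        ≤⟨ +-mono-≤ {x′} ≤-refl y′≤ ⟩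
    x′ + suc x′    <⟨ +-mono-<-≤ (≰⇒> y≰) (≰⇒> y≰) ⟩
    y + y          ≤⟨ +-monoˡ-≤ y y≤x ⟩
    x + y          ∎))
    where open ≤-Reasoning
... | k , refl | i , refl | j , refl =
  ≤-trans (m≤m+n _ _) (≤-reflexive (sym identity)) ,
  λ 1+y<x → ≤-trans (m<m+n _ (positive 1+y<x)) (≤-reflexive (sym identity))
  where
  k≡ : k ≡ i + (j + j)
  k≡ = +-cancelˡ-≡ (y + y) k (i + (j + j)) (trans (lhs y k) (trans eq (rhs y j i)))
    where
    lhs : ∀ y k → y + y + k ≡ y + k + y
    lhs = solve-∀
    rhs : ∀ y j i → (y + j) + (y + j + i) ≡ y + y + (i + (j + j))
    rhs = solve-∀
  identity : (y + k) * (y + k) + y * y ≡ (y + j) * (y + j) + (y + j + i) * (y + j + i) + 2 * j * (j + i)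
  identity rewrite k≡ = expand y j i
    where
    expand : ∀ y j i → (y + (i + (j + j))) * (y + (i + (j + j))) + y * y ≡
             (y + j) * (y + j) + (y + j + i) * (y + j + i) + 2 * j * (j + i)
    expand = solve-∀
  i≤1 : i ≤ 1
  i≤1 = +-cancelˡ-≤ (y + j) i 1 (≤-trans y′≤ (≤-reflexive (+-comm 1 (y + j))))
  positive : suc y < y + k → 0 < 2 * j * (j + i)
  positive lt = go j (subst (λ k → suc y < y + k) k≡ lt)
    where
    go : ∀ j → suc y < y + (i + (j + j)) → 0 < 2 * j * (j + i)
    go zero lt = ⊥-elim (<-irrefl refl (begin-strict
      suc y         <⟨ lt ⟩
      y + (i + 0)   ≡⟨ cong (y +_) (+-identityʳ i) ⟩
      y + i         ≤⟨ +-monoʳ-≤ y i≤1 ⟩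
      y + 1         ≡⟨ +-comm y 1 ⟩
      suc y         ∎))
      where open ≤-Reasoning
    go (suc _) _ = z<s

squares : ∀ x y x′ y′ → x′ ≤ suc y′ → y′ ≤ suc x′ → x + y ≡ x′ + y′ →
          x′ * x′ + y′ * y′ ≤ x * x + y * y × (suc y < x → x′ * x′ + y′ * y′ < x * x + y * y)
squares x y x′ y′ p q eq with ≤-total y x | ≤-total x′ y′
... | inj₁ y≤x | inj₁ x′≤y′ = squares-sorted x y x′ y′ y≤x x′≤y′ q eq
... | inj₁ y≤x | inj₂ y′≤x′ rewrite +-comm (x′ * x′) (y′ * y′) =
  squares-sorted x y y′ x′ y≤x y′≤x′ p (trans eq (+-comm x′ y′))
... | inj₂ x≤y | inj₁ x′≤y′ rewrite +-comm (x * x) (y * y) =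
  proj₁ (squares-sorted y x x′ y′ x≤y x′≤y′ q (trans (+-comm y x) eq)) ,
  λ lt → ⊥-elim (<-irrefl refl (≤-trans lt (m≤n⇒m≤1+n x≤y)))
... | inj₂ x≤y | inj₂ y′≤x′ rewrite +-comm (x * x) (y * y) | +-comm (x′ * x′) (y′ * y′) =
  proj₁ (squares-sorted y x y′ x′ x≤y y′≤x′ p (trans (+-comm y x) (trans eq (+-comm x′ y′)))) ,
  λ lt → ⊥-elim (<-irrefl refl (≤-trans lt (m≤n⇒m≤1+n x≤y)))

-- `σ e a` says that part `a` takes a copy of the split vertex from edge `e`. Being Boolean, it
-- never gives two copies from one edge to the same part, which is what makes the detachment
-- α-simple.
size : (Fin N → Fin ν → Bool) → Fin N → ℕ
size {ν = ν} σ e = ∑ (allFin ν) (b2n ∘ σ e)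

load : (Fin N → ℕ) → (Fin N → Fin ν → Bool) → Fin ν → ℕ
load {N} χ σ a = ∑ (allFin N) (λ e → χ e * b2n (σ e a))

energy : (Fin N → Fin ν → Bool) → (Fin N → ℕ) → ℕ
energy {ν = ν} σ χ = ∑ (allFin ν) (λ a → load χ σ a * load χ σ a)

Halving : (Fin N → ℕ) → List (Fin N) → (Fin N → Bool) → Set
Halving χ xs c = Halved xs c χ × Halved xs (not ∘ c) χ

-- Edges on which `a` and `b` agree contribute equally to both loads, so only the list `D` of the
-- others matters. Halving `D` between `a` and `b` keeps the sum of the two loads and brings them
-- within one of each other, for all weights at once; hence no energy rises, and a gap of two or
-- more makes one fall.
rebalance : ∀ (χs : List (Fin N → ℕ)) → (∀ xs → Unique xs → ∃ λ c → All (λ χ → Halving χ xs c) χs) →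
            ∀ (a b : Fin ν) → a ≢ b → (σ : Fin N → Fin ν → Bool) →
            ∃ λ σ′ → (∀ e → size σ′ e ≡ size σ e) ×
            All (λ χ → energy σ′ χ ≤ energy σ χ × (suc (load χ σ b) < load χ σ a → energy σ′ χ < energy σ χ)) χs
rebalance {N} {ν} χs halve a b a≢b σ = σ′ , sizes , All.map (λ {χ} → better {χ}) halved
  where
  differ? : ∀ e → Dec (σ e a ≢ σ e b)
  differ? e = ¬? (σ e a Bool.≟ σ e b)
  D : List (Fin N)
  D = filter differ? (allFin N)
  halves = halve D (Unique.filter⁺ differ? (Unique.allFin⁺ N))
  c = proj₁ halves
  halved = proj₂ halves
  _[_≔_]′ = _[_≔_] (Fin._≟_ {ν})
  recoloured : Fin N → Fin ν → Bool
  recoloured e = (σ e [ a ≔ c e ]′) [ b ≔ not (c e) ]′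
  σ′ : Fin N → Fin ν → Bool
  σ′ e x = if does (differ? e) then recoloured e x else σ e x

  recoloured-a : ∀ e → recoloured e a ≡ c e
  recoloured-a e = trans (update-other Fin._≟_ (σ e [ a ≔ c e ]′) (not (c e)) a≢b) (update-same Fin._≟_ (σ e) a (c e))
  recoloured-b : ∀ e → recoloured e b ≡ not (c e)
  recoloured-b e = update-same Fin._≟_ (σ e [ a ≔ c e ]′) b (not (c e))

  other : ∀ e x → x ≢ a → x ≢ b → σ′ e x ≡ σ e x
  other e x x≢a x≢b with σ e a Bool.≟ σ e b
  ... | yes _ = refl
  ... | no _ = trans (update-other Fin._≟_ (σ e [ a ≔ c e ]′) (not (c e)) x≢b) (update-other Fin._≟_ (σ e) (c e) x≢a)

  b2n-not : ∀ x y → x ≢ y → ∀ z → b2n x + b2n y ≡ b2n z + b2n (not z)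
  b2n-not false false ≢ z = ⊥-elim (≢ refl)
  b2n-not false true ≢ false = refl
  b2n-not false true ≢ true = refl
  b2n-not true false ≢ false = refl
  b2n-not true false ≢ true = refl
  b2n-not true true ≢ z = ⊥-elim (≢ refl)

  pair : ∀ e → b2n (σ e a) + b2n (σ e b) ≡ b2n (σ′ e a) + b2n (σ′ e b)
  pair e with σ e a Bool.≟ σ e b
  ... | yes _ = refl
  ... | no d rewrite recoloured-a e | recoloured-b e = b2n-not (σ e a) (σ e b) d (c e)

  sizes : ∀ e → size σ′ e ≡ size σ e
  sizes e = +-cancelʳ-≡ (b2n (σ e a) + b2n (σ e b)) _ _
    (trans (∑-point₂ a b a≢b (b2n ∘ σ′ e) (b2n ∘ σ e) (λ x p q → cong b2n (other e x p q)))
           (cong (size σ e +_) (sym (pair e))))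

  common : (Fin N → ℕ) → ℕ
  common χ = ∑ (allFin N) (λ e → χ e * b2n (σ e a Bool.∧ σ e b))

  load′-split : ∀ χ x (d : Fin N → Bool) → (∀ e → recoloured e x ≡ d e) → (∀ e → σ e a ≡ σ e b → σ e x ≡ σ e a Bool.∧ σ e b) →
                (∀ e → σ e a ≢ σ e b → σ e a Bool.∧ σ e b ≡ false) → load χ σ′ x ≡ common χ + Coloured D χ d
  load′-split χ x d rec same diff = trans (∑-cong pointwise (allFin N))
    (trans (∑-+ (allFin N) _ _) (cong (common χ +_) (sym (∑-filter differ? (allFin N) _))))
    where
    pointwise : ∀ e → χ e * b2n (σ′ e x) ≡ χ e * b2n (σ e a Bool.∧ σ e b) + 𝟙 (differ? e) * (χ e * b2n (d e))
    pointwise e with σ e a Bool.≟ σ e b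
    ... | yes eq rewrite same e eq = sym (+-identityʳ _)
    ... | no ≢ rewrite rec e | diff e ≢ | *-zeroʳ (χ e) = sym (+-identityʳ _)

  ∧-same : ∀ x y → x ≡ y → x ≡ x Bool.∧ y
  ∧-same false .false refl = refl
  ∧-same true .true refl = refl
  ∧-diff : ∀ x y → x ≢ y → x Bool.∧ y ≡ false
  ∧-diff false y _ = refl
  ∧-diff true false _ = refl
  ∧-diff true true ≢ = ⊥-elim (≢ refl)

  load-a : ∀ χ → load χ σ′ a ≡ common χ + Coloured D χ c
  load-a χ = load′-split χ a c recoloured-a (λ e → ∧-same _ _) (λ e → ∧-diff _ _)
  load-b : ∀ χ → load χ σ′ b ≡ common χ + Coloured D χ (not ∘ c)
  load-b χ = load′-split χ b (not ∘ c) recoloured-b (λ e eq → trans (sym eq) (∧-same _ _ eq)) (λ e → ∧-diff _ _)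

  load-sum : ∀ χ → load χ σ a + load χ σ b ≡ load χ σ′ a + load χ σ′ b
  load-sum χ = trans (sym (∑-+ (allFin N) _ _)) (trans (∑-cong pointwise (allFin N)) (∑-+ (allFin N) _ _))
    where
    pointwise : ∀ e → χ e * b2n (σ e a) + χ e * b2n (σ e b) ≡ χ e * b2n (σ′ e a) + χ e * b2n (σ′ e b)
    pointwise e = trans (sym (*-distribˡ-+ (χ e) _ _)) (trans (cong (χ e *_) (pair e)) (*-distribˡ-+ (χ e) _ _))

  better : ∀ {χ} → Halving χ D c →
           energy σ′ χ ≤ energy σ χ × (suc (load χ σ b) < load χ σ a → energy σ′ χ < energy σ χ)
  better {χ} (h₁ , h₂) =
    cancel-≤ points (proj₁ sq) , λ lt → cancel-< points (proj₂ sq lt)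
    where
    not-not : Coloured D χ (not ∘ not ∘ c) ≡ Coloured D χ c
    not-not = ∑-cong (λ e → cong (λ z → χ e * b2n z) (not-involutive (c e))) D
    near₁ : load χ σ′ a ≤ suc (load χ σ′ b)
    near₁ rewrite load-a χ | load-b χ = ≤-trans (+-monoʳ-≤ (common χ) h₁) (≤-reflexive (+-suc _ _))
    near₂ : load χ σ′ b ≤ suc (load χ σ′ a)
    near₂ rewrite load-a χ | load-b χ =
      ≤-trans (+-monoʳ-≤ (common χ) (≤-trans h₂ (s≤s (≤-reflexive not-not)))) (≤-reflexive (+-suc _ _))
    sq = squares (load χ σ a) (load χ σ b) (load χ σ′ a) (load χ σ′ b) near₁ near₂ (load-sum χ)
    points = ∑-point₂ a b a≢b (λ x → load χ σ′ x * load χ σ′ x) (λ x → load χ σ x * load χ σ x)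
      (λ x p q → cong (λ z → z * z) (∑-cong (λ e → cong (λ z → χ e * b2n z) (other e x p q)) (allFin N)))
    cancel-≤ : ∀ {x y x′ y′} → x′ + y ≡ x + y′ → y′ ≤ y → x′ ≤ x
    cancel-≤ {x} {y} {x′} {y′} eq le = +-cancelʳ-≤ y x′ x (≤-trans (≤-reflexive eq) (+-monoʳ-≤ x le))
    cancel-< : ∀ {x y x′ y′} → x′ + y ≡ x + y′ → y′ < y → x′ < x
    cancel-< {x} {y} {x′} {y′} eq lt = +-cancelʳ-< y x′ x (≤-trans (s≤s (≤-reflexive eq)) (+-monoʳ-< x lt))

Balanced : (Fin N → Fin ν → Bool) → (Fin N → ℕ) → Set
Balanced σ χ = ∀ a b → load χ σ a ≤ suc (load χ σ b)

balanced? : ∀ (σ : Fin N → Fin ν → Bool) χ → Dec (Balanced σ χ)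
balanced? σ χ = all? (λ a → all? (λ b → load χ σ a ≤? suc (load χ σ b)))

∑-energy-< : ∀ {σ σ′ : Fin N → Fin ν → Bool} {a b χs} →
             All (λ χ → energy σ′ χ ≤ energy σ χ × (suc (load χ σ b) < load χ σ a → energy σ′ χ < energy σ χ)) χs →
             Any (λ χ → suc (load χ σ b) < load χ σ a) χs → ∑ χs (energy σ′) < ∑ χs (energy σ)
∑-energy-< {σ = σ} {σ′} (p ∷ ps) (here lt) = +-mono-<-≤ (proj₂ p lt) (rest ps)
  where
  rest : ∀ {P : _ → Set} {χs} → All (λ χ → energy σ′ χ ≤ energy σ χ × P χ) χs → ∑ χs (energy σ′) ≤ ∑ χs (energy σ)
  rest [] = z≤n
  rest (p ∷ ps) = +-mono-≤ (proj₁ p) (rest ps)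
∑-energy-< {σ = σ} {σ′} (p ∷ ps) (there any) = +-mono-≤-< (proj₁ p) (∑-energy-< {σ = σ} {σ′} ps any)

-- Any unbalanced pair of parts is rebalanced, which decreases the sum of the squared loads.
equitable : ∀ (χs : List (Fin N → ℕ)) → (∀ xs → Unique xs → ∃ λ c → All (λ χ → Halving χ xs c) χs) →
            ∀ (p : Fin N → ℕ) → (∀ e → p e ≤ ν) → ∃ λ (σ : Fin N → Fin ν → Bool) → (∀ e → size σ e ≡ p e) × All (Balanced σ) χs
equitable {N} {ν} χs halve p p≤ν =
  search (λ e x → does (Fin.toℕ x <? p e)) (λ e → ∑-threshold ν (p e) (p≤ν e)) (<-wellFounded _)
  where
  search : ∀ (σ : Fin N → Fin ν → Bool) → (∀ e → size σ e ≡ p e) → Acc _<_ (∑ χs (energy σ)) →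
           ∃ λ (σ : Fin N → Fin ν → Bool) → (∀ e → size σ e ≡ p e) × All (Balanced σ) χs
  search σ sz (acc rec) with All.all? (balanced? σ) χs
  ... | yes bal = σ , sz , bal
  ... | no ¬bal with find (¬All⇒Any¬ (balanced? σ) χs ¬bal)
  ... | χ , χ∈ , ¬b with ¬∀⟶∃¬ _ _ (λ a → all? (λ b → load χ σ a ≤? suc (load χ σ b))) ¬b
  ... | a , ¬b′ with ¬∀⟶∃¬ _ _ (λ b → load χ σ a ≤? suc (load χ σ b)) ¬b′
  ... | b , ≰ with rebalance χs halve a b (λ { refl → ≰ (n≤1+n _) }) σ
  ... | σ′ , sz′ , better =
    search σ′ (λ e → trans (sz′ e) (sz e)) (rec (∑-energy-< {σ = σ} {σ′} better (lose χ∈ (≰⇒> ≰))))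

-- Binomial coefficients and rounding

-- For a set of parts that contains the new vertex, this converts rounding by the factor
-- `suc k / suc n` followed by division by `n C k` into division by `suc n C suc k`.
absorption : ∀ n k → suc k * (suc n C suc k) ≡ suc n * (n C k)
absorption zero zero = refl
absorption zero (suc k) rewrite k>n⇒nCk≡0 {1} {suc (suc k)} (s≤s z<s) | k>n⇒nCk≡0 {0} {suc k} z<s = *-zeroʳ (suc (suc k))
absorption (suc n) zero = begin
  1 * (suc (suc n) C 1)   ≡⟨ *-identityˡ _ ⟩
  suc (suc n) C 1         ≡⟨ nC1≡n (suc (suc n)) ⟩
  suc (suc n)             ≡⟨ *-identityʳ _ ⟨
  suc (suc n) * 1         ∎
  where open ≡-Reasoning
absorption (suc n) (suc k) = begin
  suc (suc k) * (suc (suc n) C suc (suc k))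
    ≡⟨ cong (suc (suc k) *_) (nCk+nC[k+1]≡[n+1]C[k+1] (suc n) (suc k)) ⟨
  suc (suc k) * (x + y)
    ≡⟨ expand (suc k) x y ⟩
  suc k * x + x + suc (suc k) * y
    ≡⟨ cong₂ (λ u v → u + x + v) (absorption n k) (absorption n (suc k)) ⟩
  suc n * (n C k) + x + suc n * (n C suc k)
    ≡⟨ regroup (suc n) (n C k) x (n C suc k) ⟩
  suc n * (n C k + n C suc k) + x
    ≡⟨ cong (λ z → suc n * z + x) (nCk+nC[k+1]≡[n+1]C[k+1] n k) ⟩
  suc n * x + x
    ≡⟨ +-comm _ x ⟩
  suc (suc n) * x ∎
  where
  open ≡-Reasoning
  x = suc n C suc k
  y = suc n C suc (suc k)
  expand : ∀ k x y → suc k * (x + y) ≡ k * x + x + suc k * y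
  expand = solve-∀
  regroup : ∀ n a x b → n * a + x + n * b ≡ n * (a + b) + x
  regroup = solve-∀

-- The counterpart for sets that avoid the new vertex, obtained by subtracting `absorption` from a
-- multiple of Pascal's rule.
absorption′ : ∀ n k r → r + k ≡ suc n → r * (suc n C k) ≡ suc n * (n C k)
absorption′ n zero r eq = cong (_* 1) (trans (sym (+-identityʳ r)) eq)
absorption′ n (suc k) r eq = +-cancelˡ-≡ (suc k * x) _ _ (begin
  suc k * x + r * x                         ≡⟨ +-comm (suc k * x) _ ⟩
  r * x + suc k * x                         ≡⟨ *-distribʳ-+ x r (suc k) ⟨
  (r + suc k) * x                           ≡⟨ cong (_* x) eq ⟩
  suc n * x                                 ≡⟨ cong (suc n *_) (nCk+nC[k+1]≡[n+1]C[k+1] n k) ⟨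
  suc n * (n C k + n C suc k)               ≡⟨ *-distribˡ-+ (suc n) (n C k) _ ⟩
  suc n * (n C k) + suc n * (n C suc k)     ≡⟨ cong (_+ suc n * (n C suc k)) (absorption n k) ⟨
  suc k * x + suc n * (n C suc k)           ∎)
  where
  open ≡-Reasoning
  x = suc n C suc k

-- For d ≥ 1 this says ⌊ y / d ⌋ ≤ x ≤ ⌈ y / d ⌉, without division.
infixr 4 _,_
record Near (x y d : ℕ) : Set where
  constructor _,_
  field
    lower : y < d + x * d
    upper : x * d < y + d

-- Every value is within one of `g a`, and the summand at `a` itself is what makes both inequalities
-- strict.
near-balanced : ∀ (g : Fin ν → ℕ) → (∀ a b → g a ≤ suc (g b)) → ∀ a → Near (g a) (∑ (allFin ν) g) ν
near-balanced {ν} g bal a =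
  (begin-strict
    ∑ (allFin ν) g                 <⟨ ∑-mono-< (λ b → bal b a) (∈-allFin a) (n<1+n (g a)) ⟩
    ∑ (allFin ν) (λ _ → suc (g a)) ≡⟨ const (suc (g a)) ⟩
    ν * suc (g a)                  ≡⟨ *-comm ν (suc (g a)) ⟩
    ν + g a * ν                    ∎) ,
  (begin-strict
    g a * ν                        ≡⟨ *-comm (g a) ν ⟩
    ν * g a                        ≡⟨ const (g a) ⟨
    ∑ (allFin ν) (λ _ → g a)       <⟨ ∑-mono-< (bal a) (∈-allFin a) (n<1+n (g a)) ⟩
    ∑ (allFin ν) (λ b → 1 + g b)   ≡⟨ ∑-+ (allFin ν) (λ _ → 1) g ⟩
    ∑ (allFin ν) (λ _ → 1) + ∑ (allFin ν) g ≡⟨ cong (_+ ∑ (allFin ν) g) (trans (const 1) (*-identityʳ ν)) ⟩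
    ν + ∑ (allFin ν) g             ≡⟨ +-comm ν _ ⟩
    ∑ (allFin ν) g + ν             ∎)
  where
  open ≤-Reasoning
  const : ∀ c → ∑ (allFin ν) (λ _ → c) ≡ ν * c
  const c = trans (∑-const c (allFin ν)) (cong (_* c) (List.length-tabulate {n = ν} id))

-- Nested floors collapse, and so do nested ceilings. The bounds on `x` are strict inequalities
-- between integers; multiplied by `n` they gain a slack of `n`, which is just what the bounds on
-- `z` lose. The equation for `s * D` then lets the factor `s` be cancelled.
near-compose : ∀ {x z M c D n} s .{{_ : NonZero s}} → s * D ≡ n * c → Near z (s * M) n → Near x z c → Near x M D
near-compose {x} {z} {M} {c} {D} {n} s eq (z₁ , z₂) (x₁ , x₂) =
  *-cancelˡ-< s M (D + x * D) (begin-strict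
    s * M                <⟨ z₁ ⟩
    n + z * n            ≡⟨ *-comm (suc z) n ⟩
    n * suc z            ≤⟨ *-monoʳ-≤ n x₁ ⟩
    n * (c + x * c)      ≡⟨ shift₁ n c x ⟩
    n * c * suc x        ≡⟨ cong (_* suc x) eq ⟨
    s * D * suc x        ≡⟨ shift₁ s D x ⟨
    s * (D + x * D)      ∎) ,
  *-cancelˡ-< s (x * D) (M + D) (+-cancelʳ-< n _ _ (begin-strict
    s * (x * D) + n      ≡⟨ cong (_+ n) (trans (shift₂ s x D) (trans (cong (x *_) eq) (shift₃ x n c))) ⟩
    n * (x * c) + n      ≡⟨ +-comm _ n ⟩
    n + n * (x * c)      ≡⟨ *-suc n _ ⟨
    n * suc (x * c)      ≤⟨ *-monoʳ-≤ n x₂ ⟩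
    n * (z + c)          ≡⟨ *-distribˡ-+ n z c ⟩
    n * z + n * c        ≡⟨ cong (_+ n * c) (*-comm n z) ⟩
    z * n + n * c        <⟨ +-monoˡ-< (n * c) z₂ ⟩
    s * M + n + n * c    ≡⟨ cong (s * M + n +_) (sym eq) ⟩
    s * M + n + s * D    ≡⟨ shift₄ (s * M) n (s * D) ⟩
    s * M + s * D + n    ≡⟨ cong (_+ n) (*-distribˡ-+ s M D) ⟨
    s * (M + D) + n      ∎))
  where
  open ≤-Reasoning
  shift₁ : ∀ n c x → n * (c + x * c) ≡ n * c * suc x
  shift₁ = solve-∀
  shift₂ : ∀ s x c → s * (x * c) ≡ x * (s * c)
  shift₂ = solve-∀
  shift₃ : ∀ x n c → x * (n * c) ≡ n * (x * c)
  shift₃ = solve-∀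
  shift₄ : ∀ a b c → a + b + c ≡ a + c + b
  shift₄ = solve-∀

-- The fractions `sM/n` and `rM/n` add up to the integer `M = z + z̄`, so complementing exchanges
-- the lower bound with the upper one.
near-complement : ∀ {z z̄ M n} s r → r + s ≡ n → z + z̄ ≡ M → Near z (s * M) n → Near z̄ (r * M) n
near-complement {z} {z̄} s r refl refl (z₁ , z₂) =
  +-cancelʳ-< (z * (r + s)) _ _ (begin-strict
    r * (z + z̄) + z * (r + s)            <⟨ +-monoʳ-< (r * (z + z̄)) z₂ ⟩
    r * (z + z̄) + (s * (z + z̄) + (r + s)) ≡⟨ eq₁ z z̄ r s ⟩
    r + s + z̄ * (r + s) + z * (r + s)    ∎) ,
  +-cancelʳ-< (s * (z + z̄)) _ _ (begin-strict
    z̄ * (r + s) + s * (z + z̄)            <⟨ +-monoʳ-< (z̄ * (r + s)) z₁ ⟩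
    z̄ * (r + s) + (r + s + z * (r + s))  ≡⟨ eq₂ z z̄ r s ⟩
    r * (z + z̄) + (r + s) + s * (z + z̄)  ∎)
  where
  open ≤-Reasoning
  eq₁ : ∀ z z̄ r s → r * (z + z̄) + (s * (z + z̄) + (r + s)) ≡ r + s + z̄ * (r + s) + z * (r + s)
  eq₁ = solve-∀
  eq₂ : ∀ z z̄ r s → z̄ * (r + s) + (r + s + z * (r + s)) ≡ r * (z + z̄) + (r + s) + s * (z + z̄)
  eq₂ = solve-∀

-- Removing one part that is close to the mean does not push the mean of the others past an integer.
-- If `x` and `z` differ by at most one in the relevant direction, the bounds simply add up; a
-- difference of two contradicts them, since the bound on `z` ties `d` to about `z * ν`.
near-rest : ∀ {x z d ν} → Near z (z + d) (suc ν) → Near x d ν → Near x (z + d) (suc ν)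
near-rest {x} {z} {d} {ν} (z₁ , z₂) (x₁ , x₂) = lower , upper
  where
  open ≤-Reasoning
  lower : z + d < suc ν + x * suc ν
  lower with z ≤? suc x
  ... | yes z≤ = begin-strict
    z + d                    <⟨ +-mono-≤-< z≤ x₁ ⟩
    suc x + (ν + x * ν)      ≡⟨ eq x ν ⟩
    suc ν + x * suc ν        ∎
    where
    eq : ∀ x ν → suc x + (ν + x * ν) ≡ suc ν + x * suc ν
    eq = solve-∀
  ... | no z≰ with m≤n⇒∃[o]m+o≡n (≰⇒> z≰)
  ... | o , refl = ⊥-elim (<-irrefl refl (begin-strict
    (2 + x + o) * suc ν                      <⟨ z₂ ⟩
    2 + x + o + d + suc ν                    ≡⟨ eq₁ (2 + x + o) d ν ⟩
    2 + x + o + suc d + ν                    ≤⟨ +-monoˡ-≤ ν (+-monoʳ-≤ (2 + x + o) x₁) ⟩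
    2 + x + o + (ν + x * ν) + ν              ≤⟨ m≤m+n _ (o * ν) ⟩
    2 + x + o + (ν + x * ν) + ν + o * ν      ≡⟨ eq₂ x o ν ⟩
    (2 + x + o) * suc ν                      ∎))
    where
    eq₁ : ∀ a d ν → a + d + suc ν ≡ a + suc d + ν
    eq₁ = solve-∀
    eq₂ : ∀ x o ν → 2 + x + o + (ν + x * ν) + ν + o * ν ≡ (2 + x + o) * suc ν
    eq₂ = solve-∀
  upper : x * suc ν < z + d + suc ν
  upper with x ≤? suc z
  ... | yes x≤ = begin-strict
    x * suc ν                ≡⟨ *-suc x ν ⟩
    x + x * ν                <⟨ +-mono-≤-< x≤ x₂ ⟩
    suc z + (d + ν)          ≡⟨ eq z d ν ⟩
    z + d + suc ν            ∎
    where
    eq : ∀ z d ν → suc z + (d + ν) ≡ z + d + suc ν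
    eq = solve-∀
  ... | no x≰ with m≤n⇒∃[o]m+o≡n (≰⇒> x≰)
  ... | o , refl = ⊥-elim (<-irrefl refl (begin-strict
    z + (2 + z + o) * ν            <⟨ +-monoʳ-< z x₂ ⟩
    z + (d + ν)                    ≡⟨ +-assoc z d ν ⟨
    z + d + ν                      ≤⟨ +-monoˡ-≤ ν (s≤s⁻¹ z₁) ⟩
    ν + z * suc ν + ν              ≤⟨ m≤m+n _ (o * ν) ⟩
    ν + z * suc ν + ν + o * ν      ≡⟨ eq z o ν ⟩
    z + (2 + z + o) * ν            ∎))
    where
    eq : ∀ z o ν → ν + z * suc ν + ν + o * ν ≡ z + (2 + z + o) * ν
    eq = solve-∀

-- Only classes of actual edges are listed, with repetitions, so the list is finite even if the type
-- of keys is not; an empty class has load zero everywhere.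
classes : List (Key (Fin N)) → List (Fin N → ℕ)
classes [] = []
classes (κ ∷ ks) = map (λ r → class κ (key κ r)) (allFin _) ++ classes ks

All-classes⁺ : ∀ {P : (Fin N → ℕ) → Set} (ks : List (Key (Fin N))) → All (λ κ → ∀ v → P (class κ v)) ks → All P (classes ks)
All-classes⁺ [] [] = []
All-classes⁺ (κ ∷ ks) (p ∷ ps) = All-++⁺ (All-map⁺ (All.tabulate (λ {r} _ → p (key κ r)))) (All-classes⁺ ks ps)

All-classes⁻ : ∀ {P : (Fin N → ℕ) → Set} (ks : List (Key (Fin N))) → All P (classes ks) →
               All (λ κ → ∀ r → P (class κ (key κ r))) ks
All-classes⁻ [] _ = []
All-classes⁻ (κ ∷ ks) ps =
  (λ r → All.lookup (All-map⁻ (All-++⁻ˡ (map _ (allFin _)) ps)) (∈-allFin r)) ∷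
  All-classes⁻ ks (All-++⁻ʳ (map (λ r → class κ (key κ r)) (allFin _)) ps)

-- Part `zero` of an equitable distribution becomes the new vertex. Of the other parts only the
-- number `p′ e` of copies survives: the recursion deals these out afresh, for finer types and
-- merged wings.
splitOff : ∀ (ks₁ ks₂ : List (Key (Fin N))) → AllPairs Refines ks₁ → AllPairs Refines ks₂ →
           ∀ p → (∀ e → p e ≤ suc ν) →
           ∃ λ (z : Fin N → Bool) → ∃ λ (p′ : Fin N → ℕ) → (∀ e → p′ e ≤ ν) × (∀ e → p e ≡ b2n (z e) + p′ e) ×
           All (λ κ → ∀ v → Near (∑ (allFin N) (λ e → class κ v e * b2n (z e))) (∑ (allFin N) (λ e → class κ v e * p e)) (suc ν))
               (ks₁ ++ ks₂)
splitOff {N} {ν} ks₁ ks₂ chain₁ chain₂ p p≤ with equitable (classes (ks₁ ++ ks₂)) halve p p≤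
  where
  halve : ∀ xs → Unique xs → ∃ λ c → All (λ χ → Halving χ xs c) (classes (ks₁ ++ ks₂))
  halve xs u with commonHalving Fin._≟_ ks₁ ks₂ chain₁ chain₂ xs u
  ... | c , h = c , All-classes⁺ (ks₁ ++ ks₂) h
... | σ , sizes , balanced =
  z , p′ , p′≤ν , (λ e → trans (sym (sizes e)) (∑-suc (b2n ∘ σ e))) ,
  All.map (λ {κ} b v → near κ b v) (All-classes⁻ (ks₁ ++ ks₂) balanced)
  where
  z : Fin N → Bool
  z e = σ e zero
  p′ : Fin N → ℕ
  p′ e = ∑ (allFin ν) (λ a → b2n (σ e (suc a)))
  p′≤ν : ∀ e → p′ e ≤ ν
  p′≤ν e = ≤-trans (∑-mono (λ a → b2n≤1 (σ e (suc a))) (allFin ν))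
    (≤-reflexive (trans (∑-const 1 (allFin ν)) (trans (*-identityʳ _) (List.length-tabulate id))))
  total : ∀ χ → ∑ (allFin (suc ν)) (load χ σ) ≡ ∑ (allFin N) (λ e → χ e * p e)
  total χ = trans (∑-swap (allFin (suc ν)) (allFin N) (λ a e → χ e * b2n (σ e a)))
    (∑-cong (λ e → trans (∑-*ˡ (χ e) (allFin (suc ν)) (λ a → b2n (σ e a))) (cong (χ e *_) (sizes e))) (allFin N))
  near : ∀ κ → (∀ r → Balanced σ (class κ (key κ r))) → ∀ v →
         Near (load (class κ v) σ zero) (∑ (allFin N) (λ e → class κ v e * p e)) (suc ν)
  near κ bal v with any? (λ r → Key._≟_ κ (key κ r) v)
  ... | yes (r , refl) = subst (λ y → Near (load (class κ v) σ zero) y (suc ν)) (total (class κ v)) (near-balanced (load (class κ v) σ) (bal r) zero)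
  ... | no empty = subst₂ (λ x y → Near x y (suc ν)) (sym (none (λ e → b2n (σ e zero)))) (sym (none p)) (z<s , z<s)
    where
    none : ∀ (f : Fin N → ℕ) → ∑ (allFin N) (λ e → class κ v e * f e) ≡ 0
    none f = trans (∑-cong (λ e → cong (_* f e) (𝟙-no (Key._≟_ κ (key κ e) v) (λ eq → empty (e , eq)))) (allFin N)) (∑-zero (allFin N))

-- Wings and the splitting of one vertex

infixr 2 _×-≟_
_×-≟_ : DecidableEquality A → DecidableEquality B → DecidableEquality (A × B)
(_≟₁_ ×-≟ _≟₂_) (a , b) (a′ , b′) =
  map′ (λ (p , q) → cong₂ _,_ p q) (λ { refl → refl , refl }) ((a ≟₁ a′) ×-dec (b ≟₂ b′))

b2n-∧ : ∀ x y → b2n (x Bool.∧ y) ≡ b2n x * b2n y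
b2n-∧ false y = refl
b2n-∧ true y = sym (+-identityʳ _)

𝟙-*-pos : {P : Set} (d : Dec P) {x : ℕ} → 0 < 𝟙 d * x → P × 0 < x
𝟙-*-pos (yes p) {x} lt = p , subst (0 <_) (+-identityʳ x) lt

_≟ˢ_ : DecidableEquality (Subset n)
_≟ˢ_ = Vec.≡-dec Bool._≟_

∣∷∣ : ∀ b (U : Subset n) → ∣ b ∷ U ∣ ≡ b2n b + ∣ U ∣
∣∷∣ false U = refl
∣∷∣ true U = refl

nonempty-lookup : ∀ (U : Subset n) → 0 < ∣ U ∣ → ∃ λ i → lookup U i ≡ true
nonempty-lookup (true ∷ U) _ = zero , refl
nonempty-lookup (false ∷ U) lt with nonempty-lookup U lt
... | i , eq = suc i , eq

near-refl : ∀ x → Near x x 1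
near-refl x = s≤s (≤-reflexive (sym (*-identityʳ x))) , ≤-reflexive (trans (cong suc (*-identityʳ x)) (+-comm 1 x))

module _ {N k : ℕ} (col : Fin N → Fin k) where

  private
    E : List (Fin N)
    E = allFin N

  -- nothing selects all edges, just j those of colour j.
  sel : Maybe (Fin k) → Fin N → ℕ
  sel nothing e = 1
  sel (just j) e = 𝟙 (col e Fin.≟ j)

  wingDeg : (Fin N → Fin M) → (Fin N → ℕ) → Fin k → Fin M → ℕ
  wingDeg w p j l = ∑ E (λ e → 𝟙 (col e Fin.≟ j) * (𝟙 (w e Fin.≟ l) * p e))

  -- The truncated subtraction matters: labels whose edges do not reach the split vertex have degree
  -- 0 and must contribute nothing.
  excess : (Fin N → Fin M) → (Fin N → ℕ) → Fin k → ℕ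
  excess {M} w p j = ∑ (allFin M) (λ l → wingDeg w p j l ∸ 1)

  -- Two different edges are allowed because the edges under one label hang together without using
  -- the vertex that is still to be split.
  Linked : (Fin N → Fin M) → (Fin N → Subset n) → Fin k → Fin n → Fin n → Set
  Linked w S j i i′ = ∃ λ e → ∃ λ e′ → col e ≡ j × col e′ ≡ j × w e ≡ w e′ ×
                                       lookup (S e) i ≡ true × lookup (S e′) i′ ≡ true

  wingDeg-sum : ∀ (w : Fin N → Fin M) p j (f : Fin M → ℕ) →
                ∑ E (λ e → 𝟙 (col e Fin.≟ j) * (f (w e) * p e)) ≡ ∑ (allFin M) (λ l → f l * wingDeg w p j l)
  wingDeg-sum {M} w p j f = sym (begin
    ∑ (allFin M) (λ l → f l * wingDeg w p j l)
      ≡⟨ ∑-cong (λ l → sym (∑-*ˡ (f l) E _)) (allFin M) ⟩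
    ∑ (allFin M) (λ l → ∑ E (λ e → f l * (c e * (𝟙 (w e Fin.≟ l) * p e))))
      ≡⟨ ∑-swap (allFin M) E _ ⟩
    ∑ E (λ e → ∑ (allFin M) (λ l → f l * (c e * (𝟙 (w e Fin.≟ l) * p e))))
      ≡⟨ ∑-cong (λ e → trans (∑-cong (λ l → move (f l) (c e) (𝟙 (w e Fin.≟ l)) (p e)) (allFin M))
                       (trans (∑-*ˡ (c e) (allFin M) _) (cong (c e *_) (∑-δ (w e) (λ l → f l * p e))))) E ⟩
    ∑ E (λ e → c e * (f (w e) * p e)) ∎)
    where
    open ≡-Reasoning
    c : Fin N → ℕ
    c e = 𝟙 (col e Fin.≟ j)
    move : ∀ f c d p → f * (c * (d * p)) ≡ c * (d * (f * p))
    move = solve-∀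

  wingDeg-pos : ∀ (w : Fin N → Fin M) p j l → 0 < wingDeg w p j l → ∃ λ e → col e ≡ j × w e ≡ l × 0 < p e
  wingDeg-pos w p j l lt with 0<∑⇒∃ _ E lt
  ... | e , _ , lt′ with 𝟙-*-pos (col e Fin.≟ _) lt′
  ... | eq , lt″ with 𝟙-*-pos (_ Fin.≟ _) lt″
  ... | eq′ , lt‴ = e , eq , eq′ , lt‴

  pos-wingDeg : ∀ (w : Fin N → Fin M) p e → p e ≤ wingDeg w p (col e) (w e)
  pos-wingDeg w p e = ≤-trans (≤-reflexive (sym value)) (∈⇒≤∑ _ (∈-allFin e))
    where
    value : 𝟙 (col e Fin.≟ col e) * (𝟙 (w e Fin.≟ w e) * p e) ≡ p e
    value = trans (cong₂ (λ x y → x * (y * p e)) (𝟙-yes (col e Fin.≟ col e) refl) (𝟙-yes (w e Fin.≟ w e) refl))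
                  (trans (*-identityˡ _) (*-identityˡ _))

  wingDeg-+ : ∀ (w : Fin N → Fin M) {p q r} j l → (∀ e → p e ≡ q e + r e) →
              wingDeg w p j l ≡ wingDeg w q j l + wingDeg w r j l
  wingDeg-+ w {p} {q} {r} j l eq = trans (∑-cong pointwise E) (∑-+ E _ _)
    where
    distrib : ∀ c d q r → c * (d * (q + r)) ≡ c * (d * q) + c * (d * r)
    distrib = solve-∀
    pointwise : ∀ e → _
    pointwise e = trans (cong (λ x → 𝟙 (col e Fin.≟ j) * (𝟙 (w e Fin.≟ l) * x)) (eq e))
                        (distrib (𝟙 (col e Fin.≟ j)) (𝟙 (w e Fin.≟ l)) (q e) (r e))

  module Merge {M : ℕ} (w : Fin N → Fin M) (z : Fin N → Bool) where

    touch : Fin k → Fin M → ℕ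
    touch = wingDeg w (b2n ∘ z)

    touched? : ∀ j l → Dec (0 < touch j l)
    touched? j l = 0 <? touch j l

    -- The new vertex joins all wings that it meets into one, labelled zero.
    merged : Fin N → Fin (suc M)
    merged e = if does (touched? (col e) (w e)) then zero else suc (w e)

    merged-zero : ∀ p j → wingDeg merged p j zero ≡ ∑ (allFin M) (λ l → 𝟙 (touched? j l) * wingDeg w p j l)
    merged-zero p j = trans (∑-cong pointwise E) (wingDeg-sum w p j (λ l → 𝟙 (touched? j l)))
      where
      pointwise : ∀ e → 𝟙 (col e Fin.≟ j) * (𝟙 (merged e Fin.≟ zero) * p e) ≡
                        𝟙 (col e Fin.≟ j) * (𝟙 (touched? j (w e)) * p e)
      pointwise e with col e Fin.≟ j
      ... | no _ = refl
      ... | yes refl with does (touched? (col e) (w e))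
      ... | true = refl
      ... | false = refl

    merged-suc : ∀ p j l → wingDeg merged p j (suc l) ≡ 𝟙 (¬? (touched? j l)) * wingDeg w p j l
    merged-suc p j l = trans (∑-cong pointwise E) (∑-*ˡ (𝟙 (¬? (touched? j l))) E _)
      where
      pointwise : ∀ e → 𝟙 (col e Fin.≟ j) * (𝟙 (merged e Fin.≟ suc l) * p e) ≡
                        𝟙 (¬? (touched? j l)) * (𝟙 (col e Fin.≟ j) * (𝟙 (w e Fin.≟ l) * p e))
      pointwise e with col e Fin.≟ j
      ... | no _ = sym (*-zeroʳ (𝟙 (¬? (touched? j l))))
      ... | yes refl with w e Fin.≟ l
      pointwise e | yes refl | yes refl with does (touched? (col e) (w e))
      ... | true = refl
      ... | false = trans (cong (λ x → x * p e + 0) (𝟙-yes (suc (w e) Fin.≟ suc (w e)) refl)) (sym (+-identityʳ _))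
      pointwise e | yes refl | no ≢ with does (touched? (col e) (w e))
      ... | true = sym (*-zeroʳ (𝟙 (¬? (touched? (col e) l))))
      ... | false = trans (cong (λ x → x * p e + 0) (𝟙-no (suc (w e) Fin.≟ suc l) (≢ ∘ suc-injective)))
                          (sym (*-zeroʳ (𝟙 (¬? (touched? (col e) l)))))

    -- Label `zero` is shared by all colours, hence the restriction to one colour `j`; there, wings
    -- that became equal are joined through the new vertex.
    merged-≡ : ∀ {e e′ j} → col e ≡ j → col e′ ≡ j → merged e ≡ merged e′ →
               w e ≡ w e′ ⊎ (0 < touch j (w e) × 0 < touch j (w e′))
    merged-≡ {e} {e′} refl p eq with if-≡ (touched? (col e) (w e)) (touched? (col e′) (w e′)) eq
      where
      if-≡ : ∀ {P Q : Set} (d : Dec P) (d′ : Dec Q) {x y : Fin M} →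
             (if does d then zero else suc x) ≡ (if does d′ then zero else suc y) → x ≡ y ⊎ (P × Q)
      if-≡ (yes t) (yes t′) _ = inj₂ (t , t′)
      if-≡ (no _) (no _) eq = inj₁ (suc-injective eq)
    ... | inj₁ same = inj₁ same
    ... | inj₂ (t , t′) = inj₂ (t , subst (λ j → 0 < touch j (w e′)) p t′)

    module _ {p p′ : Fin N → ℕ} (p≡ : ∀ e → p e ≡ b2n (z e) + p′ e) {μ : ℕ} (j : Fin k)
             (near : ∀ l → Near (touch j l) (wingDeg w p j l) (suc (suc μ)))
             (large : suc μ ≤ excess w p j) where

      private
        d h : Fin M → ℕ
        d = wingDeg w p j
        h = wingDeg w p′ j
        d≡ : ∀ l → d l ≡ touch j l + h l
        d≡ l = wingDeg-+ w j l p≡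

      -- If one of `μ + 2` balanced parts receives `z` copies, the wing has more than
      -- `(z − 1)(μ + 2)` copies, which leaves at least `(z − 1)(μ + 1)` for the other parts.
      twice-touched : ∀ l → 2 ≤ touch j l → suc μ ≤ h l
      twice-touched l 2≤z = +-cancelˡ-≤ (z′ + suc μ) _ _ (begin
        z′ + suc μ + suc μ           ≡⟨ eq z′ μ ⟩
        z′ + 2 * suc μ               ≤⟨ +-monoʳ-≤ z′ (*-monoˡ-≤ (suc μ) 2≤z) ⟩
        z′ + z′ * suc μ              ≡⟨ *-suc z′ (suc μ) ⟨
        z′ * suc (suc μ)             ≤⟨ s≤s⁻¹ (≤-trans (Near.upper (near l)) (≤-reflexive (trans (cong (_+ suc (suc μ)) (d≡ l)) (+-suc _ (suc μ))))) ⟩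
        z′ + h l + suc μ             ≡⟨ eq′ z′ (h l) (suc μ) ⟩
        z′ + suc μ + h l             ∎)
        where
        open ≤-Reasoning
        z′ = touch j l
        eq : ∀ z μ → z + suc μ + suc μ ≡ z + 2 * suc μ
        eq = solve-∀
        eq′ : ∀ a b c → a + b + c ≡ a + c + b
        eq′ = solve-∀

      excess-merged : excess merged p′ j ≡
                      (∑ (allFin M) (λ l → 𝟙 (touched? j l) * h l) ∸ 1) + ∑ (allFin M) (λ l → 𝟙 (¬? (touched? j l)) * h l ∸ 1)
      excess-merged = trans (∑-suc {M} (λ l → wingDeg merged p′ j l ∸ 1))
        (cong₂ _+_ (cong (_∸ 1) (merged-zero p′ j)) (∑-cong (λ l → cong (_∸ 1) (merged-suc p′ j l)) (allFin M)))

      -- A wing that is touched twice leaves enough copies by itself. Otherwise each touched wing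
      -- loses exactly one copy, so its old contribution `d l ∸ 1` equals `h l`, and the merged wing
      -- subtracts 1 only once from the sum of these.
      excess-step : suc μ ≤ suc (excess merged p′ j)
      excess-step with any? (λ l → 2 ≤? touch j l)
      ... | yes (l , 2≤) = s≤s (begin
        μ                                              ≤⟨ ∸-monoˡ-≤ 1 (begin
            suc μ                                              ≤⟨ twice-touched l 2≤ ⟩
            h l                                                ≡⟨ *-identityˡ (h l) ⟨
            1 * h l                                            ≡⟨ cong (_* h l) (𝟙-yes (touched? j l) (<⇒≤ 2≤)) ⟨
            𝟙 (touched? j l) * h l                             ≤⟨ ∈⇒≤∑ (λ l → 𝟙 (touched? j l) * h l) (∈-allFin l) ⟩
            ∑ (allFin M) (λ l → 𝟙 (touched? j l) * h l)        ∎) ⟩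
        ∑ (allFin M) (λ l → 𝟙 (touched? j l) * h l) ∸ 1 ≤⟨ m≤m+n _ _ ⟩
        _                                              ≡⟨ excess-merged ⟨
        excess merged p′ j                             ∎)
        where open ≤-Reasoning
      ... | no none = begin
        suc μ                                         ≤⟨ large ⟩
        excess w p j                                  ≤⟨ ∑-mono bound (allFin M) ⟩
        ∑ (allFin M) (λ l → 𝟙 (touched? j l) * h l + (𝟙 (¬? (touched? j l)) * h l ∸ 1)) ≡⟨ ∑-+ (allFin M) _ _ ⟩
        X + Y                                         ≤⟨ +-monoˡ-≤ Y (m≤n+m∸n X 1) ⟩
        suc (X ∸ 1) + Y                               ≡⟨ cong suc excess-merged ⟨
        suc (excess merged p′ j)                      ∎
        where
        open ≤-Reasoning
        X = ∑ (allFin M) (λ l → 𝟙 (touched? j l) * h l)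
        Y = ∑ (allFin M) (λ l → 𝟙 (¬? (touched? j l)) * h l ∸ 1)
        small : ∀ l → touch j l ≤ 1
        small l = s≤s⁻¹ (≰⇒> (λ le → none (l , le)))
        bound : ∀ l → d l ∸ 1 ≤ 𝟙 (touched? j l) * h l + (𝟙 (¬? (touched? j l)) * h l ∸ 1)
        bound l rewrite d≡ l with touch j l | small l
        ... | zero | _ = ≤-reflexive (cong (_∸ 1) (sym (*-identityˡ (h l))))
        ... | suc zero | _ = ≤-reflexive (sym (trans (+-identityʳ _) (+-identityʳ _)))
        ... | suc (suc _) | s≤s ()

      big? : ∀ l → Dec (2 ≤ d l)
      big? l = 2 ≤? d l

      -- The edge sought is one that gives the new vertex a copy from a wing of degree at least 2;
      -- such a wing cannot be exhausted by the new vertex.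
      shared-wing : Near (∑ E (λ e → 𝟙 (col e Fin.≟ j) * (𝟙 (big? (w e)) * b2n (z e))))
                         (∑ E (λ e → 𝟙 (col e Fin.≟ j) * (𝟙 (big? (w e)) * p e))) (suc (suc μ)) →
                    ∃ λ l → 0 < touch j l × 0 < h l
      shared-wing near-big with 0<∑⇒∃ _ E selected
        where
        open ≤-Reasoning
        Z D : ℕ
        Z = ∑ E (λ e → 𝟙 (col e Fin.≟ j) * (𝟙 (big? (w e)) * b2n (z e)))
        D = ∑ E (λ e → 𝟙 (col e Fin.≟ j) * (𝟙 (big? (w e)) * p e))
        -- A positive excess yields a wing of degree at least 2, whose contribution is strictly
        -- below its degree. This strictness provides the last of the `μ + 2` copies needed.
        excess<D : excess w p j < D
        excess<D with 0<∑⇒∃ (λ l → d l ∸ 1) (allFin M) (≤-trans z<s large)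
        ... | l₀ , l₀∈ , pos = ≤-trans
          (∑-mono-< bound l₀∈ (strictly (d l₀) pos))
          (≤-reflexive (sym (wingDeg-sum w p j (λ l → 𝟙 (big? l)))))
          where
          bound : ∀ l → d l ∸ 1 ≤ 𝟙 (big? l) * d l
          bound l with d l
          ... | zero = z≤n
          ... | suc zero = z≤n
          ... | suc (suc x) = ≤-trans (n≤1+n _) (≤-reflexive (sym (*-identityˡ (suc (suc x)))))
          strictly : ∀ x → 0 < x ∸ 1 → x ∸ 1 < 𝟙 (2 ≤? x) * x
          strictly (suc (suc x)) _ = ≤-reflexive (sym (*-identityˡ (suc (suc x))))
        selected : 0 < Z
        selected = n≢0⇒n>0 λ Z≡0 → <-irrefl refl (begin-strict
          D                          <⟨ Near.lower near-big ⟩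
          suc (suc μ) + Z * suc (suc μ) ≡⟨ cong (λ x → suc (suc μ) + x * suc (suc μ)) Z≡0 ⟩
          suc (suc μ) + 0            ≡⟨ +-identityʳ _ ⟩
          suc (suc μ)                ≤⟨ s≤s large ⟩
          suc (excess w p j)         ≤⟨ excess<D ⟩
          D                          ∎)
      ... | e , _ , pos with 𝟙-*-pos (col e Fin.≟ j) pos
      ... | refl , pos′ with 𝟙-*-pos (big? (w e)) pos′
      ... | 2≤d , pos″ = w e , ≤-trans pos″ (pos-wingDeg w (b2n ∘ z) e) , remaining
        where
        -- If nothing remained, the new vertex would have taken all copies, at least two, and
        -- `twice-touched` says that some are left over.
        remaining : 0 < h (w e)
        remaining with h (w e) | twice-touched (w e) | d≡ (w e)
        ... | suc _ | _ | _ = z<s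
        ... | zero | tw | eq with tw (subst (2 ≤_) (trans eq (+-identityʳ _)) 2≤d)
        ... | ()

-- Splitting all vertices

-- The field `connected` gives only the sufficiency of a large excess; its necessity holds for any
-- choice of parts of the right sizes and is proved separately.
record Splitting {N k M : ℕ} {T : Set} (col : Fin N → Fin k) (n : ℕ) (_≟_ : DecidableEquality T)
                 (τ : Fin N → T) (w : Fin N → Fin M) (p : Fin N → ℕ) : Set where
  field
    part      : Fin N → Subset n
    size≡     : ∀ e → ∣ part e ∣ ≡ p e
    degrees   : ∀ q i → Near (∑ (allFin N) (λ e → sel col q e * b2n (lookup (part e) i)))
                             (∑ (allFin N) (λ e → sel col q e * p e)) n
    mults     : ∀ q t U → Near (∑ (allFin N) (λ e → sel col q e * (𝟙 (τ e ≟ t) * 𝟙 (part e ≟ˢ U))))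
                               (∑ (allFin N) (λ e → sel col q e * (𝟙 (τ e ≟ t) * 𝟙 (p e ℕ.≟ ∣ U ∣)))) (n C ∣ U ∣)
    connected : ∀ j → n ≤ suc (excess col w p j) → ∀ i i′ → Star (Linked col w part j) i i′

near-cong : ∀ {x x′ y y′ d} → Near x y d → x ≡ x′ → y ≡ y′ → Near x′ y′ d
near-cong near refl refl = near

module _ {N k M : ℕ} {T : Set} (col : Fin N → Fin k) (_≟_ : DecidableEquality T)
         (τ : Fin N → T) (w : Fin N → Fin M) (p : Fin N → ℕ) where

  -- `majorKey` isolates, in each colour, the union of the wings of degree at least 2, as
  -- `shared-wing` requires. The type keys include `p e`, since a multiplicity in the original
  -- hypergraph fixes both the old vertices and the number of copies.
  wingKey majorKey colourKey unitKey typeColourKey typeKey : Key (Fin N)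
  wingKey = record { _≟_ = Fin._≟_ ×-≟ Fin._≟_ ; key = λ e → col e , w e }
  majorKey = record { _≟_ = Fin._≟_ ×-≟ Bool._≟_ ; key = λ e → col e , does (2 ≤? wingDeg col w p (col e) (w e)) }
  colourKey = record { _≟_ = Fin._≟_ ; key = col }
  unitKey = record { _≟_ = Unit._≟_ ; key = λ _ → tt }
  typeColourKey = record { _≟_ = (_≟_ ×-≟ ℕ._≟_) ×-≟ Fin._≟_ ; key = λ e → (τ e , p e) , col e }
  typeKey = record { _≟_ = _≟_ ×-≟ ℕ._≟_ ; key = λ e → τ e , p e }

  wingChain typeChain : List (Key (Fin N))
  wingChain = wingKey ∷ majorKey ∷ colourKey ∷ unitKey ∷ []
  typeChain = typeColourKey ∷ typeKey ∷ []

  wingChain-refines : AllPairs Refines wingChain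
  wingChain-refines =
    -- Whether a wing has degree at least 2 depends only on its colour and label.
    ((λ x y eq → cong (λ { (j , l) → j , does (2 ≤? wingDeg col w p j l) }) eq) ∷ (λ x y → cong proj₁) ∷ (λ x y _ → refl) ∷ []) ∷
    ((λ x y → cong proj₁) ∷ (λ x y _ → refl) ∷ []) ∷ ((λ x y _ → refl) ∷ []) ∷ [] ∷ []

  typeChain-refines : AllPairs Refines typeChain
  typeChain-refines = ((λ x y → cong proj₁) ∷ []) ∷ [] ∷ []

-- Composing one split with the recursive splitting

module Step {N k M : ℕ} {T : Set} (col : Fin N → Fin k) (ν : ℕ) (_≟_ : DecidableEquality T)
            (τ : Fin N → T) (w : Fin N → Fin M) (p : Fin N → ℕ) (z : Fin N → Bool) (p′ : Fin N → ℕ)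
            (p≡ : ∀ e → p e ≡ b2n (z e) + p′ e)
            (near : All (λ κ → ∀ v → Near (∑ (allFin N) (λ e → class κ v e * b2n (z e)))
                                          (∑ (allFin N) (λ e → class κ v e * p e)) (suc ν))
                        (wingChain col _≟_ τ w p ++ typeChain col _≟_ τ w p))
            (rec : Splitting col ν (_≟_ ×-≟ Bool._≟_) (λ e → τ e , z e) (Merge.merged col w z) p′) where

  NearKey : Key (Fin N) → Set
  NearKey κ = ∀ v → Near (∑ (allFin N) (λ e → class κ v e * b2n (z e)))
                         (∑ (allFin N) (λ e → class κ v e * p e)) (suc ν)

  near-wingKey : NearKey (wingKey col _≟_ τ w p)
  near-wingKey = All.lookup near (here refl)
  near-majorKey : NearKey (majorKey col _≟_ τ w p)
  near-majorKey = All.lookup near (there (here refl))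
  near-colourKey : NearKey (colourKey col _≟_ τ w p)
  near-colourKey = All.lookup near (there (there (here refl)))
  near-unitKey : NearKey (unitKey col _≟_ τ w p)
  near-unitKey = All.lookup near (there (there (there (here refl))))
  near-typeColourKey : NearKey (typeColourKey col _≟_ τ w p)
  near-typeColourKey = All.lookup near (there (there (there (there (here refl)))))
  near-typeKey : NearKey (typeKey col _≟_ τ w p)
  near-typeKey = All.lookup near (there (there (there (there (there (here refl))))))

  module R = Splitting rec
  module W = Merge col w z
  E = allFin N
  part : Fin N → Subset (suc ν)
  part e = z e ∷ R.part e

  total : ∀ q → ∑ E (λ e → sel col q e * p e) ≡ ∑ E (λ e → sel col q e * b2n (z e)) + ∑ E (λ e → sel col q e * p′ e)
  total q = trans (∑-cong (λ e → trans (cong (sel col q e *_) (p≡ e)) (*-distribˡ-+ (sel col q e) _ _)) E) (∑-+ E _ _)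

  degree-zero : ∀ q → Near (∑ E (λ e → sel col q e * b2n (z e))) (∑ E (λ e → sel col q e * p e)) (suc ν)
  degree-zero nothing = near-unitKey tt
  degree-zero (just j) = near-colourKey j

  -- The recursion rounds the mean of what the new vertex has left over; `near-rest` turns this into
  -- a rounding of the original mean.
  degrees : ∀ q i → Near (∑ E (λ e → sel col q e * b2n (lookup (part e) i))) (∑ E (λ e → sel col q e * p e)) (suc ν)
  degrees q zero = degree-zero q
  degrees q (suc i) =
    near-cong (near-rest (near-cong (degree-zero q) refl (total q)) (R.degrees q i)) refl (sym (total q))

  typeWeight : Maybe (Fin k) → T → ℕ → Fin N → ℕ
  typeWeight q t s e = sel col q e * (𝟙 (τ e ≟ t) * 𝟙 (p e ℕ.≟ s))

  near-type : ∀ q t s → Near (∑ E (λ e → typeWeight q t s e * b2n (z e))) (∑ E (λ e → typeWeight q t s e * p e)) (suc ν)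
  near-type nothing t s = near-cong (near-typeKey (t , s)) (∑-cong (λ e → cong (_* b2n (z e)) (weight e)) E) (∑-cong (λ e → cong (_* p e) (weight e)) E)
    where
    weight : ∀ e → 𝟙 ((_≟_ ×-≟ ℕ._≟_) (τ e , p e) (t , s)) ≡ typeWeight nothing t s e
    weight e = trans (b2n-∧ (does (τ e ≟ t)) _) (sym (*-identityˡ _))
  near-type (just j) t s = near-cong (near-typeColourKey ((t , s) , j)) (∑-cong (λ e → cong (_* b2n (z e)) (weight e)) E) (∑-cong (λ e → cong (_* p e) (weight e)) E)
    where
    weight : ∀ e → 𝟙 (((_≟_ ×-≟ ℕ._≟_) ×-≟ Fin._≟_) ((τ e , p e) , col e) ((t , s) , j)) ≡ typeWeight (just j) t s e
    weight e = trans (b2n-∧ (does (τ e ≟ t) Bool.∧ does (p e ℕ.≟ s)) _)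
                     (trans (cong (_* 𝟙 (col e Fin.≟ j)) (b2n-∧ (does (τ e ≟ t)) _)) (*-comm _ (𝟙 (col e Fin.≟ j))))

  -- All edges of a type carry the same number `s` of copies, so balancing copies determines how
  -- many edges of the type meet the new vertex.
  size-type : ∀ q t s → ∑ E (λ e → typeWeight q t s e * p e) ≡ s * ∑ E (typeWeight q t s)
  size-type q t s = trans (∑-cong pointwise E) (∑-*ˡ s E (typeWeight q t s))
    where
    pointwise : ∀ e → typeWeight q t s e * p e ≡ s * typeWeight q t s e
    pointwise e = trans (assoc (sel col q e) (𝟙 (τ e ≟ t)) (𝟙 (p e ℕ.≟ s)) (p e))
      (trans (cong (λ x → sel col q e * (𝟙 (τ e ≟ t) * x)) (weigh (p e ℕ.≟ s)))
             (assoc′ (sel col q e) (𝟙 (τ e ≟ t)) (𝟙 (p e ℕ.≟ s)) s))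
      where
      weigh : ∀ {a s} (d : Dec (a ≡ s)) → 𝟙 d * a ≡ 𝟙 d * s
      weigh (yes refl) = refl
      weigh (no _) = refl
      assoc : ∀ a b c d → a * (b * c) * d ≡ a * (b * (c * d))
      assoc = solve-∀
      assoc′ : ∀ a b c d → a * (b * (c * d)) ≡ d * (a * (b * c))
      assoc′ = solve-∀

  Count : Maybe (Fin k) → T → ℕ → Bool → ℕ
  Count q t s b = ∑ E (λ e → typeWeight q t s e * 𝟙 (z e Bool.≟ b))

  𝟙-true : ∀ b → 𝟙 (b Bool.≟ true) ≡ b2n b
  𝟙-true false = refl
  𝟙-true true = refl

  near-true : ∀ q t s → Near (Count q t s true) (s * ∑ E (typeWeight q t s)) (suc ν)
  near-true q t s = near-cong (near-type q t s) (∑-cong (λ e → cong (typeWeight q t s e *_) (sym (𝟙-true (z e)))) E) (size-type q t s)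

  count-sum : ∀ q t s → Count q t s true + Count q t s false ≡ ∑ E (typeWeight q t s)
  count-sum q t s = trans (sym (∑-+ E _ _)) (∑-cong (λ e → trans (sym (*-distribˡ-+ (typeWeight q t s e) _ _)) (trans (cong (typeWeight q t s e *_) (either (z e))) (*-identityʳ _))) E)
    where
    either : ∀ b → 𝟙 (b Bool.≟ true) + 𝟙 (b Bool.≟ false) ≡ 1
    either false = refl
    either true = refl

  step-count : ∀ q t (U : Subset ν) b → ∑ E (λ e → sel col q e * (𝟙 ((_≟_ ×-≟ Bool._≟_) (τ e , z e) (t , b)) * 𝟙 (p′ e ℕ.≟ ∣ U ∣))) ≡
               Count q t ∣ b ∷ U ∣ b
  step-count q t U b = ∑-cong pointwise E
    where
    move : ∀ a b c d → a * (b * c * d) ≡ a * (b * d) * c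
    move = solve-∀
    pointwise : ∀ e → sel col q e * (𝟙 ((_≟_ ×-≟ Bool._≟_) (τ e , z e) (t , b)) * 𝟙 (p′ e ℕ.≟ ∣ U ∣)) ≡
                      typeWeight q t ∣ b ∷ U ∣ e * 𝟙 (z e Bool.≟ b)
    pointwise e = trans (cong (λ x → sel col q e * (x * 𝟙 (p′ e ℕ.≟ ∣ U ∣))) (b2n-∧ (does (τ e ≟ t)) (does (z e Bool.≟ b))))
                 (trans (move (sel col q e) (𝟙 (τ e ≟ t)) (𝟙 (z e Bool.≟ b)) (𝟙 (p′ e ℕ.≟ ∣ U ∣))) same-size)
      where
      same-size : sel col q e * (𝟙 (τ e ≟ t) * 𝟙 (p′ e ℕ.≟ ∣ U ∣)) * 𝟙 (z e Bool.≟ b) ≡ typeWeight q t ∣ b ∷ U ∣ e * 𝟙 (z e Bool.≟ b)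
      same-size with z e Bool.≟ b | p≡ e
      ... | no _ | _ = trans (*-zeroʳ (sel col q e * (𝟙 (τ e ≟ t) * 𝟙 (p′ e ℕ.≟ ∣ U ∣)))) (sym (*-zeroʳ (typeWeight q t ∣ b ∷ U ∣ e)))
      ... | yes refl | eq = cong (λ x → sel col q e * (𝟙 (τ e ≟ t) * x) * 1)
        (𝟙-cong (p′ e ℕ.≟ ∣ U ∣) (p e ℕ.≟ ∣ z e ∷ U ∣)
          (λ p′≡ → trans eq (trans (cong (b2n (z e) +_) p′≡) (sym (∣∷∣ (z e) U))))
          (λ p≡′ → +-cancelˡ-≡ (b2n (z e)) _ _ (trans (sym eq) (trans p≡′ (∣∷∣ (z e) U)))))

  step-mult : ∀ q t b U → ∑ E (λ e → sel col q e * (𝟙 ((_≟_ ×-≟ Bool._≟_) (τ e , z e) (t , b)) * 𝟙 (R.part e ≟ˢ U))) ≡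
              ∑ E (λ e → sel col q e * (𝟙 (τ e ≟ t) * 𝟙 (part e ≟ˢ (b ∷ U))))
  step-mult q t b U = ∑-cong (λ e → cong (sel col q e *_) (pointwise e)) E
    where
    pointwise : ∀ e → 𝟙 ((_≟_ ×-≟ Bool._≟_) (τ e , z e) (t , b)) * 𝟙 (R.part e ≟ˢ U) ≡ 𝟙 (τ e ≟ t) * 𝟙 (part e ≟ˢ (b ∷ U))
    pointwise e = begin
      b2n (x Bool.∧ y) * 𝟙 (R.part e ≟ˢ U)    ≡⟨ cong (_* _) (b2n-∧ x y) ⟩
      b2n x * b2n y * 𝟙 (R.part e ≟ˢ U)       ≡⟨ *-assoc (b2n x) _ _ ⟩
      b2n x * (b2n y * 𝟙 (R.part e ≟ˢ U))     ≡⟨ cong (b2n x *_) (b2n-∧ y _) ⟨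
      b2n x * b2n (y Bool.∧ does (R.part e ≟ˢ U)) ≡⟨ cong (b2n x *_) (𝟙-cong ((z e Bool.≟ b) ×-dec (R.part e ≟ˢ U)) (part e ≟ˢ (b ∷ U))
                                                    (λ { (refl , refl) → refl }) Vec.∷-injective) ⟩
      𝟙 (τ e ≟ t) * 𝟙 (part e ≟ˢ (b ∷ U))     ∎
      where
      open ≡-Reasoning
      x = does (τ e ≟ t)
      y = does (z e Bool.≟ b)

  -- Of `M` edges of size `s`, about `sM/(ν + 1)` meet the new vertex and the others avoid it. The
  -- recursion divides these by `ν C (s − 1)` and `ν C s` respectively, and by absorption both
  -- routes amount to dividing `M` by `(ν + 1) C s`.
  mults : ∀ q t U → Near (∑ E (λ e → sel col q e * (𝟙 (τ e ≟ t) * 𝟙 (part e ≟ˢ U))))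
                         (∑ E (typeWeight q t ∣ U ∣)) (suc ν C ∣ U ∣)
  mults q t (true ∷ U) = near-compose (suc ∣ U ∣) (absorption ν ∣ U ∣) (near-true q t (suc ∣ U ∣))
    (near-cong (R.mults q (t , true) U) (step-mult q t true U) (step-count q t U true))
  mults q t (false ∷ U) = near-compose (suc r) (absorption′ ν ∣ U ∣ (suc r) (cong suc r+s))
    (near-complement ∣ U ∣ (suc r) (cong suc r+s) (count-sum q t ∣ U ∣) (near-true q t ∣ U ∣))
    (near-cong (R.mults q (t , false) U) (step-mult q t false U) (step-count q t U false))
    where
    -- A set without the new vertex has at most `ν` elements, so the multiplier
    -- `suc r = ν + 1 − ∣ U ∣` is positive and can be cancelled.
    r = ν ∸ ∣ U ∣
    r+s : r + ∣ U ∣ ≡ ν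
    r+s = m∸n+n≡m (Sub.∣p∣≤n U)

  L : Fin k → Fin (suc ν) → Fin (suc ν) → Set
  L = Linked col w part

  linked-sym : ∀ {j i i′} → L j i i′ → L j i′ i
  linked-sym (e , e′ , a , b , c , d , f) = e′ , e , b , a , sym c , f , d

  touching : ∀ {j e i} → col e ≡ j → 0 < W.touch j (w e) → lookup (R.part e) i ≡ true → L j (suc i) zero
  touching {j} {e} eq t i∈ with wingDeg-pos col w (b2n ∘ z) j (w e) t
  ... | f , col≡ , w≡ , z>0 = e , f , eq , col≡ , sym w≡ , i∈ , is-true (z f) z>0
    where
    is-true : ∀ b → 0 < b2n b → b ≡ true
    is-true true _ = refl

  -- A link inside the merged wing may use two different old wings; both meet the new vertex, so a
  -- detour through `zero` replaces it.
  lift-link : ∀ {j i i′} → Linked col W.merged R.part j i i′ → Star (L j) (suc i) (suc i′)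
  lift-link (e , e′ , col≡ , col≡′ , w≡ , i∈ , i′∈) with W.merged-≡ col≡ col≡′ w≡
  ... | inj₁ same = (e , e′ , col≡ , col≡′ , same , i∈ , i′∈) ◅ ε
  ... | inj₂ (t , t′) = _◅_ {j = zero} (touching col≡ t i∈) (linked-sym {i = suc _} {zero} (touching col≡′ t′ i′∈) ◅ ε)

  lift-star : ∀ {j i i′} → Star (Linked col W.merged R.part j) i i′ → Star (L j) (suc i) (suc i′)
  lift-star ε = ε
  lift-star (s ◅ ss) = lift-link s ◅◅ lift-star ss

  connected : ∀ j → suc ν ≤ suc (excess col w p j) → ∀ i i′ → Star (L j) i i′
  connected j (s≤s large) = go ν refl
    where
    -- With no further parts there is nothing to link; otherwise `ν = suc μ` makes the excess
    -- positive, on which `shared-wing` relies.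
    go : ∀ μ → μ ≡ ν → ∀ i i′ → Star (L j) i i′
    go zero refl zero zero = ε
    go (suc μ) refl = star
      where
      class-pair : ∀ (x y : Bool) c → b2n (x Bool.∧ y) * c ≡ b2n x * (b2n y * c)
      class-pair x y c = trans (cong (_* c) (b2n-∧ x y)) (*-assoc (b2n x) _ c)
      near-wing : ∀ l → Near (W.touch j l) (wingDeg col w p j l) (suc (suc μ))
      near-wing l = near-cong (near-wingKey (j , l)) (∑-cong (λ e → class-pair (does (col e Fin.≟ j)) _ _) E) (∑-cong (λ e → class-pair (does (col e Fin.≟ j)) _ _) E)
      near-big : Near (∑ E (λ e → 𝟙 (col e Fin.≟ j) * (𝟙 (2 ≤? wingDeg col w p j (w e)) * b2n (z e))))
                      (∑ E (λ e → 𝟙 (col e Fin.≟ j) * (𝟙 (2 ≤? wingDeg col w p j (w e)) * p e))) (suc (suc μ))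
      near-big = near-cong (near-majorKey (j , true)) (∑-cong (λ e → big e (b2n (z e))) E) (∑-cong (λ e → big e (p e)) E)
        where
        big : ∀ e c → 𝟙 ((Fin._≟_ ×-≟ Bool._≟_) (col e , does (2 ≤? wingDeg col w p (col e) (w e))) (j , true)) * c ≡
                      𝟙 (col e Fin.≟ j) * (𝟙 (2 ≤? wingDeg col w p j (w e)) * c)
        big e c with col e Fin.≟ j
        ... | no _ = refl
        ... | yes refl = trans (cong (_* c) (𝟙-true (does (2 ≤? wingDeg col w p (col e) (w e))))) (sym (+-identityʳ _))
      recursive : ∀ i i′ → Star (L j) (suc i) (suc i′)
      recursive i i′ = lift-star (R.connected j (W.excess-step p≡ j near-wing large) i i′)
      base : ∃ λ i → L j (suc i) zero
      base with W.shared-wing p≡ j near-wing large near-big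
      ... | l , t , h with wingDeg-pos col w p′ j l h
      ... | e , col≡ , refl , pos with nonempty-lookup (R.part e) (subst (0 <_) (sym (R.size≡ e)) pos)
      ... | i , i∈ = i , touching col≡ t i∈
      to-zero : ∀ i → Star (L j) (suc i) zero
      to-zero i = recursive i (proj₁ base) ◅◅ (proj₂ base ◅ ε)
      from-zero : ∀ i → Star (L j) zero (suc i)
      from-zero i = linked-sym {i = suc _} {zero} (proj₂ base) ◅ recursive (proj₁ base) i
      star : ∀ i i′ → Star (L j) i i′
      star zero zero = ε
      star zero (suc i′) = from-zero i′
      star (suc i) zero = to-zero i
      star (suc i) (suc i′) = recursive i i′

  result : Splitting col (suc ν) _≟_ τ w p
  result = record
    { part = part
    ; size≡ = λ e → trans (∣∷∣ (z e) (R.part e)) (trans (cong (b2n (z e) +_) (R.size≡ e)) (sym (p≡ e)))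
    ; degrees = degrees
    ; mults = mults
    ; connected = connected
    }

-- The type of an edge is extended by its choice z, so that at the end it determines the whole part.
split : ∀ {N k M : ℕ} {T : Set} (col : Fin N → Fin k) n (_≟_ : DecidableEquality T)
        (τ : Fin N → T) (w : Fin N → Fin M) (p : Fin N → ℕ) → (∀ e → p e ≤ n) → Splitting col n _≟_ τ w p
split {N} col zero _≟_ τ w p p≤ = record
  { part = λ _ → []
  ; size≡ = λ e → sym (p≡0 e)
  ; degrees = λ q ()
  ; mults = λ { q t [] → near-cong (near-refl _) refl (∑-cong (λ e → cong (λ x → sel col q e * (𝟙 (τ e ≟ t) * x)) (sym (𝟙-yes (p e ℕ.≟ 0) (p≡0 e)))) (allFin N)) }
  ; connected = λ j _ ()
  }
  where
  p≡0 : ∀ e → p e ≡ 0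
  p≡0 e = n≤0⇒n≡0 (p≤ e)
split col (suc ν) _≟_ τ w p p≤ =
  let z , p′ , p′≤ , p≡ , near = splitOff (wingChain col _≟_ τ w p) (typeChain col _≟_ τ w p)
        (wingChain-refines col _≟_ τ w p) (typeChain-refines col _≟_ τ w p) p p≤
  in Step.result col ν _≟_ τ w p z p′ p≡ near
       (split col ν (_≟_ ×-≟ Bool._≟_) (λ e → τ e , z e) (Merge.merged col w z) p′ p′≤)

-- Connected components

Star-map : ∀ {R S : A → A → Set} → (∀ {x y} → R x y → Star S x y) → ∀ {x y} → Star R x y → Star S x y
Star-map f ε = ε
Star-map f (s ◅ ss) = f s ◅◅ Star-map f ss

Star-resp : ∀ {R : A → A → Set} (f : A → B) → (∀ {x y} → R x y → f x ≡ f y) → ∀ {x y} → Star R x y → f x ≡ f y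
Star-resp f resp ε = refl
Star-resp f resp (s ◅ ss) = trans (resp s) (Star-resp f resp ss)

Joined : List (A × A) → A → A → Set
Joined ps x y = (x , y) ∈ ps ⊎ (y , x) ∈ ps

module _ {c : ℕ} (a b : Fin (suc c)) (a≢b : a ≢ b) where

  identify : Fin (suc c) → Fin c
  identify i with b Fin.≟ i
  ... | yes _ = punchOut {i = b} {a} (a≢b ∘ sym)
  ... | no b≢i = punchOut b≢i

  identify-≡ : identify a ≡ identify b
  identify-≡ with b Fin.≟ a | b Fin.≟ b
  ... | yes b≡a | _ = ⊥-elim (a≢b (sym b≡a))
  ... | no _ | no b≢b = ⊥-elim (b≢b refl)
  ... | no b≢a | yes _ = punchOut-cong′ b refl

  identify-surjective : ∀ i → identify (punchIn b i) ≡ i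
  identify-surjective i with b Fin.≟ punchIn b i
  ... | yes eq = ⊥-elim (punchInᵢ≢i b i (sym eq))
  ... | no b≢ = trans (punchOut-cong′ b refl) (punchOut-punchIn b)

  identify-injective : ∀ i i′ → identify i ≡ identify i′ → i ≡ i′ ⊎ (i ≡ a × i′ ≡ b) ⊎ (i ≡ b × i′ ≡ a)
  identify-injective i i′ eq with b Fin.≟ i | b Fin.≟ i′
  ... | yes refl | yes refl = inj₁ refl
  ... | yes refl | no b≢i′ = inj₂ (inj₂ (refl , sym (punchOut-injective _ b≢i′ eq)))
  ... | no b≢i | yes refl = inj₂ (inj₁ (punchOut-injective b≢i _ eq , refl))
  ... | no b≢i | no b≢i′ = inj₁ (punchOut-injective b≢i b≢i′ eq)

-- `bound` records that each pair lowers the number of classes by at most one; it is the source of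
-- the necessary condition on the excess.
record Components {n : ℕ} (ps : List (Fin n × Fin n)) : Set where
  field
    {count}    : ℕ
    label      : Fin n → Fin count
    surjective : ∀ a → ∃ λ x → label x ≡ a
    sound      : ∀ x y → label x ≡ label y → Star (Joined ps) x y
    complete   : ∀ {x y} → (x , y) ∈ ps → label x ≡ label y
    bound      : n ≤ count + length ps

components : ∀ (ps : List (Fin n × Fin n)) → Components ps
components {n} [] = record
  { label = id ; surjective = λ a → a , refl ; sound = λ { x .x refl → ε } ; complete = λ () ; bound = m≤m+n n 0 }
components ((x , y) ∷ ps) with components ps
... | record { count = c ; label = lab ; surjective = sur ; sound = snd ; complete = com ; bound = bnd } with lab x Fin.≟ lab y
... | yes same = record
  { label = lab
  ; surjective = sur
  ; sound = λ u v eq → weaken (snd u v eq)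
  ; complete = λ { (here refl) → same ; (there p) → com p }
  ; bound = ≤-trans bnd (+-monoʳ-≤ c (n≤1+n _))
  }
  where
  weaken : ∀ {u v} → Star (Joined ps) u v → Star (Joined ((x , y) ∷ ps)) u v
  weaken = Star-map (λ { (inj₁ p) → inj₁ (there p) ◅ ε ; (inj₂ p) → inj₂ (there p) ◅ ε })
components ((x , y) ∷ ps) | record { count = zero ; label = lab } | no _ with () ← lab x
components {n} ((x , y) ∷ ps) | record { count = suc c ; label = lab ; surjective = sur ; sound = snd ; complete = com ; bound = bnd } | no differ = record
  { label = f ∘ lab
  ; surjective = λ a → let u , eq = sur (punchIn (lab y) a) in
                       u , trans (cong f eq) (identify-surjective (lab x) (lab y) differ a)
  ; sound = sound
  ; complete = λ { (here refl) → identify-≡ (lab x) (lab y) differ ; (there p) → cong f (com p) }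
  ; bound = ≤-trans bnd (≤-reflexive (sym (+-suc c _)))
  }
  where
  f = identify (lab x) (lab y) differ
  weaken : ∀ {u v} → Star (Joined ps) u v → Star (Joined ((x , y) ∷ ps)) u v
  weaken = Star-map (λ { (inj₁ p) → inj₁ (there p) ◅ ε ; (inj₂ p) → inj₂ (there p) ◅ ε })
  sound : ∀ u v → f (lab u) ≡ f (lab v) → Star (Joined ((x , y) ∷ ps)) u v
  sound u v eq with identify-injective (lab x) (lab y) differ (lab u) (lab v) eq
  ... | inj₁ same = weaken (snd u v same)
  ... | inj₂ (inj₁ (ux , vy)) = weaken (snd u x ux) ◅◅ (inj₁ (here refl) ◅ weaken (snd y v (sym vy)))
  ... | inj₂ (inj₂ (uy , vx)) = weaken (snd u y uy) ◅◅ (inj₂ (here refl) ◅ weaken (snd x v (sym vx)))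

record Quotient {n : ℕ} (R : Fin n → Fin n → Set) : Set where
  field
    {count}  : ℕ
    label    : Fin n → Fin count
    sound    : ∀ {x y} → label x ≡ label y → Star R x y
    complete : ∀ {x y} → R x y → label x ≡ label y

quotient : ∀ {R : Fin n → Fin n → Set} → (∀ x y → Dec (R x y)) → (∀ {x y} → R x y → R y x) → Quotient R
quotient {n} {R} R? R-sym = record
  { label = C.label
  ; sound = λ eq → Star-map step (C.sound _ _ eq)
  ; complete = λ {x} {y} r → C.complete (∈-filter⁺ related? (∈-cartesianProduct⁺ (∈-allFin x) (∈-allFin y)) r)
  }
  where
  related? : ∀ (p : Fin n × Fin n) → Dec (R (proj₁ p) (proj₂ p))
  related? p = R? (proj₁ p) (proj₂ p)
  pairs = filter related? (cartesianProduct (allFin n) (allFin n))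
  module C = Components (components pairs)
  step : ∀ {x y} → Joined pairs x y → Star R x y
  step (inj₁ p) = proj₂ (∈-filter⁻ related? {xs = cartesianProduct (allFin n) (allFin n)} p) ◅ ε
  step (inj₂ p) = R-sym (proj₂ (∈-filter⁻ related? {xs = cartesianProduct (allFin n) (allFin n)} p)) ◅ ε

-- Really a star centred at the first entry. It connects a list with `length ∸ 1` joins, the amount
-- that a wing contributes to the excess.
chain : List A → List (A × A)
chain [] = []
chain (x ∷ xs) = map (x ,_) xs

length-chain : ∀ (xs : List A) → length (chain xs) ≡ length xs ∸ 1
length-chain [] = refl
length-chain (x ∷ xs) = List.length-map (x ,_) xs

chain-connects : ∀ (f : A → B) (xs : List A) → (∀ {x y} → (x , y) ∈ chain xs → f x ≡ f y) →
                 ∀ {x y} → x ∈ xs → y ∈ xs → f x ≡ f y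
chain-connects f (z ∷ xs) resp x∈ y∈ = trans (sym (from-head x∈)) (from-head y∈)
  where
  from-head : ∀ {x} → x ∈ z ∷ xs → f z ≡ f x
  from-head (here refl) = refl
  from-head (there x∈) = resp (∈-map⁺ (z ,_) x∈)

length-concatMap : ∀ (f : A → List B) xs → length (concatMap f xs) ≡ ∑ xs (length ∘ f)
length-concatMap f [] = refl
length-concatMap f (x ∷ xs) = trans (List.length-++ (f x)) (cong (length (f x) +_) (length-concatMap f xs))

in-subset? : ∀ (U : Subset n) i → Dec (lookup U i ≡ true)
in-subset? U i = lookup U i Bool.≟ true

elements : Subset n → List (Fin n)
elements U = filter (in-subset? U) (allFin _)

∣∣-∑ : ∀ (U : Subset n) → ∣ U ∣ ≡ ∑ (allFin n) (λ i → 𝟙 (in-subset? U i))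
∣∣-∑ [] = refl
∣∣-∑ (b ∷ U) = trans (∣∷∣ b U)
  (sym (trans (∑-suc (λ i → 𝟙 (in-subset? (b ∷ U) i))) (cong₂ _+_ (head b) (sym (∣∣-∑ U)))))
  where
  head : ∀ b → 𝟙 (b Bool.≟ true) ≡ b2n b
  head false = refl
  head true = refl

length-elements : ∀ (U : Subset n) → length (elements U) ≡ ∣ U ∣
length-elements U = trans (length-filter-∑ (in-subset? U) (allFin _)) (sym (∣∣-∑ U))

-- A wing of degree d joins at most d parts, that is, it adds at most d ∸ 1 joins; connecting n parts takes n ∸ 1.
connected⇒excess : ∀ (col : Fin N → Fin k) (w : Fin N → Fin M) (p : Fin N → ℕ) (S : Fin N → Subset n) → (∀ e → ∣ S e ∣ ≡ p e) →
                   ∀ j → (∀ i i′ → Star (Linked col w S j) i i′) → n ≤ suc (excess col w p j)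
connected⇒excess {N} {k} {M} {n} col w p S size j conn = ≤-trans C.bound (+-mono-≤ count≤1 (≤-reflexive joins-length))
  where
  member? : ∀ l e → Dec (col e ≡ j × w e ≡ l)
  member? l e = (col e Fin.≟ j) ×-dec (w e Fin.≟ l)
  -- Parts are listed with repetition, once per copy, so that the length is exactly the degree of
  -- the wing.
  members : Fin M → List (Fin n)
  members l = concatMap (elements ∘ S) (filter (member? l) (allFin N))
  joins : List (Fin n × Fin n)
  joins = concatMap (chain ∘ members) (allFin M)
  module C = Components (components joins)

  members-length : ∀ l → length (members l) ≡ wingDeg col w p j l
  members-length l = begin
    length (members l)                                        ≡⟨ length-concatMap (elements ∘ S) (filter (member? l) (allFin N)) ⟩
    ∑ (filter (member? l) (allFin N)) (length ∘ elements ∘ S)  ≡⟨ ∑-filter (member? l) (allFin N) _ ⟩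
    ∑ (allFin N) (λ e → 𝟙 (member? l e) * length (elements (S e)))
      ≡⟨ ∑-cong (λ e → trans (cong₂ _*_ (b2n-∧ (does (col e Fin.≟ j)) _) (trans (length-elements (S e)) (size e))) (*-assoc (𝟙 (col e Fin.≟ j)) _ _)) (allFin N) ⟩
    wingDeg col w p j l ∎
    where open ≡-Reasoning
  joins-length : length joins ≡ excess col w p j
  joins-length = trans (length-concatMap (chain ∘ members) (allFin M))
    (∑-cong (λ l → trans (length-chain (members l)) (cong (_∸ 1) (members-length l))) (allFin M))

  in-members : ∀ {e l i} → col e ≡ j → w e ≡ l → lookup (S e) i ≡ true → i ∈ members l
  in-members {e} {l} {i} c≡ w≡ i∈ = ∈-concatMap⁺ (elements ∘ S) {xs = filter (member? l) (allFin N)}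
    (Any.map (λ { refl → ∈-filter⁺ (in-subset? (S e)) (∈-allFin i) i∈ }) (∈-filter⁺ (member? l) (∈-allFin e) (c≡ , w≡)))
  linked-label : ∀ {i i′} → Linked col w S j i i′ → C.label i ≡ C.label i′
  linked-label (e , e′ , c≡ , c≡′ , w≡ , i∈ , i′∈) =
    chain-connects C.label (members (w e))
      (λ p∈ → C.complete (∈-concatMap⁺ (chain ∘ members) {xs = allFin M} (Any.map (λ { refl → p∈ }) (∈-allFin (w e)))))
      (in-members c≡ refl i∈) (in-members c≡′ (sym w≡) i′∈)
  same : ∀ i i′ → C.label i ≡ C.label i′
  same i i′ = Star-resp C.label linked-label (conn i i′)
  count≤1 : C.count ≤ 1
  count≤1 = all-equal (λ a b → trans (sym (proj₂ (C.surjective a))) (trans (same _ _) (proj₂ (C.surjective b))))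
    where
    all-equal : ∀ {c} → (∀ (a b : Fin c) → a ≡ b) → c ≤ 1
    all-equal {zero} _ = z≤n
    all-equal {suc zero} _ = ≤-refl
    all-equal {suc (suc c)} eq with eq zero (suc zero)
    ... | ()

-- Wings of a hypergraph

module _ {P : Fin n → Set} (P? : ∀ x → Dec (P x)) where

  comprehension : Subset n
  comprehension = Vec.tabulate (does ∘ P?)

  ∈-comprehension⁺ : ∀ {x} → P x → x Sub.∈ comprehension
  ∈-comprehension⁺ {x} p = Vec.lookup⇒[]= x comprehension (trans (Vec.lookup∘tabulate (does ∘ P?) x) (is-true (P? x)))
    where
    is-true : (d : Dec (P x)) → does d ≡ true
    is-true (yes _) = refl
    is-true (no ¬p) = ⊥-elim (¬p p)

  ∈-comprehension⁻ : ∀ {x} → x Sub.∈ comprehension → P x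
  ∈-comprehension⁻ {x} x∈ = holds (P? x) (trans (sym (Vec.lookup∘tabulate (does ∘ P?) x)) (Vec.[]=⇒lookup x∈))
    where
    holds : (d : Dec (P x)) → does d ≡ true → P x
    holds (yes p) _ = p

unique-length : ∀ {xs ys : List A} → Unique xs → Unique ys → (∀ {x} → x ∈ xs ⇔ x ∈ ys) → length xs ≡ length ys
unique-length u v eq = ↭-length (∼bag⇒↭ (unique∧set⇒bag u v eq))

-- The labels are the classes of edges generated by sharing a vertex other than α. The wings turn
-- out to be exactly the classes that reach α, each with α and the vertices on its edges.
module Wings (G : Hyp m) (α : Fin m) (nonempty : ∀ i → ∃ λ v → Incident G i v)
             (label : Fin (length G) → Fin M)
             (sound : ∀ {i i′} → label i ≡ label i′ → Star (λ i i′ → ∃ λ v → v ≢ α × Incident G i v × Incident G i′ v) i i′)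
             (complete : ∀ {i i′ v} → v ≢ α → Incident G i v → Incident G i′ v → label i ≡ label i′) where

  incident? : ∀ i v → Dec (Incident G i v)
  incident? i v = 0 <? Vec.lookup (List.lookup G i) v

  Share : Fin (length G) → Fin (length G) → Set
  Share i i′ = ∃ λ v → v ≢ α × Incident G i v × Incident G i′ v

  active? : ∀ l → Dec (∃ λ i → label i ≡ l × Incident G i α)
  active? l = any? (λ i → (label i Fin.≟ l) ×-dec incident? i α)

  edgesOf : Fin M → Subset (length G)
  edgesOf l = comprehension (λ i → label i Fin.≟ l)

  spanned? : ∀ l v → Dec (v ≡ α ⊎ ∃ λ i → label i ≡ l × Incident G i v)
  spanned? l v = (v Fin.≟ α) ⊎-dec any? (λ i → (label i Fin.≟ l) ×-dec incident? i v)

  spannedBy : Fin M → Subset m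
  spannedBy l = comprehension (spanned? l)

  wing : Fin M → Subset m × Subset (length G)
  wing l = spannedBy l , edgesOf l

  share-path : ∀ {l i i′ u v} → Star Share i i′ → label i ≡ l → Incident G i u → Incident G i′ v →
               Star (AdjacentIn G (edgesOf l)) u v
  share-path {l} ε l≡ iu iv = (_ , ∈-comprehension⁺ (λ i → label i Fin.≟ l) l≡ , iu , iv) ◅ ε
  share-path {l} ((x , x≢α , ix , i₁x) ◅ path) l≡ iu i′v =
    (_ , ∈-comprehension⁺ (λ i → label i Fin.≟ l) l≡ , iu , ix) ◅
    share-path path (trans (sym (complete x≢α ix i₁x)) l≡) i₁x i′v

  share-closed : ∀ {P : Fin (length G) → Set} {i i′} → (∀ {i i′} → Share i i′ → label i ≡ label i′ → P i → P i′) →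
                 Star Share i i′ → P i → P i′
  share-closed step ε p = p
  share-closed {P} step ((x , x≢α , ix , i₁x) ◅ path) p =
    share-closed {P} step path (step (x , x≢α , ix , i₁x) (complete x≢α ix i₁x) p)

  wing-isWing : ∀ {l} → (∃ λ i → label i ≡ l × Incident G i α) → IsWing G α (wing l)
  wing-isWing {l} (i₀ , i₀l , i₀α) =
    ∈-comprehension⁺ (spanned? l) (inj₁ refl) ,
    (λ i i∈ v iv → ∈-comprehension⁺ (spanned? l) (inj₂ (i , ∈T⁻ i∈ , iv))) ,
    (i₀ , ∈T⁺ i₀l) ,
    (λ u v u∈ v∈ → let i , il , iu = cover u∈ ; i′ , i′l , i′v = cover v∈ in
                   share-path (sound (trans il (sym i′l))) il iu i′v) ,
    notCut ,
    outside
    where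
    ∈T⁺ : ∀ {i} → label i ≡ l → i Sub.∈ edgesOf l
    ∈T⁺ = ∈-comprehension⁺ (λ i → label i Fin.≟ l)
    ∈T⁻ : ∀ {i} → i Sub.∈ edgesOf l → label i ≡ l
    ∈T⁻ = ∈-comprehension⁻ (λ i → label i Fin.≟ l)
    cover : ∀ {u} → u Sub.∈ spannedBy l → ∃ λ i → label i ≡ l × Incident G i u
    cover u∈ with ∈-comprehension⁻ (spanned? l) u∈
    ... | inj₁ refl = i₀ , i₀l , i₀α
    ... | inj₂ c = c
    outside : ∀ i → i Sub.∉ edgesOf l → ∀ v → v Sub.∈ spannedBy l → v ≢ α → ¬ Incident G i v
    outside i i∉ v v∈ v≢α iv with ∈-comprehension⁻ (spanned? l) v∈
    ... | inj₁ v≡α = v≢α v≡α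
    ... | inj₂ (i′ , i′l , i′v) = i∉ (∈T⁺ (trans (complete v≢α iv i′v) i′l))
    -- Follow a sharing path from an edge of `T₁` to one of `T₂`. Crossing over would put a shared
    -- vertex other than α into `S₁ ∩ S₂`, so the path stays in `T₁` and its end lies in both edge
    -- sets.
    notCut : ¬ CutVertex G α (spannedBy l) (edgesOf l)
    notCut (S₁ , T₁ , S₂ , T₂ , sub₁ , sub₂ , (i₁ , i₁∈) , (i₂ , i₂∈) , S∪ , T∪ , S∩ , T∩) =
      Sub.∉⊥ (subst (i₂ Sub.∈_) T∩ (Sub.x∈p∩q⁺ (i₂∈T₁ , i₂∈)))
      where
      Member : Fin (length G) → Set
      Member i = i Sub.∈ T₁ × label i ≡ l
      step : ∀ {i i′} → Share i i′ → label i ≡ label i′ → Member i → Member i′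
      step {i} {i′} (v , v≢α , iv , i′v) eq (i∈ , il) with Sub.x∈p∪q⁻ T₁ T₂ (subst (i′ Sub.∈_) (sym T∪) (∈T⁺ (trans (sym eq) il)))
      ... | inj₁ i′∈T₁ = i′∈T₁ , trans (sym eq) il
      ... | inj₂ i′∈T₂ = ⊥-elim (v≢α (Sub.x∈⁅y⁆⇒x≡y α (subst (v Sub.∈_) S∩ (Sub.x∈p∩q⁺ (sub₁ i i∈ v iv , sub₂ i′ i′∈T₂ v i′v)))))
      label₁ : label i₁ ≡ l
      label₁ = ∈T⁻ (subst (i₁ Sub.∈_) T∪ (Sub.x∈p∪q⁺ (inj₁ i₁∈)))
      label₂ : label i₂ ≡ l
      label₂ = ∈T⁻ (subst (i₂ Sub.∈_) T∪ (Sub.x∈p∪q⁺ (inj₂ i₂∈)))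
      i₂∈T₁ : i₂ Sub.∈ T₁
      i₂∈T₁ = proj₁ (share-closed {P = Member} step (sound (trans label₁ (sym label₂))) (i₁∈ , label₁))

  -- No outside edge touches the wing off α, so `T` contains the whole class of `i₀`. If it
  -- contained an edge of another class, that class and the rest of `T` would exhibit α as a cut
  -- vertex. Connectedness to α then determines `S`.
  isWing⇒wing : ∀ {S T} → IsWing G α (S , T) → ∃ λ l → (∃ λ i → label i ≡ l × Incident G i α) × (S , T) ≡ wing l
  isWing⇒wing {S} {T} (α∈ , sub , (i₀ , i₀∈) , conn , notCut , outside) =
    l , attached , cong₂ _,_ S≡ T≡
    where
    l = label i₀
    step : ∀ {i i′} → Share i i′ → label i ≡ label i′ → i Sub.∈ T → i′ Sub.∈ T
    step {i} {i′} (v , v≢α , iv , i′v) _ i∈ with i′ Sub.∈? T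
    ... | yes i′∈ = i′∈
    ... | no i′∉ = ⊥-elim (outside i′ i′∉ v (sub i i∈ v iv) v≢α i′v)
    T⊇ : ∀ {i} → label i ≡ l → i Sub.∈ T
    T⊇ il = share-closed {P = Sub._∈ T} step (sound (sym il)) i₀∈
    T₁? : ∀ i → Dec (i Sub.∈ T × label i ≡ l)
    T₁? i = (i Sub.∈? T) ×-dec (label i Fin.≟ l)
    T₂? : ∀ i → Dec (i Sub.∈ T × label i ≢ l)
    T₂? i = (i Sub.∈? T) ×-dec ¬? (label i Fin.≟ l)
    S₁? : ∀ v → Dec (v Sub.∈ S × (v ≡ α ⊎ ∃ λ i → label i ≡ l × Incident G i v))
    S₁? v = (v Sub.∈? S) ×-dec spanned? l v
    S₂? : ∀ v → Dec (v Sub.∈ S × (v ≡ α ⊎ ¬ (∃ λ i → label i ≡ l × Incident G i v)))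
    S₂? v = (v Sub.∈? S) ×-dec ((v Fin.≟ α) ⊎-dec ¬? (any? (λ i → (label i Fin.≟ l) ×-dec incident? i v)))
    T₁ = comprehension T₁?
    T₂ = comprehension T₂?
    S₁ = comprehension S₁?
    S₂ = comprehension S₂?
    S∪ : S₁ ∪ S₂ ≡ S
    S∪ = Sub.⊆-antisym
      (λ v∈ → [ proj₁ ∘ ∈-comprehension⁻ S₁? , proj₁ ∘ ∈-comprehension⁻ S₂? ]′ (Sub.x∈p∪q⁻ S₁ S₂ v∈)) cover
      where
      cover : ∀ {v} → v Sub.∈ S → v Sub.∈ S₁ ∪ S₂
      cover {v} v∈ with any? (λ i → (label i Fin.≟ l) ×-dec incident? i v)
      ... | yes c = Sub.x∈p∪q⁺ (inj₁ (∈-comprehension⁺ S₁? (v∈ , inj₂ c)))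
      ... | no ¬c = Sub.x∈p∪q⁺ (inj₂ (∈-comprehension⁺ S₂? (v∈ , inj₂ ¬c)))
    T∪ : T₁ ∪ T₂ ≡ T
    T∪ = Sub.⊆-antisym
      (λ i∈ → [ proj₁ ∘ ∈-comprehension⁻ T₁? , proj₁ ∘ ∈-comprehension⁻ T₂? ]′ (Sub.x∈p∪q⁻ T₁ T₂ i∈)) cover
      where
      cover : ∀ {i} → i Sub.∈ T → i Sub.∈ T₁ ∪ T₂
      cover {i} i∈ with label i Fin.≟ l
      ... | yes eq = Sub.x∈p∪q⁺ (inj₁ (∈-comprehension⁺ T₁? (i∈ , eq)))
      ... | no ≢l = Sub.x∈p∪q⁺ (inj₂ (∈-comprehension⁺ T₂? (i∈ , ≢l)))
    S∩ : S₁ ∩ S₂ ≡ ⁅ α ⁆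
    S∩ = Sub.⊆-antisym only-α (λ v∈ → subst (Sub._∈ S₁ ∩ S₂) (sym (Sub.x∈⁅y⁆⇒x≡y α v∈))
           (Sub.x∈p∩q⁺ (∈-comprehension⁺ S₁? (α∈ , inj₁ refl) , ∈-comprehension⁺ S₂? (α∈ , inj₁ refl))))
      where
      only-α : ∀ {v} → v Sub.∈ S₁ ∩ S₂ → v Sub.∈ ⁅ α ⁆
      only-α {v} v∈ with Sub.x∈p∩q⁻ S₁ S₂ v∈
      ... | v∈₁ , v∈₂ with ∈-comprehension⁻ S₁? v∈₁ | ∈-comprehension⁻ S₂? v∈₂
      ... | _ , inj₁ refl | _ = Sub.x∈⁅x⁆ α
      ... | _ | _ , inj₁ refl = Sub.x∈⁅x⁆ α
      ... | _ , inj₂ c | _ , inj₂ ¬c = ⊥-elim (¬c c)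
    T∩ : T₁ ∩ T₂ ≡ Sub.⊥
    T∩ = Sub.⊆-antisym none (Sub.⊆-min (T₁ ∩ T₂))
      where
      none : ∀ {i} → i Sub.∈ T₁ ∩ T₂ → i Sub.∈ Sub.⊥
      none i∈ with Sub.x∈p∩q⁻ T₁ T₂ i∈
      ... | i∈₁ , i∈₂ = ⊥-elim (proj₂ (∈-comprehension⁻ T₂? i∈₂) (proj₂ (∈-comprehension⁻ T₁? i∈₁)))
    T⊆ : ∀ {i} → i Sub.∈ T → label i ≡ l
    T⊆ {i} i∈ with label i Fin.≟ l
    ... | yes eq = eq
    ... | no ≢l = ⊥-elim (notCut (S₁ , T₁ , S₂ , T₂ , sub₁ , sub₂ ,
            (i₀ , ∈-comprehension⁺ T₁? (i₀∈ , refl)) , (i , ∈-comprehension⁺ T₂? (i∈ , ≢l)) , S∪ , T∪ , S∩ , T∩))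
      where
      sub₁ : SubHyp G S₁ T₁
      sub₁ i i∈ v iv with ∈-comprehension⁻ T₁? i∈
      ... | i∈T , il = ∈-comprehension⁺ S₁? (sub i i∈T v iv , inj₂ (i , il , iv))
      sub₂ : SubHyp G S₂ T₂
      sub₂ i i∈ v iv with ∈-comprehension⁻ T₂? i∈ | v Fin.≟ α
      ... | i∈T , _ | yes v≡α = ∈-comprehension⁺ S₂? (sub i i∈T v iv , inj₁ v≡α)
      ... | i∈T , i≢l | no v≢α = ∈-comprehension⁺ S₂? (sub i i∈T v iv ,
              inj₂ (λ { (i′ , i′l , i′v) → i≢l (trans (complete v≢α iv i′v) i′l) }))
    T≡ : T ≡ edgesOf l
    T≡ = Sub.⊆-antisym (λ i∈ → ∈-comprehension⁺ (λ i → label i Fin.≟ l) (T⊆ i∈))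
                       (λ i∈ → T⊇ (∈-comprehension⁻ (λ i → label i Fin.≟ l) i∈))
    first-edge : ∀ {u v} → u ≢ v → Star (AdjacentIn G T) u v → ∃ λ i → i Sub.∈ T × Incident G i u
    first-edge u≢v ε = ⊥-elim (u≢v refl)
    first-edge u≢v ((i , i∈ , iu , _) ◅ _) = i , i∈ , iu
    S≡ : S ≡ spannedBy l
    S≡ = Sub.⊆-antisym (λ v∈ → ∈-comprehension⁺ (spanned? l) (covered v∈)) (λ v∈ → inside (∈-comprehension⁻ (spanned? l) v∈))
      where
      covered : ∀ {v} → v Sub.∈ S → v ≡ α ⊎ ∃ λ i → label i ≡ l × Incident G i v
      covered {v} v∈ with v Fin.≟ α
      ... | yes v≡α = inj₁ v≡α
      ... | no v≢α = let i , i∈ , iv = first-edge v≢α (conn v α v∈ α∈) in inj₂ (i , T⊆ i∈ , iv)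
      inside : ∀ {v} → v ≡ α ⊎ (∃ λ i → label i ≡ l × Incident G i v) → v Sub.∈ S
      inside (inj₁ refl) = α∈
      inside {v} (inj₂ (i , il , iv)) = sub i (T⊇ il) v iv
    attached : ∃ λ i → label i ≡ l × Incident G i α
    -- An edge is nonempty: either it contains α, or a path from α to one of its vertices begins
    -- with an edge at α.
    attached with nonempty i₀
    ... | v , i₀v with α Fin.≟ v
    ... | yes refl = i₀ , refl , i₀v
    ... | no α≢v = let i , i∈ , iα = first-edge α≢v (conn α v α∈ (sub i₀ i₀∈ v i₀v)) in i , T⊆ i∈ , iα

  wing-injective : ∀ {l l′} → (∃ λ i → label i ≡ l × Incident G i α) → wing l ≡ wing l′ → l ≡ l′
  wing-injective {l} {l′} (i , il , _) eq = trans (sym il)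
    (∈-comprehension⁻ (λ i → label i Fin.≟ l′) (subst (i Sub.∈_) (cong proj₂ eq) (∈-comprehension⁺ (λ i → label i Fin.≟ l) il)))

  wings : List (Subset m × Subset (length G))
  wings = map wing (filter active? (allFin M))

  wings-unique : Unique wings
  wings-unique = map-unique (All-filter (allFin M)) (Unique.filter⁺ active? (Unique.allFin⁺ M))
    where
    All-filter : ∀ ls → All (λ l → ∃ λ i → label i ≡ l × Incident G i α) (filter active? ls)
    All-filter ls = All.tabulate (λ l∈ → proj₂ (∈-filter⁻ active? {xs = ls} l∈))
    map-unique : ∀ {ls} → All (λ l → ∃ λ i → label i ≡ l × Incident G i α) ls → Unique ls → Unique (map wing ls)
    map-unique [] [] = []
    map-unique (act ∷ acts) (l∉ ∷ u) =
      All.tabulate (λ W∈ eq → let l′ , l′∈ , W≡ = ∈-map⁻ wing W∈ in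
                              All.lookup l∉ l′∈ (wing-injective act (trans eq W≡))) ∷ map-unique acts u

  wing-count : ∀ {w} → WingCount G α w → w ≡ ∑ (allFin M) (λ l → 𝟙 (active? l))
  wing-count (L , unique , members , refl) = begin
    length L                              ≡⟨ unique-length unique wings-unique (mk⇔ to from) ⟩
    length wings                          ≡⟨ List.length-map wing (filter active? (allFin M)) ⟩
    length (filter active? (allFin M))    ≡⟨ length-filter-∑ active? (allFin M) ⟩
    ∑ (allFin M) (λ l → 𝟙 (active? l))    ∎
    where
    open ≡-Reasoning
    to : ∀ {W} → W ∈ L → W ∈ wings
    to {W} W∈ with isWing⇒wing (Equivalence.to (members W) W∈)
    ... | l , act , refl = ∈-map⁺ wing (∈-filter⁺ active? (∈-allFin l) act)
    from : ∀ {W} → W ∈ wings → W ∈ L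
    from {W} W∈ with ∈-map⁻ wing W∈
    ... | l , l∈ , refl = Equivalence.from (members W) (wing-isWing (proj₂ (∈-filter⁻ active? {xs = allFin M} l∈)))

-- Counting in hypergraphs

C-pos : ∀ n k → k ≤ n → 0 < n C k
C-pos n zero _ = z<s
C-pos (suc n) (suc k) (s≤s k≤n) = ≤-trans (C-pos n k k≤n) (≤-trans (m≤m+n _ _) (≤-reflexive (nCk+nC[k+1]≡[n+1]C[k+1] n k)))

near⇒≈ : ∀ {x y d} → 0 < d → Near x y d → x ≈ y / d
near⇒≈ {x} {y} {suc d} _ (y< , x<) =
  s≤s⁻¹ (m<n*o⇒m/o<n {y} {suc x} {suc d} y<) ,
  ≤-trans (≤-reflexive (sym (m*n/n≡m x (suc d))))
          (/-monoˡ-≤ (suc d) (s≤s⁻¹ (≤-trans x< (≤-reflexive (+-suc y d)))))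

-- Filtering renumbers the edges of a colour class. `pos` recovers the original numbers, bijectively
-- onto the edges that satisfy `P`.
Picked : ∀ {P : A → Set} (P? : ∀ x → Dec (P x)) (f : A → B) (xs : List A) → Set
Picked {P = P} P? f xs = Σ (Fin (length (map f (filter P? xs))) → Fin (length xs)) λ pos →
  (∀ i → List.lookup (map f (filter P? xs)) i ≡ f (List.lookup xs (pos i))) ×
  (∀ i → P (List.lookup xs (pos i))) ×
  (∀ e → P (List.lookup xs e) → ∃ λ i → pos i ≡ e) ×
  (∀ {i i′} → pos i ≡ pos i′ → i ≡ i′)

picked : ∀ {P : A → Set} (P? : ∀ x → Dec (P x)) (f : A → B) xs → Picked P? f xs
picked P? f [] = (λ ()) , (λ ()) , (λ ()) , (λ ()) , λ { {()} }
picked P? f (x ∷ xs) with P? x | picked P? f xs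
... | no ¬p | pos , look , holds , sur , inj =
  suc ∘ pos , look , holds ,
  (λ { zero p → ⊥-elim (¬p p) ; (suc e) p → let i , eq = sur e p in i , cong suc eq }) ,
  inj ∘ suc-injective
... | yes p | pos , look , holds , sur , inj =
  (λ { zero → zero ; (suc i) → suc (pos i) }) ,
  (λ { zero → refl ; (suc i) → look i }) ,
  (λ { zero → p ; (suc i) → holds i }) ,
  (λ { zero _ → zero , refl ; (suc e) q → let i , eq = sur e q in suc i , cong suc eq }) ,
  λ { {zero} {zero} _ → refl ; {suc i} {suc i′} eq → cong suc (inj (suc-injective eq)) }

-- Definitionally `underlying` for `nothing` and `colourClass` for `just j`, so the uncoloured and
-- coloured conditions have one proof.
selected : Maybe (Fin k) → List (Edge m × Fin k) → Hyp m
selected nothing xs = map proj₁ xs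
selected (just j) xs = map proj₁ (filter (λ ec → proj₂ ec Fin.≟ j) xs)

∑-selected : ∀ q (g : Fin N → Edge m × Fin k) (f : Edge m → ℕ) →
             ∑ (selected q (map g (allFin N))) f ≡ ∑ (allFin N) (λ e → sel (proj₂ ∘ g) q e * f (proj₁ (g e)))
∑-selected {N} nothing g f = trans (∑-map proj₁ (map g (allFin N)) f)
  (trans (∑-map g (allFin N) (f ∘ proj₁)) (∑-cong (λ e → sym (*-identityˡ _)) (allFin N)))
∑-selected {N} (just j) g f = trans (∑-map proj₁ (filter (λ ec → proj₂ ec Fin.≟ j) (map g (allFin N))) f)
  (trans (∑-filter (λ ec → proj₂ ec Fin.≟ j) (map g (allFin N)) (f ∘ proj₁))
         (∑-map g (allFin N) (λ ec → 𝟙 (proj₂ ec Fin.≟ j) * f (proj₁ ec))))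

map-lookup : ∀ (xs : List A) → map (List.lookup xs) (allFin (length xs)) ≡ xs
map-lookup xs = trans (List.map-tabulate id (List.lookup xs)) (List.tabulate-lookup xs)

_≟ᵉ_ : DecidableEquality (Vec ℕ m)
_≟ᵉ_ = Vec.≡-dec ℕ._≟_

mult-∑ : ∀ (G : Hyp m) U → mult G U ≡ ∑ G (λ e → 𝟙 (e ≟ᵉ U))
mult-∑ G U = length-filter-∑ (_≟ᵉ U) G

∈-coloured⁻ : ∀ {j : Fin k} {x : Edge m} xs → x ∈ selected (just j) xs → ∃ λ e → proj₂ (List.lookup xs e) ≡ j × x ≡ proj₁ (List.lookup xs e)
∈-coloured⁻ {j = j} xs x∈ with ∈-map⁻ proj₁ x∈
... | ec , ec∈ , refl with ∈-filter⁻ (λ ec → proj₂ ec Fin.≟ j) {xs = xs} ec∈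
... | ec∈xs , c≡ with Any.index ec∈xs | lookup-index ec∈xs
... | e | refl = e , c≡ , refl

∈-coloured⁺ : ∀ {j : Fin k} {ec : Edge m × Fin k} {xs} → ec ∈ xs → proj₂ ec ≡ j → proj₁ ec ∈ selected (just j) xs
∈-coloured⁺ {j = j} ec∈ c≡ = ∈-map⁺ proj₁ (∈-filter⁺ (λ ec → proj₂ ec Fin.≟ j) ec∈ c≡)

lookup-setMS : ∀ (U : Subset n) i → lookup (setMS U) i ≡ b2n (lookup U i)
lookup-setMS (true ∷ U) zero = refl
lookup-setMS (false ∷ U) zero = refl
lookup-setMS (_ ∷ U) (suc i) = lookup-setMS U i

sum-setMS : ∀ (U : Subset n) → Vec.sum (setMS U) ≡ ∣ U ∣
sum-setMS [] = refl
sum-setMS (true ∷ U) = cong suc (sum-setMS U)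
sum-setMS (false ∷ U) = sum-setMS U

setMS-injective : ∀ (U V : Subset n) → setMS U ≡ setMS V → U ≡ V
setMS-injective [] [] _ = refl
setMS-injective (true ∷ U) (true ∷ V) eq = cong (true ∷_) (setMS-injective U V (Vec.∷-injectiveʳ eq))
setMS-injective (false ∷ U) (false ∷ V) eq = cong (false ∷_) (setMS-injective U V (Vec.∷-injectiveʳ eq))

sum-removeAt : ∀ (xs : Vec ℕ (suc m)) i → lookup xs i + Vec.sum (removeAt xs i) ≡ Vec.sum xs
sum-removeAt (x ∷ xs) zero = refl
sum-removeAt (x ∷ xs@(_ ∷ _)) (suc i) = trans (exch (lookup xs i) x _) (cong (x +_) (sum-removeAt xs i))
  where
  exch : ∀ a b c → a + (b + c) ≡ b + (a + c)
  exch = solve-∀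

take-++ : ∀ (xs : Vec A n) (ys : Vec A m) → take n (xs Vec.++ ys) ≡ xs
take-++ [] ys = refl
take-++ (x ∷ xs) ys = cong (x ∷_) (take-++ xs ys)

drop-++ : ∀ (xs : Vec A n) (ys : Vec A m) → drop n (xs Vec.++ ys) ≡ ys
drop-++ [] ys = refl
drop-++ (x ∷ xs) ys = drop-++ xs ys

lookup-removeAt : ∀ (xs : Vec A (suc m)) i u → lookup (removeAt xs i) u ≡ lookup xs (punchIn i u)
lookup-removeAt xs i u = trans (sym (Vec.insertAt-punchIn (removeAt xs i) i (lookup xs i) u))
                               (cong (λ ys → lookup ys (punchIn i u)) (Vec.insertAt-removeAt xs i))

addCopies-removed : ∀ (xs : Vec ℕ m) i → addCopies i (lookup xs i) (updateAt xs i (λ _ → 0)) ≡ xs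
addCopies-removed (x ∷ xs) zero = cong (_∷ xs) (+-identityʳ x)
addCopies-removed (x ∷ xs) (suc i) = cong (x ∷_) (addCopies-removed xs i)

sum-pos : ∀ (xs : Vec ℕ m) → 0 < Vec.sum xs → ∃ λ v → 0 < lookup xs v
sum-pos (suc x ∷ xs) _ = zero , z<s
sum-pos (zero ∷ xs) lt with sum-pos xs lt
... | v , pos = suc v , pos

Pointwise-tabulate : ∀ {R : A → B → Set} (f : Fin N → A) (g : Fin N → B) → (∀ e → R (f e) (g e)) →
                     Pointwise R (List.tabulate f) (List.tabulate g)
Pointwise-tabulate {N = zero} f g r = []
Pointwise-tabulate {N = suc N} f g r = r zero ∷ Pointwise-tabulate (f ∘ suc) (g ∘ suc) (r ∘ suc)

-- Pigeonhole: an element `a` with `s (f a) ≢ a` is missed by the injective map `s`, and adding it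
-- would inject `c + 1` elements into `c`.
section⇒injective : ∀ {c} (f s : Fin c → Fin c) → (∀ b → f (s b) ≡ b) → ∀ {a a′} → f a ≡ f a′ → a ≡ a′
section⇒injective {c} f s fs {a} {a′} eq = trans (sym (sf a)) (trans (cong s eq) (sf a′))
  where
  s-injective : ∀ {b b′} → s b ≡ s b′ → b ≡ b′
  s-injective {b} {b′} eq = trans (sym (fs b)) (trans (cong f eq) (fs b′))
  sf : ∀ a → s (f a) ≡ a
  sf a with s (f a) Fin.≟ a
  ... | yes eq = eq
  ... | no ≢a = ⊥-elim (1+n≰n (injective⇒≤ {f = extended} extended-injective))
    where
    extended : Fin (suc c) → Fin c
    extended zero = a
    extended (suc b) = s b
    missed : ∀ b → a ≢ s b
    missed b eq = ≢a (trans (cong s (trans (cong f eq) (fs b))) (sym eq))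
    extended-injective : ∀ {b b′} → extended b ≡ extended b′ → b ≡ b′
    extended-injective {zero} {zero} _ = refl
    extended-injective {zero} {suc b} eq = ⊥-elim (missed b eq)
    extended-injective {suc b} {zero} eq = ⊥-elim (missed b (sym eq))
    extended-injective {suc b} {suc b′} eq = cong suc (s-injective eq)

-- Comparing numbers of components along a surjection

module _ {GF : Hyp n} {GH : Hyp m} (φ : Fin n → Fin m) (ψ : Fin m → Fin n) (φψ : ∀ y → φ (ψ y) ≡ y)
         (φ-connected : ∀ {u v} → Connected GF u v → Connected GH (φ u) (φ v)) where

  -- `φ` induces a surjection `f` on components, with section `s`. Between finite sets it is
  -- injective exactly when the counts agree, and injectivity of `f` means that connections are
  -- reflected.
  equal-components : ∀ {cF cH} → HasComponents GF cF → HasComponents GH cH →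
                     (cF ≡ cH) ⇔ (∀ u v → Connected GH (φ u) (φ v) → Connected GF u v)
  equal-components {cF} {cH} (compF , surF , F⇔) (compH , surH , H⇔) = mk⇔ to from
    where
    f : Fin cF → Fin cH
    f a = compH (φ (proj₁ (surF a)))
    s : Fin cH → Fin cF
    s b = compF (ψ (proj₁ (surH b)))
    f-comp : ∀ u → f (compF u) ≡ compH (φ u)
    f-comp u = Equivalence.from (H⇔ _ _) (φ-connected (Equivalence.to (F⇔ _ _) (proj₂ (surF (compF u)))))
    fs : ∀ b → f (s b) ≡ b
    fs b = trans (f-comp _) (trans (cong compH (φψ _)) (proj₂ (surH b)))
    to : cF ≡ cH → ∀ u v → Connected GH (φ u) (φ v) → Connected GF u v
    to refl u v conn = Equivalence.to (F⇔ u v) (section⇒injective f s fs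
      (trans (f-comp u) (trans (Equivalence.from (H⇔ _ _) conn) (sym (f-comp v)))))
    from : (∀ u v → Connected GH (φ u) (φ v) → Connected GF u v) → cF ≡ cH
    from reflect = ≤-antisym (injective⇒≤ {f = f} f-injective) (injective⇒≤ {f = s} s-injective)
      where
      f-injective : ∀ {a a′} → f a ≡ f a′ → a ≡ a′
      f-injective {a} {a′} eq = trans (sym (proj₂ (surF a)))
        (trans (Equivalence.from (F⇔ _ _) (reflect _ _ (Equivalence.to (H⇔ _ _) eq))) (proj₂ (surF a′)))
      s-injective : ∀ {b b′} → s b ≡ s b′ → b ≡ b′
      s-injective {b} {b′} eq = trans (sym (fs b)) (trans (cong f eq) (fs b′))

-- The detachment

lookup⇒∣∣>0 : ∀ {n} (U : Subset n) i → 0 < b2n (lookup U i) → 0 < ∣ U ∣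
lookup⇒∣∣>0 (true ∷ U) _ _ = z<s
lookup⇒∣∣>0 (false ∷ U) (suc i) lt = lookup⇒∣∣>0 U i lt

b2n>0⇒true : ∀ {b} → 0 < b2n b → b ≡ true
b2n>0⇒true {true} _ = refl

true⇒b2n>0 : ∀ {b} → b ≡ true → 0 < b2n b
true⇒b2n>0 refl = z<s

module EdgeData {m k : ℕ} (H : CHyp (suc m) k) (α : Fin (suc m)) where

  edgeCount : ℕ
  edgeCount = length (edges H)

  ed : Fin edgeCount → Edge (suc m)
  ed e = proj₁ (List.lookup (edges H) e)
  col : Fin edgeCount → Fin k
  col e = proj₂ (List.lookup (edges H) e)
  p : Fin edgeCount → ℕ
  p e = lookup (ed e) α
  rest : Fin edgeCount → MSet m
  rest e = removeAt (ed e) α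

  p≤n : ∀ n → (∀ t Y → n + 1 ≤ t → mult (underlying H) (addCopies α t Y) ≡ 0) → ∀ e → p e ≤ n
  p≤n n bounded e with p e ≤? n
  ... | yes p≤ = p≤
  ... | no p≰ = ⊥-elim (<-irrefl refl (begin-strict
    0                                                    <⟨ z<s ⟩
    1                                                    ≡⟨ 𝟙-yes (ed e ≟ᵉ U) (sym (addCopies-removed (ed e) α)) ⟨
    𝟙 (ed e ≟ᵉ U)                                        ≤⟨ ∈⇒≤∑ (λ x → 𝟙 (x ≟ᵉ U)) (∈-map⁺ proj₁ (∈-lookup {xs = edges H} e)) ⟩
    ∑ (underlying H) (λ x → 𝟙 (x ≟ᵉ U))                  ≡⟨ mult-∑ (underlying H) U ⟨
    mult (underlying H) U                                ≡⟨ bounded (p e) _ (≤-trans (≤-reflexive (+-comm n 1)) (≰⇒> p≰)) ⟩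
    0                                                    ∎))
    where
    open ≤-Reasoning
    -- `Y` is the edge with its copies of α erased; adding `p e` copies restores the edge, whose
    -- multiplicity is positive.
    U = addCopies α (p e) (updateAt (ed e) α (λ _ → 0))

  -- Requiring equal colours lets one quotient label the wings of all colour classes simultaneously.
  Adj : Fin edgeCount → Fin edgeCount → Set
  Adj e e′ = col e ≡ col e′ × ∃ λ v → v ≢ α × 0 < lookup (ed e) v × 0 < lookup (ed e′) v

  adj? : ∀ e e′ → Dec (Adj e e′)
  adj? e e′ = (col e Fin.≟ col e′) ×-dec
    any? (λ v → ¬? (v Fin.≟ α) ×-dec ((0 <? lookup (ed e) v) ×-dec (0 <? lookup (ed e′) v)))

  adj-sym : ∀ {e e′} → Adj e e′ → Adj e′ e
  adj-sym (c≡ , v , v≢α , ev , e′v) = sym c≡ , v , v≢α , e′v , ev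

module Detach {m k : ℕ} (n′ : ℕ) (H : CHyp (suc m) k) (α : Fin (suc m)) (quot : Quotient (EdgeData.Adj H α))
              (splitting : Splitting (EdgeData.col H α) (suc n′) _≟ᵉ_ (EdgeData.rest H α) (Quotient.label quot) (EdgeData.p H α)) where

  open EdgeData H α

  n₁ : ℕ
  n₁ = suc n′

  module Q = Quotient quot
  module R = Splitting splitting

  fe : Fin edgeCount → Edge (n₁ + m)
  fe e = setMS (R.part e) Vec.++ rest e

  sum-fe : ∀ e → Vec.sum (fe e) ≡ Vec.sum (ed e)
  sum-fe e = trans (Vec.sum-++ (setMS (R.part e)))
    (trans (cong (_+ Vec.sum (rest e)) (trans (sum-setMS (R.part e)) (R.size≡ e))) (sum-removeAt (ed e) α))

  nonempty-ed : ∀ e → 0 < Vec.sum (ed e)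
  nonempty-ed e = All.lookup (nonempty H) (∈-lookup {xs = edges H} e)

  F : CHyp (n₁ + m) k
  F = record
    { edges = map (λ e → fe e , col e) (allFin edgeCount)
    ; nonempty = All.tabulate λ x∈ → let e , _ , eq = ∈-map⁻ (λ e → fe e , col e) x∈ in
                   subst (λ ec → 0 < Vec.sum (proj₁ ec)) (sym eq) (subst (0 <_) (sym (sum-fe e)) (nonempty-ed e))
    }

  isDetachment : IsDetachment α n₁ F H
  isDetachment = subst₂ (Pointwise _) (sym (List.map-tabulate id (λ e → fe e , col e))) (List.tabulate-lookup (edges H))
    (Pointwise-tabulate (λ e → fe e , col e) (List.lookup (edges H)) (λ e → merge e , refl))
    where
    merge : ∀ e → ed e ≡ insertAt (drop n₁ (fe e)) α (Vec.sum (take n₁ (fe e)))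
    merge e = sym (begin
      insertAt (drop n₁ (fe e)) α (Vec.sum (take n₁ (fe e)))
        ≡⟨ cong₂ (λ xs ys → insertAt xs α (Vec.sum ys)) (drop-++ (setMS (R.part e)) (rest e)) (take-++ (setMS (R.part e)) (rest e)) ⟩
      insertAt (rest e) α (Vec.sum (setMS (R.part e)))
        ≡⟨ cong (insertAt (rest e) α) (trans (sum-setMS (R.part e)) (R.size≡ e)) ⟩
      insertAt (rest e) α (p e)
        ≡⟨ Vec.insertAt-removeAt (ed e) α ⟩
      ed e ∎)
      where open ≡-Reasoning

  lookup-new : ∀ e i → lookup (fe e) (i ↑ˡ m) ≡ b2n (lookup (R.part e) i)
  lookup-new e i = trans (Vec.lookup-++ˡ (setMS (R.part e)) (rest e) i) (lookup-setMS (R.part e) i)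

  lookup-old : ∀ e u → lookup (fe e) (n₁ ↑ʳ u) ≡ lookup (ed e) (punchIn α u)
  lookup-old e u = trans (Vec.lookup-++ʳ (setMS (R.part e)) (rest e) u) (lookup-removeAt (ed e) α u)

  simple : αSimple n₁ F
  simple = All.tabulate λ x∈ i → let e , _ , eq = ∈-map⁻ (λ e → fe e , col e) x∈ in
    subst (λ ec → lookup (proj₁ ec) (i ↑ˡ m) ≤ 1) (sym eq)
          (≤-trans (≤-reflexive (lookup-new e i)) (b2n≤1 (lookup (R.part e) i)))

  ∑-H : ∀ q (f : Edge (suc m) → ℕ) → ∑ (selected q (edges H)) f ≡ ∑ (allFin edgeCount) (λ e → sel col q e * f (ed e))
  ∑-H q f = trans (cong (λ xs → ∑ (selected q xs) f) (sym (map-lookup (edges H)))) (∑-selected q (List.lookup (edges H)) f)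

  ∑-F : ∀ q (f : Edge (n₁ + m) → ℕ) → ∑ (selected q (edges F)) f ≡ ∑ (allFin edgeCount) (λ e → sel col q e * f (fe e))
  ∑-F q f = ∑-selected q (λ e → fe e , col e) f

  degrees : ∀ q i → deg (selected q (edges F)) (i ↑ˡ m) ≈ deg (selected q (edges H)) α / n₁
  degrees q i = near⇒≈ z<s (near-cong (R.degrees q i)
    (sym (trans (∑-F q (λ x → lookup x (i ↑ˡ m))) (∑-cong (λ e → cong (sel col q e *_) (lookup-new e i)) (allFin edgeCount))))
    (sym (∑-H q (λ x → lookup x α))))

  mults : ∀ q (U : Subset n₁) (X : MSet m) →
          mult (selected q (edges F)) (detMS U X) ≈ mult (selected q (edges H)) (origMS α ∣ U ∣ X) / (n₁ C ∣ U ∣)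
  mults q U X = near⇒≈ (C-pos n₁ ∣ U ∣ (Sub.∣p∣≤n U)) (near-cong (R.mults q X U)
    (sym (trans (mult-∑ (selected q (edges F)) (detMS U X)) (trans (∑-F q _) (∑-cong (λ e → cong (sel col q e *_) (in-F e)) (allFin edgeCount)))))
    (sym (trans (mult-∑ (selected q (edges H)) (origMS α ∣ U ∣ X)) (trans (∑-H q _) (∑-cong (λ e → cong (sel col q e *_) (in-H e)) (allFin edgeCount))))))
    where
    in-F : ∀ e → 𝟙 (fe e ≟ᵉ detMS U X) ≡ 𝟙 (rest e ≟ᵉ X) * 𝟙 (R.part e ≟ˢ U)
    in-F e = trans (𝟙-cong (fe e ≟ᵉ detMS U X) ((rest e ≟ᵉ X) ×-dec (R.part e ≟ˢ U))
      (λ eq → let eqU , eqX = Vec.++-injective (setMS (R.part e)) (setMS U) eq in eqX , setMS-injective (R.part e) U eqU)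
      (λ (eqX , eqU) → cong₂ (λ V Y → setMS V Vec.++ Y) eqU eqX)) (b2n-∧ (does (rest e ≟ᵉ X)) _)
    in-H : ∀ e → 𝟙 (ed e ≟ᵉ origMS α ∣ U ∣ X) ≡ 𝟙 (rest e ≟ᵉ X) * 𝟙 (p e ℕ.≟ ∣ U ∣)
    in-H e = trans (𝟙-cong (ed e ≟ᵉ origMS α ∣ U ∣ X) ((rest e ≟ᵉ X) ×-dec (p e ℕ.≟ ∣ U ∣))
      (λ eq → trans (cong (λ x → removeAt x α) eq) (Vec.removeAt-insertAt X α ∣ U ∣) ,
              trans (cong (λ x → lookup x α) eq) (Vec.insertAt-lookup X α ∣ U ∣))
      (λ (eqX , eqp) → trans (sym (Vec.insertAt-removeAt (ed e) α)) (cong₂ (λ Y t → insertAt Y α t) eqX eqp)))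
      (b2n-∧ (does (rest e ≟ᵉ X)) _)

  data View : Fin (n₁ + m) → Set where
    new : ∀ i → View (i ↑ˡ m)
    old : ∀ u → View (n₁ ↑ʳ u)

  view : ∀ v → View v
  view v with splitAt n₁ v in eq
  ... | inj₁ i = subst View (splitAt⁻¹-↑ˡ {i = v} eq) (new i)
  ... | inj₂ u = subst View (splitAt⁻¹-↑ʳ {i = v} eq) (old u)

  φ : Fin (n₁ + m) → Fin (suc m)
  φ v = [ (λ _ → α) , punchIn α ]′ (splitAt n₁ v)

  φ-new : ∀ i → φ (i ↑ˡ m) ≡ α
  φ-new i = cong [ (λ _ → α) , punchIn α ]′ (splitAt-↑ˡ n₁ i m)

  φ-old : ∀ u → φ (n₁ ↑ʳ u) ≡ punchIn α u
  φ-old u = cong [ (λ _ → α) , punchIn α ]′ (splitAt-↑ʳ n₁ m u)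

  ψ : Fin (suc m) → Fin (n₁ + m)
  ψ y with α Fin.≟ y
  ... | yes _ = zero ↑ˡ m
  ... | no α≢y = n₁ ↑ʳ punchOut α≢y

  φψ : ∀ y → φ (ψ y) ≡ y
  φψ y with α Fin.≟ y
  ... | yes refl = φ-new zero
  ... | no α≢y = trans (φ-old (punchOut α≢y)) (punchIn-punchOut α≢y)

  IncF : Fin edgeCount → Fin (n₁ + m) → Set
  IncF e v = 0 < lookup (fe e) v
  IncH : Fin edgeCount → Fin (suc m) → Set
  IncH e v = 0 < lookup (ed e) v

  inc-φ : ∀ {e v} → IncF e v → IncH e (φ v)
  inc-φ {e} {v} ev with view v
  ... | new i = subst (IncH e) (sym (φ-new i))
    (subst (0 <_) (R.size≡ e) (lookup⇒∣∣>0 (R.part e) i (subst (0 <_) (lookup-new e i) ev)))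
  ... | old u = subst (IncH e) (sym (φ-old u)) (subst (0 <_) (lookup-old e u) ev)

  inc-part : ∀ {e i} → lookup (R.part e) i ≡ true → IncF e (i ↑ˡ m)
  inc-part {e} {i} i∈ = subst (0 <_) (sym (lookup-new e i)) (true⇒b2n>0 i∈)

  part-inc : ∀ {e i} → IncF e (i ↑ˡ m) → lookup (R.part e) i ≡ true
  part-inc {e} {i} ei = b2n>0⇒true (subst (0 <_) (lookup-new e i) ei)

  inc-lift : ∀ {e y} → IncH e y → ∃ λ v → φ v ≡ y × IncF e v
  inc-lift {e} {y} ey with α Fin.≟ y
  ... | yes refl = let i , i∈ = nonempty-lookup (R.part e) (subst (0 <_) (sym (R.size≡ e)) ey) in
                   i ↑ˡ m , φ-new i , inc-part i∈
  ... | no α≢y = n₁ ↑ʳ punchOut α≢y , trans (φ-old _) (punchIn-punchOut α≢y) ,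
                 subst (0 <_) (sym (trans (lookup-old e _) (cong (lookup (ed e)) (punchIn-punchOut α≢y)))) ey

  -- Connectivity and wings of one colour class

  module Coloured (j : Fin k) where

    GF : Hyp (n₁ + m)
    GF = colourClass F j
    GH : Hyp (suc m)
    GH = colourClass H j

    adjH⁻ : ∀ {u v} → Adjacent GH u v → ∃ λ e → col e ≡ j × IncH e u × IncH e v
    adjH⁻ (x , x∈ , xu , xv) with ∈-coloured⁻ (edges H) x∈
    ... | e , c≡ , refl = e , c≡ , xu , xv

    adjH⁺ : ∀ {u v} e → col e ≡ j → IncH e u → IncH e v → Adjacent GH u v
    adjH⁺ e c≡ eu ev = ed e , ∈-coloured⁺ (∈-lookup {xs = edges H} e) c≡ , eu , ev

    adjF⁻ : ∀ {u v} → Adjacent GF u v → ∃ λ e → col e ≡ j × IncF e u × IncF e v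
    adjF⁻ (x , x∈ , xu , xv) with ∈-map⁻ proj₁ x∈
    ... | ec , ec∈ , refl with ∈-filter⁻ (λ ec → proj₂ ec Fin.≟ j) {xs = edges F} ec∈
    ... | ec∈F , c≡ with ∈-map⁻ (λ e → fe e , col e) ec∈F
    ... | e , _ , refl = e , c≡ , xu , xv

    adjF⁺ : ∀ {u v} e → col e ≡ j → IncF e u → IncF e v → Adjacent GF u v
    adjF⁺ e c≡ eu ev = fe e , ∈-coloured⁺ (∈-map⁺ (λ e → fe e , col e) (∈-allFin e)) c≡ , eu , ev

    φ-connected : ∀ {u v} → Connected GF u v → Connected GH (φ u) (φ v)
    φ-connected ε = ε
    φ-connected (s ◅ ss) = let e , c≡ , eu , ev = adjF⁻ s in adjH⁺ e c≡ (inc-φ eu) (inc-φ ev) ◅ φ-connected ss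

    PartsConnected : Set
    PartsConnected = ∀ i i′ → Connected GF (i ↑ˡ m) (i′ ↑ˡ m)

    -- A path is lifted edge by edge. Where consecutive lifts fail to meet, their ends have the same
    -- image, so they are both parts of α and `parts` bridges the gap.
    reflects : PartsConnected → ∀ u v → Connected GH (φ u) (φ v) → Connected GF u v
    reflects parts u v conn = go conn refl refl
      where
      same-image : ∀ {u v} → φ u ≡ φ v → Connected GF u v
      same-image {u} {v} eq with view u | view v
      ... | new i | new i′ = parts i i′
      ... | new i | old y = ⊥-elim (punchInᵢ≢i α y (trans (sym (φ-old y)) (trans (sym eq) (φ-new i))))
      ... | old x | new i = ⊥-elim (punchInᵢ≢i α x (trans (sym (φ-old x)) (trans eq (φ-new i))))
      ... | old x | old y with punchIn-injective α x y (trans (sym (φ-old x)) (trans eq (φ-old y)))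
      ... | refl = ε
      go : ∀ {x y u v} → Connected GH x y → φ u ≡ x → φ v ≡ y → Connected GF u v
      go ε ux vy = same-image (trans ux (sym vy))
      go (s ◅ ss) ux vy with adjH⁻ s
      ... | e , c≡ , ex , ez with inc-lift ex | inc-lift ez
      ... | x′ , x′≡ , ex′ | z′ , z′≡ , ez′ = same-image (trans ux (sym x′≡)) ◅◅ (adjF⁺ e c≡ ex′ ez′ ◅ go ss z′≡ vy)

    same-components : ∀ {cF cH} → HasComponents GF cF → HasComponents GH cH → (cF ≡ cH) ⇔ PartsConnected
    same-components hF hH = mk⇔
      (λ eq i i′ → Equivalence.to equiv eq _ _ (subst₂ (Connected GH) (sym (φ-new i)) (sym (φ-new i′)) ε))
      (λ parts → Equivalence.from equiv (reflects parts))
      where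
      equiv = equal-components φ ψ φψ φ-connected hF hH

    PartsLinked : Set
    PartsLinked = ∀ i i′ → Star (Linked col Q.label R.part j) i i′

    -- Consecutive edges of the path share a vertex other than α, which survives in the detachment.
    wing-connected : ∀ {e e′ x y} → Star Adj e e′ → col e ≡ j → IncF e x → IncF e′ y → Connected GF x y
    wing-connected ε c≡ ex ey = adjF⁺ _ c≡ ex ey ◅ ε
    wing-connected {e} ((c≡′ , v , v≢α , ev , e₁v) ◅ ss) c≡ ex e′y =
      adjF⁺ e c≡ ex (old-inc ev) ◅ wing-connected ss (trans (sym c≡′) c≡) (old-inc e₁v) e′y
      where
      old-inc : ∀ {e} → IncH e v → IncF e (n₁ ↑ʳ punchOut (v≢α ∘ sym))
      old-inc {e} ev = subst (0 <_) (sym (trans (lookup-old e _) (cong (lookup (ed e)) (punchIn-punchOut (v≢α ∘ sym))))) ev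

    linked⇒connected : PartsLinked → PartsConnected
    linked⇒connected linked i i′ = go (linked i i′)
      where
      go : ∀ {i i′} → Star (Linked col Q.label R.part j) i i′ → Connected GF (i ↑ˡ m) (i′ ↑ˡ m)
      go ε = ε
      go ((e , e′ , c≡ , _ , l≡ , i∈ , i′∈) ◅ ss) = wing-connected (Q.sound l≡) c≡ (inc-part i∈) (inc-part i′∈) ◅◅ go ss

    connected⇒linked : PartsConnected → PartsLinked
    connected⇒linked parts i i′ = Reached-new (reach (parts i i′) (start i refl))
      where
      -- Invariant along a path in the detachment: at an old vertex, it remembers a part reached so
      -- far and the wing through which that part was left. Edges meeting at an old vertex have the
      -- same label, so the wing changes only at parts.
      data Reached : Fin (n₁ + m) → Set where
        at-new : ∀ {v} i′ → v ≡ i′ ↑ˡ m → Star (Linked col Q.label R.part j) i i′ → Reached v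
        at-old : ∀ {v} u {i′ e e′} → v ≡ n₁ ↑ʳ u → Star (Linked col Q.label R.part j) i i′ →
                 col e ≡ j → col e′ ≡ j → Q.label e ≡ Q.label e′ → lookup (R.part e) i′ ≡ true → IncF e′ (n₁ ↑ʳ u) → Reached v
      start : ∀ i′ → i ≡ i′ → Reached (i′ ↑ˡ m)
      start i′ refl = at-new i′ refl ε
      new≢old : ∀ {i u} → i ↑ˡ m ≢ n₁ ↑ʳ u
      new≢old {i} {u} eq with trans (sym (splitAt-↑ˡ n₁ i m)) (trans (cong (splitAt n₁) eq) (splitAt-↑ʳ n₁ m u))
      ... | ()
      Reached-new : ∀ {i′} → Reached (i′ ↑ˡ m) → Star (Linked col Q.label R.part j) i i′
      Reached-new (at-new i″ eq path) = subst (Star _ i) (sym (↑ˡ-injective m _ i″ eq)) path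
      Reached-new (at-old u eq _ _ _ _ _ _) = ⊥-elim (new≢old eq)
      share-label : ∀ {e e′ u} → col e ≡ j → col e′ ≡ j → IncF e (n₁ ↑ʳ u) → IncF e′ (n₁ ↑ʳ u) → Q.label e ≡ Q.label e′
      share-label {e} {e′} {u} c≡ c≡′ eu e′u = Q.complete (trans c≡ (sym c≡′) , punchIn α u , punchInᵢ≢i α u ,
        subst (0 <_) (lookup-old e u) eu , subst (0 <_) (lookup-old e′ u) e′u)
      step : ∀ {x y} → Reached x → Adjacent GF x y → Reached y
      step {x} {y} r adj with adjF⁻ adj
      ... | f , f≡ , fx , fy with r | view y
      ... | at-new i₁ refl path | new i₂ = at-new i₂ refl (path ◅◅ ((f , f , f≡ , f≡ , refl , part-inc fx , part-inc fy) ◅ ε))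
      ... | at-new i₁ refl path | old u = at-old u refl path f≡ f≡ refl (part-inc fx) fy
      ... | at-old u refl path e≡ e′≡ l≡ i∈ e′u | new i₂ =
        at-new i₂ refl (path ◅◅ ((_ , f , e≡ , f≡ , trans l≡ (share-label e′≡ f≡ e′u fx) , i∈ , part-inc fy) ◅ ε))
      ... | at-old u refl path e≡ e′≡ l≡ i∈ e′u | old u₂ =
        at-old u₂ refl path e≡ f≡ (trans l≡ (share-label e′≡ f≡ e′u fx)) i∈ fy
      reach : ∀ {x y} → Connected GF x y → Reached x → Reached y
      reach ε r = r
      reach (s ◅ ss) r = reach ss (step r s)

    linked⇔excess : PartsLinked ⇔ (n′ ≤ excess col Q.label p j)
    linked⇔excess = mk⇔
      (λ linked → s≤s⁻¹ (connected⇒excess col Q.label p R.part R.size≡ j linked))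
      (λ large → R.connected j (s≤s large))

    pos : Fin (length GH) → Fin edgeCount
    pos = proj₁ (picked (λ ec → proj₂ ec Fin.≟ j) proj₁ (edges H))
    lookup-GH : ∀ i → List.lookup GH i ≡ ed (pos i)
    lookup-GH = proj₁ (proj₂ (picked (λ ec → proj₂ ec Fin.≟ j) proj₁ (edges H)))
    col-pos : ∀ i → col (pos i) ≡ j
    col-pos = proj₁ (proj₂ (proj₂ (picked (λ ec → proj₂ ec Fin.≟ j) proj₁ (edges H))))
    pos-surjective : ∀ e → col e ≡ j → ∃ λ i → pos i ≡ e
    pos-surjective = proj₁ (proj₂ (proj₂ (proj₂ (picked (λ ec → proj₂ ec Fin.≟ j) proj₁ (edges H)))))
    pos-injective : ∀ {i i′} → pos i ≡ pos i′ → i ≡ i′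
    pos-injective = proj₂ (proj₂ (proj₂ (proj₂ (picked (λ ec → proj₂ ec Fin.≟ j) proj₁ (edges H)))))

    inc-pos⁺ : ∀ {i v} → IncH (pos i) v → Incident GH i v
    inc-pos⁺ {i} {v} = subst (λ x → 0 < lookup x v) (sym (lookup-GH i))
    inc-pos⁻ : ∀ {i v} → Incident GH i v → IncH (pos i) v
    inc-pos⁻ {i} {v} = subst (λ x → 0 < lookup x v) (lookup-GH i)

    share-path : ∀ {e e′ i i′} → Star Adj e e′ → pos i ≡ e → pos i′ ≡ e′ →
           Star (λ i i′ → ∃ λ v → v ≢ α × Incident GH i v × Incident GH i′ v) i i′
    share-path ε i≡ i′≡ with pos-injective (trans i≡ (sym i′≡))
    ... | refl = ε
    share-path {i = i} ((c≡ , v , v≢α , ev , e₁v) ◅ ss) refl i′≡ with pos-surjective _ (trans (sym c≡) (col-pos i))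
    ... | i₁ , refl = (v , v≢α , inc-pos⁺ ev , inc-pos⁺ e₁v) ◅ share-path ss refl i′≡

    incident-vertex : ∀ i → ∃ λ v → Incident GH i v
    incident-vertex i = let v , iv = sum-pos (ed (pos i)) (nonempty-ed (pos i)) in v , inc-pos⁺ iv

    label : Fin (length GH) → Fin (Quotient.count quot)
    label i = Q.label (pos i)

    label-sound : ∀ {i i′} → label i ≡ label i′ → Star (λ i i′ → ∃ λ v → v ≢ α × Incident GH i v × Incident GH i′ v) i i′
    label-sound eq = share-path (Q.sound eq) refl refl

    label-complete : ∀ {i i′ v} → v ≢ α → Incident GH i v → Incident GH i′ v → label i ≡ label i′
    label-complete {i} {i′} {v} v≢α iv i′v =
      Q.complete (trans (col-pos i) (sym (col-pos i′)) , v , v≢α , inc-pos⁻ iv , inc-pos⁻ i′v)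

    module W = Wings GH α incident-vertex label label-sound label-complete

    -- Label by label, `d` is `d ∸ 1` plus 1 if `d` is positive, and a label is a wing exactly when
    -- `d` is positive.
    excess+wings : ∀ {w} → WingCount GH α w → excess col Q.label p j + w ≡ deg GH α
    excess+wings {w} count = begin
      excess col Q.label p j + w
        ≡⟨ cong (excess col Q.label p j +_) (trans (W.wing-count count) (∑-cong active (allFin _))) ⟩
      excess col Q.label p j + ∑ (allFin _) (λ l → 𝟙 (0 <? d l))
        ≡⟨ ∑-+ (allFin _) (λ l → d l ∸ 1) (λ l → 𝟙 (0 <? d l)) ⟨
      ∑ (allFin _) (λ l → (d l ∸ 1) + 𝟙 (0 <? d l))
        ≡⟨ ∑-cong (λ l → trans (pred-pos (d l)) (sym (*-identityˡ (d l)))) (allFin _) ⟩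
      ∑ (allFin _) (λ l → 1 * d l)
        ≡⟨ wingDeg-sum col Q.label p j (λ _ → 1) ⟨
      ∑ (allFin edgeCount) (λ e → 𝟙 (col e Fin.≟ j) * (1 * p e))
        ≡⟨ ∑-cong (λ e → cong (𝟙 (col e Fin.≟ j) *_) (*-identityˡ (p e))) (allFin edgeCount) ⟩
      ∑ (allFin edgeCount) (λ e → 𝟙 (col e Fin.≟ j) * p e)
        ≡⟨ ∑-H (just j) (λ x → lookup x α) ⟨
      deg GH α ∎
      where
      open ≡-Reasoning
      d = wingDeg col Q.label p j
      pred-pos : ∀ x → (x ∸ 1) + 𝟙 (0 <? x) ≡ x
      pred-pos zero = refl
      pred-pos (suc x) = +-comm x 1
      active : ∀ l → 𝟙 (W.active? l) ≡ 𝟙 (0 <? d l)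
      active l = 𝟙-cong (W.active? l) (0 <? d l) to from
        where
        to : (∃ λ i → Q.label (pos i) ≡ l × Incident GH i α) → 0 < d l
        to (i , refl , iα) = ≤-trans (inc-pos⁻ iα)
          (subst (λ j′ → p (pos i) ≤ wingDeg col Q.label p j′ (Q.label (pos i))) (col-pos i) (pos-wingDeg col Q.label p (pos i)))
        from : 0 < d l → ∃ λ i → Q.label (pos i) ≡ l × Incident GH i α
        from lt with wingDeg-pos col Q.label p j l lt
        ... | e , c≡ , l≡ , eα with pos-surjective e c≡
        ... | i , refl = i , l≡ , inc-pos⁺ eα

    components-iff : ∀ cF cH w → HasComponents GF cF → HasComponents GH cH → WingCount GH α w →
                     (cF ≡ cH) ⇔ (n′ + w ≤ deg GH α)
    components-iff cF cH w hF hH count = mk⇔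
      (λ eq → ≤-trans (+-monoˡ-≤ w (Equivalence.to linked⇔excess (connected⇒linked (Equivalence.to (same-components hF hH) eq))))
                      (≤-reflexive (excess+wings count)))
      (λ le → Equivalence.from (same-components hF hH) (linked⇒connected (Equivalence.from linked⇔excess
        (+-cancelʳ-≤ w _ _ (≤-trans le (≤-reflexive (sym (excess+wings count))))))))

theorem1p1 : (k n : ℕ) → .{{_ : NonZero k}} → .{{_ : NonZero n}} →
    (m : ℕ) (H : CHyp (suc m) k) (α : Fin (suc m)) →
    (∀ (t : ℕ) (Y : MSet (suc m)) → n + 1 ≤ t → mult (underlying H) (addCopies α t Y) ≡ 0) →
    Σ (CHyp (n + m) k) λ F →
    IsDetachment α n F H × αSimple n F ×
    (∀ (i : Fin n) → deg (underlying F) (αᵢ m i) ≈ deg (underlying H) α / n) ×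
    (∀ (i : Fin n) (j : Fin k) → deg (colourClass F j) (αᵢ m i) ≈ deg (colourClass H j) α / n) ×
    (∀ (U : Subset n) (X : MSet m) →
    mult (underlying F) (detMS U X) ≈ mult (underlying H) (origMS α ∣ U ∣ X) / (n C ∣ U ∣)) ×
    (∀ (U : Subset n) (X : MSet m) (j : Fin k) →
    mult (colourClass F j) (detMS U X) ≈ mult (colourClass H j) (origMS α ∣ U ∣ X) / (n C ∣ U ∣)) ×
    (∀ (j : Fin k) (cF cH w : ℕ) →
    HasComponents (colourClass F j) cF → HasComponents (colourClass H j) cH →
    WingCount (colourClass H j) α w →
    ((cF ≡ cH) ⇔ (n ∸ 1 + w ≤ deg (colourClass H j) α)))
theorem1p1 k (suc n′) m H α bounded =
  D.F , D.isDetachment , D.simple , D.degrees nothing , (λ i j → D.degrees (just j) i) ,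
  D.mults nothing , (λ U X j → D.mults (just j) U X) , D.Coloured.components-iff
  where
  module E = EdgeData H α
  quot : Quotient E.Adj
  quot = quotient E.adj? E.adj-sym
  module D = Detach n′ H α quot (split E.col (suc n′) _≟ᵉ_ E.rest (Quotient.label quot) E.p (E.p≤n (suc n′) bounded))
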